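{- There exists a natural number $k$ such that every $k$-edge-connected graph $G$ with $|E(G)|$ divisible by $5$ admits a $P_5$-decomposition, i.e. $E(G)$ can be partitioned into sets each of which is the edge set of a subgraph of $G$ isomorphic to $P_5$, the path with $5$ edges.
   Context: Graphs are finite and have no loops or multiple edges. $P_5$ denotes the path of length $5$ (five edges, six vertices). A decomposition of $G$ into copies of $H$ is a set of pairwise edge-disjoint subgraphs of $G$, each isomorphic to $H$, whose union is $G$. -}

module Defs where

open import Data.Nat using (ℕ; _<_)
open import Data.Fin as Fin using (Fin; zero; suc)
open import Data.Fin.Properties using (_≟_)
open import Data.Bool using (Bool; true; false)
open import Data.Product using (_×_; _,_; Σ)
open import Data.Product.Properties using (≡-dec)
open import Data.Sum using (_⊎_)
open import Data.List using (List; []; _∷_; length; concatMap; allFin; filter)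
open import Data.List.Membership.Propositional using (_∈_)
open import Data.Vec using (Vec; lookup)
open import Function.Definitions using (Injective)
open import Relation.Nullary using (¬_; Dec)
open import Relation.Nullary.Decidable using (_⊎-dec_; _×-dec_)
open import Relation.Binary.PropositionalEquality using (_≡_)
import Data.Fin as F

record Graph (n : ℕ) : Set where
  field
    adj    : Fin n → Fin n → Bool
    sym    : ∀ i j → adj i j ≡ adj j i
    irrefl : ∀ i → adj i i ≡ false
open Graph public

Edge : ℕ → Set
Edge n = Fin n × Fin n

edges : ∀ {n} → Graph n → List (Edge n)
edges {n} G =
  concatMap (λ i → concatMap (λ j → pairIf i j) (allFin n)) (allFin n)
  where
    pairIf : Fin n → Fin n → List (Edge n)
    pairIf i j with i F.<? j | adj G i j
    ... | Relation.Nullary.yes _ | true = (i , j) ∷ []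
    ... | _ | _ = []

SameEdge : ∀ {n} → Edge n → Edge n → Set
SameEdge (u , v) e = (e ≡ (u , v)) ⊎ (e ≡ (v , u))

sameEdge? : ∀ {n} (x e : Edge n) → Dec (SameEdge x e)
sameEdge? (u , v) e = ≡-dec _≟_ _≟_ e (u , v) ⊎-dec ≡-dec _≟_ _≟_ e (v , u)

AdjMinus : ∀ {n} → Graph n → List (Edge n) → Fin n → Fin n → Set
AdjMinus G F u v = (adj G u v ≡ true) × ¬ (((u , v) ∈ F) ⊎ ((v , u) ∈ F))

data Reach {n} (G : Graph n) (F : List (Edge n)) (u : Fin n) : Fin n → Set where
  here : Reach G F u u
  step : ∀ {v w} → Reach G F u v → AdjMinus G F v w → Reach G F u w

ConnectedMinus : ∀ {n} → Graph n → List (Edge n) → Set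
ConnectedMinus {n} G F = ∀ (u v : Fin n) → Reach G F u v

Connected : ∀ {n} → Graph n → Set
Connected G = ConnectedMinus G []

-- k-edge-connected: G − F is connected for every set F of fewer than k edges.
-- (A list F of length < k deletes a set of fewer than k edges of G, and every
--  set of fewer than k edges arises this way.)
EdgeConnected : ℕ → ∀ {n} → Graph n → Set
EdgeConnected k {n} G = ∀ (F : List (Edge n)) → length F < k → ConnectedMinus G F

record P5In {n} (G : Graph n) : Set where
  field
    vtx    : Fin 6 → Fin n
    inj    : Injective _≡_ _≡_ vtx
    isPath : ∀ (t : Fin 5) → adj G (vtx (F.inject₁ t)) (vtx (suc t)) ≡ true
open P5In public

p5Edges : ∀ {n} {G : Graph n} → P5In G → List (Edge n)
p5Edges P = Data.List.map (λ t → (vtx P (F.inject₁ t) , vtx P (suc t))) (allFin 5)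

-- A P₅-decomposition: a family of copies of P₅ in G such that every edge of G
-- lies in exactly one of them (edge-disjoint, and their union is E(G);
-- path edges are edges of G by isPath).
P5Decomposition : ∀ {n} → Graph n → Set
P5Decomposition {n} G =
  Σ (List (P5In G)) λ Ps →
    ∀ (e : Edge n) → e ∈ edges G →
      length (filter (sameEdge? e) (concatMap p5Edges Ps)) ≡ 1

{-# OPTIONS --safe #-}

{- A connected graph with even degrees whose number of edges is divisible by 5
is cut by an Euler tour into trails of length 5.  So it suffices to remove
5-trails from G until all degrees are even, without disconnecting it, and then
to exchange ends of 5-trails until all of them are paths.

A maximum cut gives a highly edge-connected spanning bipartite subgraph H, with
sides A and B.  Intersecting copies of its graphic matroid with a partition
matroid gives edge-disjoint connected spanning subgraphs T₁, T₂, T₃ of H that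
use a small proportion of the edges at every vertex of B, and leave large
degrees everywhere.  In what is left, further matroid intersections grow
edge-disjoint trees of bounded size, each private to its root.

T₁ together with a parity join in T₂ has an Euler tour a₀ b₀ a₁ b₁ … .  A
private path of length 4 at bᵢ is completed to a removed 5-trail by aᵢ bᵢ or by
bᵢ aᵢ₊₁; switching between the two changes the parity of the degrees of aᵢ and
aᵢ₊₁ only.  Removing or keeping a private 5-trail from b ∈ B to A changes the
parity at b and at a vertex of A.  Hence every set of vertices arising as the
odd vertices of a graph can be corrected, while T₃ keeps the rest connected.

Finally, every vertex v owns a few reserved paths which meet only near v.  A
trail through v can exchange its end at v with that of any of them; each
obstruction to the results being paths excludes at most one reserved path.
Exchanging ends of length 2 at the middle of a trail and then its first and
last edges turns all trails into paths. -}
module Submission where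

open import Data.Nat
open import Data.Nat.Properties
open import Data.Nat.Tactic.RingSolver using (solve-∀)
open import Data.Bool using (Bool; true; false; _∧_; _∨_; not; if_then_else_; _xor_; f≤t; b≤b)
import Data.Bool as B
open import Data.Fin as Fin using (Fin; zero; suc)
import Data.Fin.Properties as Finₚ
import Data.Vec as V
open import Data.Vec using (Vec; []; _∷_; take; drop; replicate; toList)
open import Data.List using (List; []; _∷_; _++_; length; concatMap)
import Data.List as L
import Data.List.Properties as Lₚ
open import Data.List.Relation.Unary.All using (All; []; _∷_)
import Data.List.Relation.Unary.All as All
import Data.Bool.Properties as Bₚ
open import Data.List.Relation.Binary.Permutation.Propositional using (_↭_; ↭-refl; ↭-sym; ↭-trans; ↭-reflexive)
import Data.List.Relation.Binary.Permutation.Propositional as Perm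
import Data.List.Relation.Binary.Permutation.Propositional.Properties as Permₚ
import Data.List.Membership.Propositional.Properties as ∈ₚ
import Data.List.Relation.Unary.All.Properties as Allₚ
open import Data.Nat.DivMod using (_/_; m/n*n≤m; m≡m%n+[m/n]*n; m%n<n)
import Data.Vec.Relation.Unary.Unique.Propositional as VecU
import Data.Vec.Relation.Unary.Unique.Propositional.Properties as VecUₚ
import Data.Vec.Relation.Unary.All as VA
import Data.Vec.Relation.Unary.AllPairs as VP
open import Data.Nat.Divisibility using (_∣_; divides; quotient; ∣m∣n⇒∣m+n; ∣m+n∣m⇒∣n)
open import Data.Unit using (⊤; tt)
open import Data.Vec.Properties using (take-zipWith; drop-zipWith; take-map; drop-map)
open import Data.Fin.Subset using (Subset; _∪_; _∩_; ∁; ⊥; ∣_∣)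
open import Data.Fin.Subset.Properties using (anySubset?)
open import Data.Product
open import Data.Sum using (_⊎_; inj₁; inj₂)
open import Data.Empty using () renaming (⊥ to ⊥₀; ⊥-elim to ⊥₀-elim)
open import Relation.Nullary
open import Relation.Nullary.Decidable using (dec-true; dec-false; _⊎-dec_; _×-dec_)
open import Relation.Binary.PropositionalEquality hiding ([_])
open import Relation.Binary using (IsEquivalence)
open import Function using (_∘_; id; case_of_)
open import Defs hiding (sym)
open import Data.List.Membership.Propositional using (_∈_)
import Data.List.Relation.Unary.Any as Any
open import Data.List.Relation.Unary.Any using (here; there)
open import Data.Vec.Properties using (lookup∘tabulate; toList∘fromList)

-- The bipartition is forced by the tool. Matroid intersection admits one further matroid beside the
-- union of the graphic ones. The edges of H are partitioned by their ends in B, so a single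
-- partition matroid bounds the degrees on B, but on B only. That is where the bound is required: a
-- link of the tour is charged to its centre b, and each link consumes a private tree there. Such a
-- tree demands about q edges at b, so the tour may use only a fraction of order 1/q of the degree
-- of b.
--
-- Each removable trail is treated as an auxiliary edge joining the two vertices whose parity it
-- switches. Links join consecutive A-vertices of the tour, and a trail of odd length joins a vertex
-- of B to A. Hence the auxiliary graph is connected and the correction is a parity join in it.
-- Every state removes 0 or 5 edges, so divisibility by 5 survives. The reserved paths are set aside
-- before parities are computed; they come in groups of five edges too and return as members of the
-- decomposition.

+-interchange : ∀ a b c d → (a + b) + (c + d) ≡ (a + c) + (b + d)
+-interchange = solve-∀

+-left-comm : ∀ a b c → a + (b + c) ≡ b + (a + c)
+-left-comm = solve-∀

-- Indicators and finite sums

⟦_⟧ : Bool → ℕ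
⟦ true ⟧  = 1
⟦ false ⟧ = 0

infix 5 _==_
_==_ : ∀ {n} → Fin n → Fin n → Bool
i == j = does (i Finₚ.≟ j)

==-refl : ∀ {n} (i : Fin n) → (i == i) ≡ true
==-refl i = dec-true (i Finₚ.≟ i) refl

==-≢ : ∀ {n} {i j : Fin n} → i ≢ j → (i == j) ≡ false
==-≢ {i = i} {j} p = dec-false (i Finₚ.≟ j) p

==-true : ∀ {n} {i j : Fin n} → (i == j) ≡ true → i ≡ j
==-true {i = i} {j} p with i Finₚ.≟ j
... | yes q = q

==-sym : ∀ {n} (i j : Fin n) → (i == j) ≡ (j == i)
==-sym i j with i Finₚ.≟ j
... | yes refl = sym (==-refl i)
... | no  p    = sym (==-≢ (p ∘ sym))

==-suc : ∀ {n} (i j : Fin n) → (suc i == suc j) ≡ (i == j)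
==-suc i j with i Finₚ.≟ j
... | yes _ = refl
... | no _  = refl

opaque
  ∑ : ∀ {n} → (Fin n → ℕ) → ℕ
  ∑ {zero}  f = 0
  ∑ {suc n} f = f zero + ∑ (f ∘ suc)

  ∑-cong : ∀ {n} {f g : Fin n → ℕ} → (∀ i → f i ≡ g i) → ∑ f ≡ ∑ g
  ∑-cong {zero}  h = refl
  ∑-cong {suc n} h = cong₂ _+_ (h zero) (∑-cong (h ∘ suc))

  ∑-mono : ∀ {n} {f g : Fin n → ℕ} → (∀ i → f i ≤ g i) → ∑ f ≤ ∑ g
  ∑-mono {zero}  h = z≤n
  ∑-mono {suc n} h = +-mono-≤ (h zero) (∑-mono (h ∘ suc))

  ∑-+ : ∀ {n} (f g : Fin n → ℕ) → ∑ (λ i → f i + g i) ≡ ∑ f + ∑ g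
  ∑-+ {zero}  f g = refl
  ∑-+ {suc n} f g = trans (cong (f zero + g zero +_) (∑-+ (f ∘ suc) (g ∘ suc))) (+-interchange (f zero) (g zero) _ _)

  ∑-0 : ∀ n → ∑ {n} (λ _ → 0) ≡ 0
  ∑-0 zero    = refl
  ∑-0 (suc n) = ∑-0 n

  ∑-1 : ∀ n → ∑ {n} (λ _ → 1) ≡ n
  ∑-1 zero    = refl
  ∑-1 (suc n) = cong suc (∑-1 n)

  ∑-* : ∀ {n} k (f : Fin n → ℕ) → ∑ (λ i → k * f i) ≡ k * ∑ f
  ∑-* {zero}  k f = sym (*-zeroʳ k)
  ∑-* {suc n} k f = trans (cong (k * f zero +_) (∑-* k (f ∘ suc))) (sym (*-distribˡ-+ k (f zero) _))

  ∑-swap : ∀ {m n} (f : Fin m → Fin n → ℕ) → ∑ (λ i → ∑ (f i)) ≡ ∑ (λ j → ∑ (λ i → f i j))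
  ∑-swap {zero}  {n} f = sym (∑-0 n)
  ∑-swap {suc m} f = trans (cong (∑ (f zero) +_) (∑-swap (f ∘ suc))) (sym (∑-+ (f zero) (λ j → ∑ (λ i → f (suc i) j))))

  ∑-term : ∀ {n} (f : Fin n → ℕ) i → f i ≤ ∑ f
  ∑-term f zero    = m≤m+n _ _
  ∑-term f (suc i) = ≤-trans (∑-term (f ∘ suc) i) (m≤n+m _ _)

  -- Turns tightness of a total, which is what matroid intersection supplies, into tightness of
  -- every term.
  ∑-squeeze : ∀ {n} {f g : Fin n → ℕ} → (∀ i → f i ≤ g i) → ∑ g ≤ ∑ f → ∀ i → f i ≡ g i
  ∑-squeeze {suc n} {f} {g} h t zero = ≤-antisym (h zero)
    (+-cancelʳ-≤ (∑ (f ∘ suc)) _ _ (≤-trans (+-monoʳ-≤ (g zero) (∑-mono (h ∘ suc))) t))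
  ∑-squeeze {suc n} {f} {g} h t (suc i) = ∑-squeeze (h ∘ suc)
    (+-cancelˡ-≤ (f zero) _ _ (≤-trans (+-monoˡ-≤ _ (h zero)) t)) i

  ∑-δ : ∀ {n} (j : Fin n) → ∑ (λ i → ⟦ j == i ⟧) ≡ 1
  ∑-δ {suc n} zero    = cong suc (∑-0 n)
  ∑-δ {suc n} (suc j) = trans (∑-cong (λ i → cong ⟦_⟧ (==-suc j i))) (∑-δ j)

  -- The two sums differ by the difference at j; it is written additively because subtraction of
  -- naturals truncates.
  ∑-update : ∀ {n} (f g : Fin n → ℕ) j → (∀ i → i ≢ j → f i ≡ g i) → ∑ f + g j ≡ ∑ g + f j
  ∑-update {suc n} f g zero h = begin
    f zero + ∑ (f ∘ suc) + g zero  ≡⟨ cong (λ x → f zero + x + g zero) (∑-cong (λ i → h (suc i) (λ ()))) ⟩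
    f zero + ∑ (g ∘ suc) + g zero  ≡⟨ rot (f zero) _ (g zero) ⟩
    g zero + ∑ (g ∘ suc) + f zero  ∎
    where open ≡-Reasoning
          rot : ∀ a b c → a + b + c ≡ c + b + a
          rot = solve-∀
  ∑-update {suc n} f g (suc j) h = begin
    f zero + ∑ (f ∘ suc) + g (suc j)  ≡⟨ +-assoc (f zero) _ _ ⟩
    f zero + (∑ (f ∘ suc) + g (suc j))  ≡⟨ cong₂ _+_ (h zero (λ ())) (∑-update (f ∘ suc) (g ∘ suc) j (λ i p → h (suc i) (λ q → p (Finₚ.suc-injective q)))) ⟩
    g zero + (∑ (g ∘ suc) + f (suc j))  ≡⟨ sym (+-assoc (g zero) _ _) ⟩
    g zero + ∑ (g ∘ suc) + f (suc j)  ∎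
    where open ≡-Reasoning

-- Matroid rank functions on Fin m and the matroid intersection theorem

infix 4 _⊑_
-- Bitwise, so that proofs follow the induction on the first ground element, the one to be deleted
-- or contracted.
data _⊑_ : ∀ {m} → Subset m → Subset m → Set where
  []  : [] ⊑ []
  _∷_ : ∀ {m a b} {X Y : Subset m} → a B.≤ b → X ⊑ Y → (a ∷ X) ⊑ (b ∷ Y)

⊑-refl : ∀ {m} (X : Subset m) → X ⊑ X
⊑-refl []      = []
⊑-refl (_ ∷ X) = b≤b ∷ ⊑-refl X

⊑-trans : ∀ {m} {X Y Z : Subset m} → X ⊑ Y → Y ⊑ Z → X ⊑ Z
⊑-trans [] [] = []
⊑-trans (b≤b ∷ p) (q ∷ r) = q ∷ ⊑-trans p r
⊑-trans (f≤t ∷ p) (b≤b ∷ r) = f≤t ∷ ⊑-trans p r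

⊥⊑ : ∀ {m} (X : Subset m) → ⊥ ⊑ X
⊥⊑ []          = []
⊥⊑ (true ∷ X)  = f≤t ∷ ⊥⊑ X
⊥⊑ (false ∷ X) = b≤b ∷ ⊥⊑ X

⊑∪ˡ : ∀ {m} (X Y : Subset m) → X ⊑ X ∪ Y
⊑∪ˡ [] [] = []
⊑∪ˡ (true ∷ X) (_ ∷ Y)      = b≤b ∷ ⊑∪ˡ X Y
⊑∪ˡ (false ∷ X) (true ∷ Y)  = f≤t ∷ ⊑∪ˡ X Y
⊑∪ˡ (false ∷ X) (false ∷ Y) = b≤b ∷ ⊑∪ˡ X Y

⊑∪ʳ : ∀ {m} (X Y : Subset m) → Y ⊑ X ∪ Y
⊑∪ʳ [] [] = []
⊑∪ʳ (true ∷ X) (true ∷ Y)   = b≤b ∷ ⊑∪ʳ X Y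
⊑∪ʳ (true ∷ X) (false ∷ Y)  = f≤t ∷ ⊑∪ʳ X Y
⊑∪ʳ (false ∷ X) (_ ∷ Y)     = b≤b ∷ ⊑∪ʳ X Y

∩⊑ˡ : ∀ {m} (X Y : Subset m) → X ∩ Y ⊑ X
∩⊑ˡ [] [] = []
∩⊑ˡ (true ∷ X) (true ∷ Y)   = b≤b ∷ ∩⊑ˡ X Y
∩⊑ˡ (true ∷ X) (false ∷ Y)  = f≤t ∷ ∩⊑ˡ X Y
∩⊑ˡ (false ∷ X) (_ ∷ Y)     = b≤b ∷ ∩⊑ˡ X Y

∩⊑ʳ : ∀ {m} (X Y : Subset m) → X ∩ Y ⊑ Y
∩⊑ʳ [] [] = []
∩⊑ʳ (true ∷ X) (_ ∷ Y)      = b≤b ∷ ∩⊑ʳ X Y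
∩⊑ʳ (false ∷ X) (true ∷ Y)  = f≤t ∷ ∩⊑ʳ X Y
∩⊑ʳ (false ∷ X) (false ∷ Y) = b≤b ∷ ∩⊑ʳ X Y

⊑-∩ : ∀ {m} {Z X Y : Subset m} → Z ⊑ X → Z ⊑ Y → Z ⊑ X ∩ Y
⊑-∩ [] [] = []
⊑-∩ (b≤b {true} ∷ p)  (b≤b ∷ q) = b≤b ∷ ⊑-∩ p q
⊑-∩ (b≤b {false} ∷ p) (_ ∷ q)   = b≤b ∷ ⊑-∩ p q
⊑-∩ (f≤t ∷ p) (f≤t ∷ q) = f≤t ∷ ⊑-∩ p q
⊑-∩ (f≤t ∷ p) (b≤b ∷ q) = b≤b ∷ ⊑-∩ p q

⊑-∪-lub : ∀ {m} {Z X Y : Subset m} → X ⊑ Z → Y ⊑ Z → X ∪ Y ⊑ Z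
⊑-∪-lub [] [] = []
⊑-∪-lub (b≤b {true} ∷ p) (_ ∷ q) = b≤b ∷ ⊑-∪-lub p q
⊑-∪-lub (b≤b {false} ∷ p) (b≤b ∷ q) = b≤b ∷ ⊑-∪-lub p q
⊑-∪-lub (f≤t ∷ p) (f≤t ∷ q) = f≤t ∷ ⊑-∪-lub p q
⊑-∪-lub (f≤t ∷ p) (b≤b ∷ q) = b≤b ∷ ⊑-∪-lub p q

∪-mono : ∀ {m} {X X′ Y Y′ : Subset m} → X ⊑ X′ → Y ⊑ Y′ → X ∪ Y ⊑ X′ ∪ Y′
∪-mono {X′ = X′} {Y′ = Y′} p q = ⊑-∪-lub (⊑-trans p (⊑∪ˡ X′ Y′)) (⊑-trans q (⊑∪ʳ X′ Y′))

⊑-take : ∀ m {n} {X Y : Subset (m + n)} → X ⊑ Y → take m X ⊑ take m Y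
⊑-take zero    p       = []
⊑-take (suc m) {X = _ ∷ _} {_ ∷ _} (q ∷ p) = q ∷ ⊑-take m p

⊑-drop : ∀ m {n} {X Y : Subset (m + n)} → X ⊑ Y → drop m X ⊑ drop m Y
⊑-drop zero    p       = p
⊑-drop (suc m) {X = _ ∷ _} {_ ∷ _} (q ∷ p) = ⊑-drop m p

∁-∪ : ∀ {m} (X Y : Subset m) → ∁ (X ∪ Y) ≡ ∁ X ∩ ∁ Y
∁-∪ [] [] = refl
∁-∪ (true ∷ X) (_ ∷ Y)  = cong (false ∷_) (∁-∪ X Y)
∁-∪ (false ∷ X) (b ∷ Y) = cong (not b ∷_) (∁-∪ X Y)

∁-∩ : ∀ {m} (X Y : Subset m) → ∁ (X ∩ Y) ≡ ∁ X ∪ ∁ Y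
∁-∩ [] [] = refl
∁-∩ (true ∷ X) (b ∷ Y)  = cong (not b ∷_) (∁-∩ X Y)
∁-∩ (false ∷ X) (_ ∷ Y) = cong (true ∷_) (∁-∩ X Y)

∣∣-∷ : ∀ {m} b (X : Subset m) → ∣ b ∷ X ∣ ≡ ⟦ b ⟧ + ∣ X ∣
∣∣-∷ true  X = refl
∣∣-∷ false X = refl

∣⊥∣ : ∀ m → ∣ ⊥ {m} ∣ ≡ 0
∣⊥∣ zero    = refl
∣⊥∣ (suc m) = ∣⊥∣ m

-- `unit` bounds singletons by 1 and forces `r ⊥ ≡ 0`, which distinguishes matroid ranks from
-- general polymatroid functions.
record IsRank {m} (r : Subset m → ℕ) : Set where
  field
    mono   : ∀ {X Y} → X ⊑ Y → r X ≤ r Y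
    submod : ∀ X Y → r (X ∪ Y) + r (X ∩ Y) ≤ r X + r Y
    unit   : ∀ X → r X ≤ ∣ X ∣
open IsRank

delete : ∀ {m} → (Subset (suc m) → ℕ) → Subset m → ℕ
delete r X = r (false ∷ X)

-- The 1 stands for the rank of the contracted element, so this is the matroid contraction only when
-- that element is not a loop.
contract : ∀ {m} → (Subset (suc m) → ℕ) → Subset m → ℕ
contract r X = r (true ∷ X) ∸ 1

delete-isRank : ∀ {m} {r : Subset (suc m) → ℕ} → IsRank r → IsRank (delete r)
delete-isRank R .mono p = R .mono (b≤b ∷ p)
delete-isRank R .submod X Y = R .submod (false ∷ X) (false ∷ Y)
delete-isRank R .unit X = R .unit (false ∷ X)

∸-merge : ∀ {a b} → 1 ≤ a → 1 ≤ b → (a ∸ 1) + (b ∸ 1) ≡ a + b ∸ 2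
∸-merge {suc a} {suc b} _ _ = cong (_∸ 1) (sym (+-suc a b))

contract-isRank : ∀ {m} {r : Subset (suc m) → ℕ} → IsRank r → 1 ≤ r (true ∷ ⊥) → IsRank (contract r)
contract-isRank R e .mono p = ∸-monoˡ-≤ 1 (R .mono (b≤b ∷ p))
contract-isRank {r = r} R e .submod X Y = begin
  r (true ∷ (X ∪ Y)) ∸ 1 + (r (true ∷ (X ∩ Y)) ∸ 1) ≡⟨ ∸-merge (pos _) (pos _) ⟩
  r (true ∷ (X ∪ Y)) + r (true ∷ (X ∩ Y)) ∸ 2  ≤⟨ ∸-monoˡ-≤ 2 (R .submod (true ∷ X) (true ∷ Y)) ⟩
  r (true ∷ X) + r (true ∷ Y) ∸ 2  ≡⟨ sym (∸-merge (pos _) (pos _)) ⟩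
  r (true ∷ X) ∸ 1 + (r (true ∷ Y) ∸ 1)  ∎
  where open ≤-Reasoning
        pos : ∀ Z → 1 ≤ r (true ∷ Z)
        pos Z = ≤-trans e (R .mono (b≤b ∷ ⊥⊑ Z))
contract-isRank R e .unit X = ∸-monoˡ-≤ 1 (R .unit (true ∷ X))

r⊥≡0 : ∀ {m} {r : Subset m → ℕ} → IsRank r → r ⊥ ≡ 0
r⊥≡0 {m} R = n≤0⇒n≡0 (≤-trans (R .unit ⊥) (≤-reflexive (∣⊥∣ m)))

∪-⊥ : ∀ {m} (X : Subset m) → X ∪ ⊥ ≡ X
∪-⊥ []          = refl
∪-⊥ (true ∷ X)  = cong (true ∷_) (∪-⊥ X)
∪-⊥ (false ∷ X) = cong (false ∷_) (∪-⊥ X)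

add-head : ∀ {m} {r : Subset (suc m) → ℕ} → IsRank r → ∀ X → r (true ∷ X) ≤ r (false ∷ X) + r (true ∷ ⊥)
add-head {r = r} R X = begin
  r (true ∷ X)  ≡⟨ cong (λ Z → r (true ∷ Z)) (sym (∪-⊥ X)) ⟩
  r (true ∷ (X ∪ ⊥))  ≤⟨ m≤m+n _ _ ⟩
  r (true ∷ (X ∪ ⊥)) + r (false ∷ (X ∩ ⊥)) ≤⟨ R .submod (false ∷ X) (true ∷ ⊥) ⟩
  r (false ∷ X) + r (true ∷ ⊥) ∎
  where open ≤-Reasoning

∸1-≤ : ∀ {t a b} → 1 ≤ a → 1 ≤ b → ¬ (t ≤ a ∸ 1 + (b ∸ 1)) → a + b ≤ suc t
∸1-≤ {t} {suc a} {suc b} _ _ h = s≤s (≤-trans (≤-reflexive (+-suc a b)) (≰⇒> h))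

≤-offset : ∀ {a b} → b ≡ 0 → a + b ≤ a
≤-offset {a} refl = ≤-reflexive (+-identityʳ a)

suc-∸1 : ∀ {a s} → 1 ≤ a → a ∸ 1 ≡ s → a ≡ suc s
suc-∸1 (s≤s _) refl = refl

positive : ∀ {a} → (a ≡ 0 → ⊥₀) → 1 ≤ a
positive {zero}  h = ⊥₀-elim (h refl)
positive {suc a} h = s≤s z≤n

-- If neither deleting nor contracting the first element preserves the
-- hypothesis, submodularity of both ranks applied to the two violating sets
-- contradicts it.
intersection : ∀ {m} {r₁ r₂ : Subset m → ℕ} → IsRank r₁ → IsRank r₂ → ∀ t →
  (∀ X → t ≤ r₁ X + r₂ (∁ X)) → Σ (Subset m) λ I → r₁ I ≡ t × r₂ I ≡ t × ∣ I ∣ ≡ t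
intersection {zero} {r₁} {r₂} R₁ R₂ t h = [] , trans z₁ (sym t≡0) , trans z₂ (sym t≡0) , sym t≡0
  where z₁ = r⊥≡0 R₁
        z₂ = r⊥≡0 R₂
        t≡0 : t ≡ 0
        t≡0 = n≤0⇒n≡0 (≤-trans (h []) (≤-reflexive (cong₂ _+_ z₁ z₂)))
intersection {suc m} {r₁} {r₂} R₁ R₂ t h
  with anySubset? (λ X → ¬? (t ≤? r₁ (false ∷ X) + r₂ (false ∷ ∁ X)))
... | no none = let I , p , q , s = intersection (delete-isRank R₁) (delete-isRank R₂) t
                                     (λ X → decidable-stable (t ≤? _) (λ q → none (X , q)))
                in false ∷ I , p , q , s
intersection {suc m} {r₁} {r₂} R₁ R₂ zero h | yes (X , nX) = ⊥₀-elim (nX z≤n)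
intersection {suc m} {r₁} {r₂} R₁ R₂ (suc t) h | yes (X , nX) = continue
  where
    -- Were the first element a loop of `r₁`, adding it to X would not raise `r₁`, and `h` at the
    -- enlarged set would refute `nX`. For `r₂` the element is left to the complement instead.
    e₁ : 1 ≤ r₁ (true ∷ ⊥)
    e₁ = positive λ z → nX (≤-trans (h (true ∷ X)) (+-monoˡ-≤ _ (≤-trans (add-head R₁ X) (≤-offset z))))
    e₂ : 1 ≤ r₂ (true ∷ ⊥)
    e₂ = positive λ z → nX (≤-trans (h (false ∷ X)) (+-monoʳ-≤ _ (≤-trans (add-head R₂ (∁ X)) (≤-offset z))))
    pos₁ : ∀ Z → 1 ≤ r₁ (true ∷ Z)
    pos₁ Z = ≤-trans e₁ (R₁ .mono (b≤b ∷ ⊥⊑ Z))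
    pos₂ : ∀ Z → 1 ≤ r₂ (true ∷ Z)
    pos₂ Z = ≤-trans e₂ (R₂ .mono (b≤b ∷ ⊥⊑ Z))
    continue : Σ (Subset (suc m)) λ I → r₁ I ≡ suc t × r₂ I ≡ suc t × ∣ I ∣ ≡ suc t
    continue with anySubset? (λ Y → ¬? (t ≤? contract r₁ Y + contract r₂ (∁ Y)))
    ... | no none = let I , p , q , s = intersection (contract-isRank R₁ e₁) (contract-isRank R₂ e₂) t
                                         (λ Y → decidable-stable (t ≤? _) (λ q → none (Y , q)))
                    in true ∷ I , suc-∸1 (pos₁ I) p , suc-∸1 (pos₂ I) q , cong suc s
    -- Uncross X, which fails after deletion, with Y plus the first element, which fails after
    -- contraction. The union takes the element and the intersection leaves it to the complement, so
    -- both are bounded by `h`, and 2t + 2 would be at most 2t + 1.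
    ... | yes (Y , nY) = ⊥₀-elim (1+n≰n (begin
      suc (suc t + t)  ≡⟨ sym (+-suc (suc t) t) ⟩
      suc t + suc t  ≤⟨ +-mono-≤ (h (true ∷ (X ∪ Y))) (h (false ∷ (X ∩ Y))) ⟩
      (u₁ + r₂ (false ∷ ∁ (X ∪ Y))) + (i₁ + r₂ (true ∷ ∁ (X ∩ Y)))  ≡⟨ cong₂ (λ a b → (u₁ + r₂ (false ∷ a)) + (i₁ + r₂ (true ∷ b))) (∁-∪ X Y) (∁-∩ X Y) ⟩
      (u₁ + i₂) + (i₁ + u₂)  ≡⟨ regroup u₁ i₂ i₁ u₂ ⟩
      (u₁ + i₁) + (u₂ + i₂)  ≤⟨ +-mono-≤ (R₁ .submod (false ∷ X) (true ∷ Y)) (R₂ .submod (false ∷ ∁ X) (true ∷ ∁ Y)) ⟩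
      (r₁ (false ∷ X) + r₁ (true ∷ Y)) + (r₂ (false ∷ ∁ X) + r₂ (true ∷ ∁ Y))  ≡⟨ +-interchange (r₁ (false ∷ X)) _ _ _ ⟩
      (r₁ (false ∷ X) + r₂ (false ∷ ∁ X)) + (r₁ (true ∷ Y) + r₂ (true ∷ ∁ Y))  ≤⟨ +-mono-≤ (s≤s⁻¹ (≰⇒> nX)) (∸1-≤ (pos₁ Y) (pos₂ (∁ Y)) nY) ⟩
      t + suc t  ≡⟨ +-comm t (suc t) ⟩
      suc t + t  ∎))
      where
        open ≤-Reasoning
        u₁ = r₁ (true ∷ (X ∪ Y))
        i₁ = r₁ (false ∷ (X ∩ Y))
        u₂ = r₂ (true ∷ (∁ X ∪ ∁ Y))
        i₂ = r₂ (false ∷ (∁ X ∩ ∁ Y))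
        regroup : ∀ a b c d → (a + b) + (c + d) ≡ (a + c) + (d + b)
        regroup = solve-∀

-- Rank of a partition matroid with capacities

col : ∀ {c m} → Vec (Fin c) m → Subset m → Fin c → ℕ
col []      []      i = 0
col (x ∷ χ) (b ∷ X) i = ⟦ b ∧ (x == i) ⟧ + col χ X i

capRank : ∀ {c m} → Vec (Fin c) m → (Fin c → ℕ) → Subset m → ℕ
capRank χ cap X = ∑ λ i → cap i ⊓ col χ X i

∑-col : ∀ {c m} (χ : Vec (Fin c) m) X → ∑ (col χ X) ≡ ∣ X ∣
∑-col {c} []   []      = ∑-0 c
∑-col (x ∷ χ) (b ∷ X) = begin
  ∑ (λ i → ⟦ b ∧ (x == i) ⟧ + col χ X i)  ≡⟨ ∑-+ _ _ ⟩
  ∑ (λ i → ⟦ b ∧ (x == i) ⟧) + ∑ (col χ X)  ≡⟨ cong₂ _+_ (head b) (∑-col χ X) ⟩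
  ⟦ b ⟧ + ∣ X ∣  ≡⟨ sym (∣∣-∷ b X) ⟩
  ∣ b ∷ X ∣  ∎
  where open ≡-Reasoning
        head : ∀ b → ∑ (λ i → ⟦ b ∧ (x == i) ⟧) ≡ ⟦ b ⟧
        head true  = ∑-δ x
        head false = ∑-0 _

⟦⟧-mono : ∀ {a b} → a B.≤ b → ⟦ a ⟧ ≤ ⟦ b ⟧
⟦⟧-mono f≤t = z≤n
⟦⟧-mono b≤b = ≤-refl

col-mono : ∀ {c m} (χ : Vec (Fin c) m) {X Y} → X ⊑ Y → ∀ i → col χ X i ≤ col χ Y i
col-mono []      []      i = z≤n
col-mono (x ∷ χ) (f≤t ∷ p) i = ≤-trans (col-mono χ p i) (m≤n+m _ _)
col-mono (x ∷ χ) (b≤b ∷ p) i = +-monoʳ-≤ _ (col-mono χ p i)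

∪-∩-bit : ∀ a b p → ⟦ (a ∨ b) ∧ p ⟧ + ⟦ (a ∧ b) ∧ p ⟧ ≡ ⟦ a ∧ p ⟧ + ⟦ b ∧ p ⟧
∪-∩-bit true  true  p     = refl
∪-∩-bit true  false true  = refl
∪-∩-bit true  false false = refl
∪-∩-bit false b     p     = +-identityʳ _

col-modular : ∀ {c m} (χ : Vec (Fin c) m) X Y i → col χ (X ∪ Y) i + col χ (X ∩ Y) i ≡ col χ X i + col χ Y i
col-modular [] [] [] i = refl
col-modular (x ∷ χ) (a ∷ X) (b ∷ Y) i =
  trans (+-interchange ⟦ (a ∨ b) ∧ (x == i) ⟧ _ _ _)
  (trans (cong₂ _+_ (∪-∩-bit a b (x == i)) (col-modular χ X Y i))
         (sym (+-interchange ⟦ a ∧ (x == i) ⟧ _ _ _)))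

-- Truncation at k is concave, so for a fixed sum the pair lying further apart has the smaller
-- truncated sum. The counts in a union and an intersection are such a spread pair.
⊓-concave : ∀ k {p q p′ q′} → p′ + q′ ≡ p + q → q′ ≤ p → q′ ≤ q → k ⊓ p′ + k ⊓ q′ ≤ k ⊓ p + k ⊓ q
⊓-concave k {p} {q} {p′} {q′} e hp hq with ≤-total k p | ≤-total k q
... | inj₁ kp | _ = +-mono-≤ (≤-trans (m⊓n≤m k p′) (≤-reflexive (sym (m≤n⇒m⊓n≡m kp)))) (⊓-monoʳ-≤ k hq)
... | inj₂ pk | inj₁ kq = ≤-trans (+-mono-≤ (≤-trans (m⊓n≤m k p′) (≤-reflexive (sym (m≤n⇒m⊓n≡m kq)))) (⊓-monoʳ-≤ k hp)) (≤-reflexive (+-comm (k ⊓ q) _))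
... | inj₂ pk | inj₂ qk = ≤-trans (+-mono-≤ (m⊓n≤n k p′) (m⊓n≤n k q′))
       (≤-reflexive (trans e (cong₂ _+_ (sym (m≥n⇒m⊓n≡n pk)) (sym (m≥n⇒m⊓n≡n qk)))))

capRank-isRank : ∀ {c m} (χ : Vec (Fin c) m) cap → IsRank (capRank χ cap)
capRank-isRank χ cap .mono p = ∑-mono λ i → ⊓-monoʳ-≤ (cap i) (col-mono χ p i)
capRank-isRank χ cap .submod X Y = begin
  capRank χ cap (X ∪ Y) + capRank χ cap (X ∩ Y)  ≡⟨ sym (∑-+ _ _) ⟩
  ∑ (λ i → cap i ⊓ col χ (X ∪ Y) i + cap i ⊓ col χ (X ∩ Y) i) ≤⟨ ∑-mono (λ i → ⊓-concave (cap i) (col-modular χ X Y i) (col-mono χ (∩⊑ˡ X Y) i) (col-mono χ (∩⊑ʳ X Y) i)) ⟩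
  ∑ (λ i → cap i ⊓ col χ X i + cap i ⊓ col χ Y i)  ≡⟨ ∑-+ _ _ ⟩
  capRank χ cap X + capRank χ cap Y  ∎
  where open ≤-Reasoning
capRank-isRank χ cap .unit X = ≤-trans (∑-mono λ i → m⊓n≤n (cap i) _) (≤-reflexive (∑-col χ X))

-- When the rank is the full size, no colour can lose anything by truncation.
capRank-tight : ∀ {c m} (χ : Vec (Fin c) m) cap X → ∣ X ∣ ≤ capRank χ cap X → ∀ i → col χ X i ≤ cap i
capRank-tight χ cap X h i = ≤-trans (≤-reflexive (sym (∑-squeeze (λ i → m⊓n≤n (cap i) (col χ X i)) (≤-trans (≤-reflexive (∑-col χ X)) h) i))) (m⊓n≤m _ _)

≤*⊓ : ∀ κ a z → z ≤ suc κ * a → z ≤ suc κ * (a ⊓ z)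
≤*⊓ κ a z h with ≤-total a z
... | inj₁ p = ≤-trans h (≤-reflexive (cong (suc κ *_) (sym (m≤n⇒m⊓n≡m p))))
... | inj₂ p = ≤-trans (m≤m+n z _) (≤-reflexive (cong (suc κ *_) (sym (m≥n⇒m⊓n≡n p))))

-- In each colour the minimum is either the count itself or a capacity that is at least a (κ + 1)-st
-- part of the count.
capRank-lower : ∀ {c m} (χ : Vec (Fin c) m) cap κ X → (∀ i → col χ X i ≤ suc κ * cap i) → ∣ X ∣ ≤ suc κ * capRank χ cap X
capRank-lower χ cap κ X h = begin
  ∣ X ∣  ≡⟨ sym (∑-col χ X) ⟩
  ∑ (col χ X)  ≤⟨ ∑-mono (λ i → ≤*⊓ κ (cap i) (col χ X i) (h i)) ⟩
  ∑ (λ i → suc κ * (cap i ⊓ col χ X i))  ≡⟨ ∑-* (suc κ) (λ i → cap i ⊓ col χ X i) ⟩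
  suc κ * capRank χ cap X  ∎
  where open ≤-Reasoning

-- Rank of a graphic matroid: a labeling sends a vertex to a representative of its component

module _ {n : ℕ} where

  Labeling : Set
  Labeling = Fin n → Fin n

  Idem : Labeling → Set
  Idem l = ∀ x → l (l x) ≡ l x

  -- For an idempotent labeling this is the number of classes: each class contains exactly one fixed
  -- point, its label.
  fixes : Labeling → ℕ
  fixes l = ∑ λ v → ⟦ l v == v ⟧

  merge : Edge n → Labeling → Labeling
  merge (u , v) l x = if l x == l u then l v else l x

  labFrom : Labeling → ∀ {m} → Vec (Edge n) m → Subset m → Labeling
  labFrom l []       []          = l
  labFrom l (e ∷ es) (true ∷ X)  = merge e (labFrom l es X)
  labFrom l (e ∷ es) (false ∷ X) = labFrom l es X

  infix 4 _≼_
  _≼_ : Labeling → Labeling → Set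
  l ≼ l′ = ∀ x y → l x ≡ l y → l′ x ≡ l′ y

  merge-hit : ∀ {u v} l {x} → l x ≡ l u → merge (u , v) l x ≡ l v
  merge-hit {u} l {x} p rewrite p | ==-refl (l u) = refl

  merge-miss : ∀ {u v} l {x} → l x ≢ l u → merge (u , v) l x ≡ l x
  merge-miss {u} l {x} p rewrite ==-≢ p = refl

  merge-joins : ∀ u v l → merge (u , v) l u ≡ merge (u , v) l v
  merge-joins u v l with l v Finₚ.≟ l u
  ... | yes p = merge-hit {v = v} l refl
  ... | no p  = merge-hit {v = v} l refl

  merge-idem : ∀ e {l} → Idem l → Idem (merge e l)
  merge-idem (u , v) {l} I x with l x Finₚ.≟ l u
  ... | no p  = trans (merge-miss l (λ q → p (trans (sym (I x)) q))) (I x)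
  ... | yes p with l v Finₚ.≟ l u
  ...   | yes q = merge-hit l (trans (I v) q)
  ...   | no q  = trans (merge-miss l (λ r → q (trans (sym (I v)) r))) (I v)

  merge-coarser : ∀ e l → l ≼ merge e l
  merge-coarser (u , v) l x y p with l x Finₚ.≟ l u
  ... | yes q = sym (merge-hit l (trans (sym p) q))
  ... | no q  = trans p (sym (merge-miss l (λ r → q (trans p r))))

  merge-least : ∀ {R : Fin n → Fin n → Set} → IsEquivalence R → ∀ {u v l} →
    (∀ x y → l x ≡ l y → R x y) → R u v → ∀ x y → merge (u , v) l x ≡ merge (u , v) l y → R x y
  merge-least E {u} {v} {l} h r x y p with l x Finₚ.≟ l u | l y Finₚ.≟ l u
  ... | yes a | yes b = h x y (trans a (sym b))
  ... | yes a | no b  = E.trans (h x u a) (E.trans r (h v y p))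
    where module E = IsEquivalence E
  ... | no a  | yes b = E.trans (h x v p) (E.sym (E.trans (h y u b) r))
    where module E = IsEquivalence E
  ... | no a  | no b  = h x y p

  labFrom-idem : ∀ {l m} → Idem l → (es : Vec (Edge n) m) → ∀ X → Idem (labFrom l es X)
  labFrom-idem I [] [] = I
  labFrom-idem I (e ∷ es) (true ∷ X)  = merge-idem e (labFrom-idem I es X)
  labFrom-idem I (e ∷ es) (false ∷ X) = labFrom-idem I es X

  labFrom-coarser : ∀ l {m} (es : Vec (Edge n) m) X → l ≼ labFrom l es X
  labFrom-coarser l [] [] x y p = p
  labFrom-coarser l (e ∷ es) (true ∷ X) x y p = merge-coarser e _ x y (labFrom-coarser l es X x y p)
  labFrom-coarser l (e ∷ es) (false ∷ X) = labFrom-coarser l es X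

  data Allˢ (P : Edge n → Set) : ∀ {m} → Vec (Edge n) m → Subset m → Set where
    []  : Allˢ P [] []
    in∷  : ∀ {m e} {es : Vec (Edge n) m} {X} → P e → Allˢ P es X → Allˢ P (e ∷ es) (true ∷ X)
    out∷ : ∀ {m e} {es : Vec (Edge n) m} {X} → Allˢ P es X → Allˢ P (e ∷ es) (false ∷ X)

  Allˢ-map : ∀ {P Q : Edge n → Set} → (∀ {e} → P e → Q e) → ∀ {m} {es : Vec (Edge n) m} {X} → Allˢ P es X → Allˢ Q es X
  Allˢ-map f [] = []
  Allˢ-map f (in∷ p a) = in∷ (f p) (Allˢ-map f a)
  Allˢ-map f (out∷ a) = out∷ (Allˢ-map f a)

  Allˢ-⊑ : ∀ {P : Edge n → Set} {m} {es : Vec (Edge n) m} {X Y} → X ⊑ Y → Allˢ P es Y → Allˢ P es X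
  Allˢ-⊑ [] [] = []
  Allˢ-⊑ (f≤t ∷ p) (in∷ _ a) = out∷ (Allˢ-⊑ p a)
  Allˢ-⊑ (b≤b ∷ p) (in∷ q a) = in∷ q (Allˢ-⊑ p a)
  Allˢ-⊑ (b≤b ∷ p) (out∷ a) = out∷ (Allˢ-⊑ p a)

  Within : Labeling → Edge n → Set
  Within l (u , v) = l u ≡ l v

  labFrom-joins : ∀ l {m} (es : Vec (Edge n) m) X → Allˢ (Within (labFrom l es X)) es X
  labFrom-joins l [] [] = []
  labFrom-joins l (e@(u , v) ∷ es) (true ∷ X) = in∷ (merge-joins u v (labFrom l es X))
    (Allˢ-map (λ {f} p → merge-coarser e (labFrom l es X) (proj₁ f) (proj₂ f) p) (labFrom-joins l es X))
  labFrom-joins l (e ∷ es) (false ∷ X) = out∷ (labFrom-joins l es X)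

  -- With `labFrom-coarser` and `labFrom-joins` this characterises the kernel as the least
  -- equivalence containing the old classes and the selected edges. Refinements between labelings
  -- are derived from it without following paths.
  labFrom-least : ∀ {R : Fin n → Fin n → Set} → IsEquivalence R → ∀ {l} → (∀ x y → l x ≡ l y → R x y) →
    ∀ {m} {es : Vec (Edge n) m} {X} → Allˢ (λ e → R (proj₁ e) (proj₂ e)) es X →
    ∀ x y → labFrom l es X x ≡ labFrom l es X y → R x y
  labFrom-least E h [] = h
  labFrom-least E h (in∷ p a) = merge-least E (labFrom-least E h a) p
  labFrom-least E h (out∷ a) = labFrom-least E h a

  kernel : Labeling → Fin n → Fin n → Set
  kernel l x y = l x ≡ l y

  kernel-isEquivalence : ∀ l → IsEquivalence (kernel l)
  kernel-isEquivalence l = record { refl = refl ; sym = sym ; trans = trans }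

  -- l embeds the fixed points of l′ in those of l.
  fixes-antitone : ∀ {l l′} → Idem l → l ≼ l′ → fixes l′ ≤ fixes l
  fixes-antitone {l} {l′} I h = begin
    ∑ (λ v → ⟦ l′ v == v ⟧)  ≡⟨ ∑-cong (λ v → sym (weight v)) ⟩
    ∑ (λ v → ∑ (λ w → ⟦ (l′ v == v) ∧ (l v == w) ⟧))  ≡⟨ ∑-swap _ ⟩
    ∑ (λ w → ∑ (λ v → ⟦ (l′ v == v) ∧ (l v == w) ⟧))  ≤⟨ ∑-mono fibre ⟩
    ∑ (λ w → ⟦ l w == w ⟧)  ∎
    where
      open ≤-Reasoning
      weight : ∀ v → ∑ (λ w → ⟦ (l′ v == v) ∧ (l v == w) ⟧) ≡ ⟦ l′ v == v ⟧
      weight v with l′ v == v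
      ... | true  = ∑-δ (l v)
      ... | false = ∑-0 n
      -- Injectivity of the embedding: v and its image w have the same label under l, hence under
      -- l′, and v is fixed by l′.
      hit : ∀ {v w} → ((l′ v == v) ∧ (l v == w)) ≡ true → v ≡ l′ w
      hit {v} {w} p with l′ v Finₚ.≟ v | l v Finₚ.≟ w
      ... | yes a | yes b = trans (sym a) (h v w (trans (sym (I v)) (cong l b)))
      fibre : ∀ w → ∑ (λ v → ⟦ (l′ v == v) ∧ (l v == w) ⟧) ≤ ⟦ l w == w ⟧
      fibre w with l w Finₚ.≟ w
      ... | yes p = ≤-trans (∑-mono pt) (≤-reflexive (∑-δ (l′ w)))
        where pt : ∀ v → ⟦ (l′ v == v) ∧ (l v == w) ⟧ ≤ ⟦ l′ w == v ⟧
              pt v with (l′ v == v) ∧ (l v == w) in eq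
              ... | false = z≤n
              ... | true  = ≤-reflexive (cong ⟦_⟧ (sym (trans (cong (l′ w ==_) (hit eq)) (==-refl (l′ w)))))
      ... | no p  = ≤-reflexive (trans (∑-cong pt) (∑-0 n))
        where pt : ∀ v → ⟦ (l′ v == v) ∧ (l v == w) ⟧ ≡ 0
              pt v with l′ v Finₚ.≟ v | l v Finₚ.≟ w
              ... | yes a | yes b = ⊥₀-elim (p (trans (trans (cong l (sym b)) (I v)) b))
              ... | yes a | no b  = refl
              ... | no a  | yes b = refl
              ... | no a  | no b  = refl

  -- The only fixed point lost is `l u`; the joined class keeps the label `l v`.
  fixes-merge : ∀ u v {l} → Idem l → l u ≢ l v → suc (fixes (merge (u , v) l)) ≡ fixes l
  fixes-merge u v {l} I p = begin
    suc (fixes l′)  ≡⟨ +-comm 1 _ ⟩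
    fixes l′ + 1  ≡⟨ cong (fixes l′ +_) (sym at-l) ⟩
    fixes l′ + ⟦ l (l u) == l u ⟧  ≡⟨ ∑-update (λ x → ⟦ l′ x == x ⟧) (λ x → ⟦ l x == x ⟧) (l u) off ⟩
    fixes l + ⟦ l′ (l u) == l u ⟧  ≡⟨ cong (fixes l +_) at-l′ ⟩
    fixes l + 0  ≡⟨ +-identityʳ _ ⟩
    fixes l  ∎
    where
      open ≡-Reasoning
      l′ = merge (u , v) l
      at-l : ⟦ l (l u) == l u ⟧ ≡ 1
      at-l rewrite I u | ==-refl (l u) = refl
      at-l′ : ⟦ l′ (l u) == l u ⟧ ≡ 0
      at-l′ rewrite I u | ==-refl (l u) | ==-≢ (p ∘ sym) = refl
      off : ∀ x → x ≢ l u → ⟦ l′ x == x ⟧ ≡ ⟦ l x == x ⟧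
      off x q with l x Finₚ.≟ l u
      ... | no r  = refl
      ... | yes r = cong ⟦_⟧ (trans (==-≢ a) (sym (==-≢ b)))
        where
          b : l x ≢ x
          b s = q (trans (sym s) r)
          a : l v ≢ x
          a s = p (trans (sym r) (trans (cong l (sym s)) (I v)))

  fixes-merge-≡ : ∀ u v {l} → l u ≡ l v → fixes (merge (u , v) l) ≡ fixes l
  fixes-merge-≡ u v {l} p = ∑-cong pt
    where pt : ∀ x → ⟦ merge (u , v) l x == x ⟧ ≡ ⟦ l x == x ⟧
          pt x with l x Finₚ.≟ l u
          ... | no _  = refl
          ... | yes q = cong (λ y → ⟦ y == x ⟧) (trans (sym p) (sym q))

  fixes-merge-≤ : ∀ e {l} → Idem l → fixes l ≤ suc (fixes (merge e l))
  fixes-merge-≤ (u , v) {l} I with l u Finₚ.≟ l v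
  ... | yes p = ≤-trans (≤-reflexive (sym (fixes-merge-≡ u v p))) (n≤1+n _)
  ... | no p  = ≤-reflexive (sym (fixes-merge u v I p))

  labFrom-mono : ∀ {l l′} → l ≼ l′ → ∀ {m} (es : Vec (Edge n) m) {X Y} → X ⊑ Y → labFrom l es X ≼ labFrom l′ es Y
  labFrom-mono {l} {l′} h es {X} {Y} p = labFrom-least (kernel-isEquivalence (labFrom l′ es Y))
    (λ x y q → labFrom-coarser l′ es Y x y (h x y q)) (Allˢ-⊑ p (labFrom-joins l′ es Y))

  -- Adding the same edges on top of a coarser labeling merges fewer classes (stated without subtraction).
  fixes-drop : ∀ {l l′} → Idem l → Idem l′ → l ≼ l′ → ∀ {m} (es : Vec (Edge n) m) X →
    fixes l′ + fixes (labFrom l es X) ≤ fixes l + fixes (labFrom l′ es X)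
  fixes-drop {l} {l′} I I′ h [] [] = ≤-reflexive (+-comm (fixes l′) _)
  fixes-drop I I′ h (e ∷ es) (false ∷ X) = fixes-drop I I′ h es X
  fixes-drop {l} {l′} I I′ h (e@(u , v) ∷ es) (true ∷ X) with fixes-drop I I′ h es X | labFrom l es X u Finₚ.≟ labFrom l es X v
  ... | ih | yes p = subst₂ (λ a b → fixes l′ + a ≤ fixes l + b)
      (sym (fixes-merge-≡ u v p)) (sym (fixes-merge-≡ u v (labFrom-mono h es (⊑-refl X) u v p))) ih
  ... | ih | no p = s≤s⁻¹ (begin
      suc (fixes l′ + fixes (merge e a))  ≡⟨ sym (+-suc (fixes l′) _) ⟩
      fixes l′ + suc (fixes (merge e a))  ≡⟨ cong (fixes l′ +_) (fixes-merge u v (labFrom-idem I es X) p) ⟩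
      fixes l′ + fixes a  ≤⟨ ih ⟩
      fixes l + fixes a′  ≤⟨ +-monoʳ-≤ (fixes l) (fixes-merge-≤ e (labFrom-idem I′ es X)) ⟩
      fixes l + suc (fixes (merge e a′))  ≡⟨ +-suc (fixes l) _ ⟩
      suc (fixes l + fixes (merge e a′))  ∎)
    where open ≤-Reasoning
          a = labFrom l es X
          a′ = labFrom l′ es X

  lab : ∀ {m} → Vec (Edge n) m → Subset m → Labeling
  lab = labFrom id

  lab-idem : ∀ {m} (es : Vec (Edge n) m) X → Idem (lab es X)
  lab-idem = labFrom-idem (λ _ → refl)

  graphRank : ∀ {m} → Vec (Edge n) m → Subset m → ℕ
  graphRank es X = n ∸ fixes (lab es X)

  fixes-id : fixes id ≡ n
  fixes-id = trans (∑-cong (λ v → cong ⟦_⟧ (==-refl v))) (∑-1 n)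

  fixes-lab≤ : ∀ {m} (es : Vec (Edge n) m) X → fixes (lab es X) ≤ n
  fixes-lab≤ es X = ≤-trans (fixes-antitone (λ _ → refl) (labFrom-coarser id es X)) (≤-reflexive fixes-id)

  graphRank+fixes : ∀ {m} (es : Vec (Edge n) m) X → graphRank es X + fixes (lab es X) ≡ n
  graphRank+fixes es X = m∸n+n≡m (fixes-lab≤ es X)

  -- Rank plus number of classes is n, so the claim amounts to `fX + fY ≤ fI + fU`. Adding the edges
  -- of Y to `X ∩ Y` merges at least as many classes as adding them to X, which is `fixes-drop`.
  graphRank-submod : ∀ {m} (es : Vec (Edge n) m) X Y →
    graphRank es (X ∪ Y) + graphRank es (X ∩ Y) ≤ graphRank es X + graphRank es Y
  graphRank-submod es X Y = +-cancelʳ-≤ (fX + fY) _ _ (begin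
    gU + gI + (fX + fY)  ≤⟨ +-monoʳ-≤ (gU + gI) drop′ ⟩
    gU + gI + (fI + fU)  ≡⟨ re gU gI fI fU ⟩
    (gU + fU) + (gI + fI)  ≡⟨ cong₂ _+_ (graphRank+fixes es _) (graphRank+fixes es _) ⟩
    n + n  ≡⟨ sym (cong₂ _+_ (graphRank+fixes es X) (graphRank+fixes es Y)) ⟩
    (gX + fX) + (gY + fY)  ≡⟨ +-interchange gX fX gY fY ⟩
    gX + gY + (fX + fY)  ∎)
    where
      open ≤-Reasoning
      gU = graphRank es (X ∪ Y)
      gI = graphRank es (X ∩ Y)
      gX = graphRank es X
      gY = graphRank es Y
      fU = fixes (lab es (X ∪ Y))
      fI = fixes (lab es (X ∩ Y))
      fX = fixes (lab es X)
      fY = fixes (lab es Y)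
      re : ∀ a b c d → a + b + (c + d) ≡ (a + d) + (b + c)
      re = solve-∀
      lI = lab es (X ∩ Y)
      lX = lab es X
      fine : lI ≼ lX
      fine = labFrom-mono (λ _ _ p → p) es (∩⊑ˡ X Y)
      below : fY ≤ fixes (labFrom lI es Y)
      below = fixes-antitone (labFrom-idem (lab-idem es (X ∩ Y)) es Y)
        (labFrom-least (kernel-isEquivalence (lab es Y)) (labFrom-mono (λ _ _ p → p) es (∩⊑ʳ X Y)) (labFrom-joins id es Y))
      above : fixes (labFrom lX es Y) ≤ fU
      above = fixes-antitone (lab-idem es (X ∪ Y))
        (labFrom-least (kernel-isEquivalence (labFrom lX es Y)) (λ { x .x refl → refl }) (joins∪ es (Allˢ-lab X Y) (labFrom-joins lX es Y)))
        where
          joins∪ : ∀ {P : Edge n → Set} {m} (es : Vec (Edge n) m) {X Y} → Allˢ P es X → Allˢ P es Y → Allˢ P es (X ∪ Y)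
          joins∪ [] [] [] = []
          joins∪ (e ∷ es) (in∷ p a) (in∷ _ b) = in∷ p (joins∪ es a b)
          joins∪ (e ∷ es) (in∷ p a) (out∷ b) = in∷ p (joins∪ es a b)
          joins∪ (e ∷ es) (out∷ a) (in∷ p b) = in∷ p (joins∪ es a b)
          joins∪ (e ∷ es) (out∷ a) (out∷ b) = out∷ (joins∪ es a b)
          Allˢ-lab : ∀ X Y → Allˢ (Within (labFrom (lab es X) es Y)) es X
          Allˢ-lab X Y = Allˢ-map (λ {f} p → labFrom-coarser (lab es X) es Y (proj₁ f) (proj₂ f) p) (labFrom-joins id es X)
      drop′ : fX + fY ≤ fI + fU
      drop′ = ≤-trans (+-monoʳ-≤ fX below) (≤-trans (fixes-drop (lab-idem es (X ∩ Y)) (lab-idem es X) fine es Y) (+-monoʳ-≤ fI above))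

  fixes-unit : ∀ {m} (es : Vec (Edge n) m) X → n ≤ ∣ X ∣ + fixes (lab es X)
  fixes-unit [] [] = ≤-reflexive (sym fixes-id)
  fixes-unit (e ∷ es) (false ∷ X) = fixes-unit es X
  fixes-unit (e ∷ es) (true ∷ X) = ≤-trans (fixes-unit es X)
    (≤-trans (+-monoʳ-≤ ∣ X ∣ (fixes-merge-≤ e (lab-idem es X))) (≤-reflexive (+-suc ∣ X ∣ _)))

  graphRank-isRank : ∀ {m} (es : Vec (Edge n) m) → IsRank (graphRank es)
  graphRank-isRank es .mono {X} {Y} p = ∸-monoʳ-≤ n (fixes-antitone (lab-idem es X) (labFrom-mono (λ _ _ q → q) es p))
  graphRank-isRank es .submod = graphRank-submod es
  graphRank-isRank es .unit X = m≤n+o⇒m∸n≤o n (fixes (lab es X)) (≤-trans (fixes-unit es X) (≤-reflexive (+-comm ∣ X ∣ _)))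

-- Edge-disjoint spanning connected subgraphs with few edges of each colour

≤-squeeze-+ : ∀ {a a′ b b′} → a ≤ a′ → b ≤ b′ → a′ + b′ ≤ a + b → a′ ≤ a × b′ ≤ b
≤-squeeze-+ {a} {a′} {b} {b′} p q h =
  +-cancelʳ-≤ b a′ a (≤-trans (+-monoʳ-≤ a′ q) h) , +-cancelˡ-≤ a b′ b (≤-trans (+-monoˡ-≤ b′ p) h)

∣take∣+∣drop∣ : ∀ m {k} (X : Subset (m + k)) → ∣ take m X ∣ + ∣ drop m X ∣ ≡ ∣ X ∣
∣take∣+∣drop∣ zero    X = refl
∣take∣+∣drop∣ (suc m) (true ∷ X)  = cong suc (∣take∣+∣drop∣ m X)
∣take∣+∣drop∣ (suc m) (false ∷ X) = ∣take∣+∣drop∣ m X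

∣∪∣≤ : ∀ {m} (X Y : Subset m) → ∣ X ∪ Y ∣ ≤ ∣ X ∣ + ∣ Y ∣
∣∪∣≤ [] [] = z≤n
∣∪∣≤ (true ∷ X) (true ∷ Y)   = s≤s (≤-trans (∣∪∣≤ X Y) (+-monoʳ-≤ ∣ X ∣ (n≤1+n _)))
∣∪∣≤ (true ∷ X) (false ∷ Y)  = s≤s (∣∪∣≤ X Y)
∣∪∣≤ (false ∷ X) (true ∷ Y)  = ≤-trans (s≤s (∣∪∣≤ X Y)) (≤-reflexive (sym (+-suc ∣ X ∣ _)))
∣∪∣≤ (false ∷ X) (false ∷ Y) = ∣∪∣≤ X Y

∣∣-mono : ∀ {m} {X Y : Subset m} → X ⊑ Y → ∣ X ∣ ≤ ∣ Y ∣
∣∣-mono [] = z≤n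
∣∣-mono (f≤t ∷ p) = ≤-trans (∣∣-mono p) (n≤1+n _)
∣∣-mono (b≤b {true} ∷ p) = s≤s (∣∣-mono p)
∣∣-mono (b≤b {false} ∷ p) = ∣∣-mono p

-- Families of edges are compared by these counts, for all predicates at once, that is, as
-- multisets. Disjointness and exact covers thereby become linear relations between numbers.
# : ∀ {A : Set} → (A → Bool) → List A → ℕ
# p []       = 0
# p (x ∷ xs) = ⟦ p x ⟧ + # p xs

#-++ : ∀ {A : Set} (p : A → Bool) xs ys → # p (xs ++ ys) ≡ # p xs + # p ys
#-++ p []       ys = refl
#-++ p (x ∷ xs) ys = trans (cong (⟦ p x ⟧ +_) (#-++ p xs ys)) (sym (+-assoc ⟦ p x ⟧ _ _))

select : ∀ {A : Set} {m} → Vec A m → Subset m → List A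
select []       []          = []
select (x ∷ xs) (true ∷ X)  = x ∷ select xs X
select (x ∷ xs) (false ∷ X) = select xs X

-- Disjointness is expressed through cardinalities because that is the form in which tight ranks
-- deliver it.
#-select-∪ : ∀ {A : Set} (p : A → Bool) {m} (xs : Vec A m) X Y → ∣ X ∣ + ∣ Y ∣ ≤ ∣ X ∪ Y ∣ →
  # p (select xs (X ∪ Y)) ≡ # p (select xs X) + # p (select xs Y)
#-select-∪ p [] [] [] h = refl
#-select-∪ p (x ∷ xs) (true ∷ X) (true ∷ Y) h =
  ⊥₀-elim (1+n≰n (≤-trans (≤-reflexive (sym (+-suc ∣ X ∣ _))) (≤-trans (s≤s⁻¹ h) (∣∪∣≤ X Y))))
#-select-∪ p (x ∷ xs) (true ∷ X) (false ∷ Y) h =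
  trans (cong (⟦ p x ⟧ +_) (#-select-∪ p xs X Y (s≤s⁻¹ h))) (sym (+-assoc ⟦ p x ⟧ _ _))
#-select-∪ p (x ∷ xs) (false ∷ X) (true ∷ Y) h =
  trans (cong (⟦ p x ⟧ +_) (#-select-∪ p xs X Y (s≤s⁻¹ (≤-trans (≤-reflexive (sym (+-suc ∣ X ∣ _))) h)))) (+-left-comm ⟦ p x ⟧ (# p (select xs X)) (# p (select xs Y)))
#-select-∪ p (x ∷ xs) (false ∷ X) (false ∷ Y) h = #-select-∪ p xs X Y h

#-select-∁ : ∀ {A : Set} (p : A → Bool) {m} (xs : Vec A m) X →
  # p (select xs X) + # p (select xs (∁ X)) ≡ # p (toList xs)
#-select-∁ p [] [] = refl
#-select-∁ p (x ∷ xs) (true ∷ X) = trans (+-assoc ⟦ p x ⟧ _ _) (cong (⟦ p x ⟧ +_) (#-select-∁ p xs X))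
#-select-∁ p (x ∷ xs) (false ∷ X) = trans (+-left-comm (# p (select xs X)) ⟦ p x ⟧ (# p (select xs (∁ X)))) (cong (⟦ p x ⟧ +_) (#-select-∁ p xs X))

#-select≤ : ∀ {A : Set} (p : A → Bool) {m} (xs : Vec A m) X → # p (select xs X) ≤ # p (toList xs)
#-select≤ p xs X = ≤-trans (m≤m+n _ _) (≤-reflexive (#-select-∁ p xs X))

col-select : ∀ {A : Set} {c m} (f : A → Fin c) (xs : Vec A m) X i →
  col (V.map f xs) X i ≡ # (λ e → f e == i) (select xs X)
col-select f [] [] i = refl
col-select f (x ∷ xs) (true ∷ X) i = cong (_ +_) (col-select f xs X i)
col-select f (x ∷ xs) (false ∷ X) i = col-select f xs X i

-- Connectivity in second-order form. Each application supplies its own relation, such as lying on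
-- the same side of a cut or being linked by a parity join, instead of an induction along walks.
Connected′ : ∀ {n} → List (Edge n) → Set₁
Connected′ {n} es = ∀ {R : Fin n → Fin n → Set} → IsEquivalence R → All (λ e → R (proj₁ e) (proj₂ e)) es → ∀ x y → R x y

Allˢ-select : ∀ {n m} {P : Edge n → Set} {es : Vec (Edge n) m} {X} → All P (select es X) → Allˢ P es X
Allˢ-select {es = []} {[]} a = []
Allˢ-select {es = e ∷ es} {true ∷ X} (p ∷ a) = in∷ p (Allˢ-select a)
Allˢ-select {es = e ∷ es} {false ∷ X} a = out∷ (Allˢ-select a)

inc : ∀ {n} → Fin n → Edge n → Bool
inc v (i , j) = (i == v) ∨ (j == v)

∨-false : ∀ {a b} → a ∨ b ≡ false → a ≡ false × b ≡ false
∨-false {false} {false} _ = refl , refl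

avoid : ∀ {n} (v : Fin n) (es : List (Edge n)) → # (inc v) es ≡ 0 → All (λ e → (proj₁ e == v) ≡ (proj₂ e == v)) es
avoid v [] h = []
avoid v (e@(i , j) ∷ es) h with inc v e in eq
... | false = let a , b = ∨-false eq in trans a (sym b) ∷ avoid v es h

-- If no edge met v, the partition into v and the remaining vertices would be an equivalence
-- containing all edges.
connected⇒incident : ∀ {n} {es : List (Edge n)} → Connected′ es → ∀ {v y : Fin n} → y ≢ v → 1 ≤ # (inc v) es
connected⇒incident {es = es} C {v} {y} p = positive λ z →
  case trans (sym (==-refl v)) (trans (C (record { refl = refl ; sym = sym ; trans = trans }) (avoid v es z) v y) (==-≢ p)) of λ ()

module Packing {n′ m : ℕ} (es : Vec (Edge (suc n′)) m) (f : Edge (suc n′) → Fin (suc n′)) where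
  n = suc n′
  χ = V.map f es

  -- Direct sum of c graphic matroids, on c disjoint copies of the edge set.
  unionRank : ∀ c → Subset (c * m) → ℕ
  unionRank zero    X = 0
  unionRank (suc c) X = graphRank es (take m X) + unionRank c (drop m X)

  unionRank-isRank : ∀ c → IsRank (unionRank c)
  unionRank-isRank zero .mono p = z≤n
  unionRank-isRank zero .submod X Y = z≤n
  unionRank-isRank zero .unit X = z≤n
  unionRank-isRank (suc c) .mono p = +-mono-≤ (graphRank-isRank es .mono (⊑-take m p)) (unionRank-isRank c .mono (⊑-drop m p))
  unionRank-isRank (suc c) .submod X Y
    rewrite take-zipWith {m = m} _∨_ X Y | drop-zipWith {m = m} _∨_ X Y | take-zipWith {m = m} _∧_ X Y | drop-zipWith {m = m} _∧_ X Y = begin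
    (gU + uU) + (gI + uI)  ≡⟨ +-interchange gU uU gI uI ⟩
    (gU + gI) + (uU + uI)  ≤⟨ +-mono-≤ (graphRank-isRank es .submod (take m X) (take m Y)) (unionRank-isRank c .submod (drop m X) (drop m Y)) ⟩
    (gX + gY) + (uX + uY)  ≡⟨ +-interchange gX gY uX uY ⟩
    (gX + uX) + (gY + uY)  ∎
    where
      open ≤-Reasoning
      gU = graphRank es (take m X ∪ take m Y)
      gI = graphRank es (take m X ∩ take m Y)
      gX = graphRank es (take m X)
      gY = graphRank es (take m Y)
      uU = unionRank c (drop m X ∪ drop m Y)
      uI = unionRank c (drop m X ∩ drop m Y)
      uX = unionRank c (drop m X)
      uY = unionRank c (drop m Y)
  unionRank-isRank (suc c) .unit X = ≤-trans (+-mono-≤ (graphRank-isRank es .unit (take m X)) (unionRank-isRank c .unit (drop m X)))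
    (≤-reflexive (∣take∣+∣drop∣ m X))

  -- Forgets in which copy an edge lies. Under a rank composed with it, two copies of one edge are
  -- parallel, so an independent set uses every edge in one copy at most. This is how
  -- edge-disjointness enters the second matroid.
  shadow : ∀ c → Subset (c * m) → Subset m
  shadow zero    X = ⊥
  shadow (suc c) X = take m X ∪ shadow c (drop m X)

  shadow-mono : ∀ c {X Y} → X ⊑ Y → shadow c X ⊑ shadow c Y
  shadow-mono zero    p = ⊥⊑ ⊥
  shadow-mono (suc c) p = ∪-mono (⊑-take m p) (shadow-mono c (⊑-drop m p))

  shadow-∪ : ∀ c X Y → shadow c (X ∪ Y) ⊑ shadow c X ∪ shadow c Y
  shadow-∪ zero X Y = ⊥⊑ _
  shadow-∪ (suc c) X Y rewrite take-zipWith {m = m} _∨_ X Y | drop-zipWith {m = m} _∨_ X Y =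
    ⊑-∪-lub (∪-mono (⊑∪ˡ _ _) (⊑∪ˡ _ _))
            (⊑-trans (shadow-∪ c (drop m X) (drop m Y)) (∪-mono (⊑∪ʳ (take m X) _) (⊑∪ʳ (take m Y) _)))

  ∣shadow∣≤ : ∀ c X → ∣ shadow c X ∣ ≤ ∣ X ∣
  ∣shadow∣≤ zero X = ≤-trans (≤-reflexive (∣⊥∣ m)) z≤n
  ∣shadow∣≤ (suc c) X = ≤-trans (∣∪∣≤ (take m X) _) (≤-trans (+-monoʳ-≤ ∣ take m X ∣ (∣shadow∣≤ c (drop m X))) (≤-reflexive (∣take∣+∣drop∣ m X)))

  -- The shadow of an intersection may be smaller than the intersection of the shadows; monotonicity
  -- of r makes the inclusion sufficient.
  shadow-isRank : ∀ c {r} → IsRank r → IsRank (r ∘ shadow c)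
  shadow-isRank c R .mono p = R .mono (shadow-mono c p)
  shadow-isRank c R .submod X Y = ≤-trans
    (+-mono-≤ (R .mono (shadow-∪ c X Y)) (R .mono (⊑-∩ (shadow-mono c (∩⊑ˡ X Y)) (shadow-mono c (∩⊑ʳ X Y)))))
    (R .submod (shadow c X) (shadow c Y))
  shadow-isRank c R .unit X = ≤-trans (R .unit (shadow c X)) (∣shadow∣≤ c X)

  crossing : Labeling {n} → Subset m
  crossing l = V.map (λ e → not (l (proj₁ e) == l (proj₂ e))) es

  crossing⊑∁ : ∀ {k} (es : Vec (Edge n) k) (l : Labeling {n}) {X} → Allˢ (Within l) es X →
    V.map (λ e → not (l (proj₁ e) == l (proj₂ e))) es ⊑ ∁ X
  crossing⊑∁ [] l [] = []
  crossing⊑∁ (e ∷ es) l (in∷ p a) = subst (λ b → not b B.≤ false) (sym (trans (cong (_== l (proj₂ e)) p) (==-refl (l (proj₂ e))))) b≤b ∷ crossing⊑∁ es l a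
  crossing⊑∁ (e ∷ es) l (out∷ a) = Bₚ.≤-maximum _ ∷ crossing⊑∁ es l a

  Spanning : Subset m → Set
  Spanning X = ∀ x y → lab es X x ≡ lab es X y

  Each : ∀ c → (Subset m → Set) → Subset (c * m) → Set
  Each zero    P X = ⊤
  Each (suc c) P X = P (take m X) × Each c P (drop m X)

  fixed : ∀ {l : Labeling {n}} → Idem l → ∀ x → ⟦ l (l x) == l x ⟧ ≡ 1
  fixed {l} I x rewrite I x | ==-refl (l x) = refl

  fixes≥1 : ∀ {l : Labeling {n}} → Idem l → 1 ≤ fixes l
  fixes≥1 {l} I = ≤-trans (≤-reflexive (sym (fixed I zero))) (∑-term (λ v → ⟦ l v == v ⟧) (l zero))

  fixes≤1⇒spanning : ∀ {l : Labeling {n}} → Idem l → fixes l ≤ 1 → ∀ x y → l x ≡ l y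
  fixes≤1⇒spanning {l} I h x y with l x Finₚ.≟ l y
  ... | yes p = p
  ... | no p  = ⊥₀-elim (1+n≰n (begin
    2  ≡⟨ sym (cong₂ _+_ (∑-δ (l x)) (∑-δ (l y))) ⟩
    ∑ (λ v → ⟦ l x == v ⟧) + ∑ (λ v → ⟦ l y == v ⟧) ≡⟨ sym (∑-+ (λ v → ⟦ l x == v ⟧) (λ v → ⟦ l y == v ⟧)) ⟩
    ∑ (λ v → ⟦ l x == v ⟧ + ⟦ l y == v ⟧)  ≤⟨ ∑-mono pt ⟩
    fixes l  ≤⟨ h ⟩
    1  ∎))
    where
      open ≤-Reasoning
      pt : ∀ v → ⟦ l x == v ⟧ + ⟦ l y == v ⟧ ≤ ⟦ l v == v ⟧
      pt v with l x Finₚ.≟ v | l y Finₚ.≟ v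
      ... | yes a | yes b = ⊥₀-elim (p (trans a (sym b)))
      ... | yes a | no b  = ≤-reflexive (sym (subst (λ z → ⟦ l z == z ⟧ ≡ 1) a (fixed I x)))
      ... | no a  | yes b = ≤-reflexive (sym (subst (λ z → ⟦ l z == z ⟧ ≡ 1) b (fixed I y)))
      ... | no a  | no b  = z≤n

  graphRank≤ : ∀ X → graphRank es X ≤ n′
  graphRank≤ X = m≤n+o⇒m∸n≤o n (fixes (lab es X)) (+-monoˡ-≤ n′ (fixes≥1 (lab-idem es X)))

  full⇒spanning : ∀ X → n′ ≤ graphRank es X → Spanning X
  full⇒spanning X h = fixes≤1⇒spanning (lab-idem es X) (+-cancelˡ-≤ n′ _ 1
    (≤-trans (+-monoˡ-≤ _ h) (≤-reflexive (trans (graphRank+fixes es X) (+-comm 1 n′)))))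

  unionRank≤ : ∀ c X → unionRank c X ≤ c * n′
  unionRank≤ zero X = z≤n
  unionRank≤ (suc c) X = +-mono-≤ (graphRank≤ (take m X)) (unionRank≤ c (drop m X))

  full⇒each-spanning : ∀ c X → c * n′ ≤ unionRank c X → Each c Spanning X
  full⇒each-spanning zero X h = tt
  full⇒each-spanning (suc c) X h =
    let p , q = ≤-squeeze-+ (graphRank≤ (take m X)) (unionRank≤ c (drop m X)) h
    in full⇒spanning (take m X) p , full⇒each-spanning c (drop m X) q

  module _ (κ c : ℕ) (cap : Fin n → ℕ) (enough : ∀ i → col χ (replicate m true) i ≤ suc κ * cap i)
    (cross : ∀ l → Idem l → 2 ≤ fixes l → suc κ * (suc c * fixes l) ≤ ∣ crossing l ∣) where

    all-⊑ : ∀ {k} (X : Subset k) → X ⊑ replicate k true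
    all-⊑ []      = []
    all-⊑ (b ∷ X) = Bₚ.≤-maximum b ∷ all-⊑ X

    -- No edge of X crosses the classes of `lab es X`, so all crossing edges lie in Y. There are
    -- many of them, and the capacities retain a (κ + 1)-st part of any set.
    deficit : ∀ X Y → ∁ X ⊑ Y → suc c * (fixes (lab es X) ∸ 1) ≤ capRank χ cap Y
    deficit X Y p with fixes (lab es X) in eq
    ... | zero = ≤-trans (≤-reflexive (*-zeroʳ (suc c))) z≤n
    ... | suc zero = ≤-trans (≤-reflexive (*-zeroʳ (suc c))) z≤n
    ... | suc (suc z) = ≤-trans (*-monoʳ-≤ (suc c) (n≤1+n (suc z))) (*-cancelˡ-≤ (suc κ) (begin
      suc κ * (suc c * suc (suc z))  ≡⟨ cong (λ w → suc κ * (suc c * w)) (sym eq) ⟩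
      suc κ * (suc c * fixes (lab es X))  ≤⟨ cross (lab es X) (lab-idem es X) (≤-trans (s≤s (s≤s z≤n)) (≤-reflexive (sym eq))) ⟩
      ∣ crossing (lab es X) ∣  ≤⟨ ∣∣-mono (crossing⊑∁ es (lab es X) (labFrom-joins id es X)) ⟩
      ∣ ∁ X ∣  ≤⟨ ∣∣-mono p ⟩
      ∣ Y ∣  ≤⟨ capRank-lower χ cap κ Y (λ i → ≤-trans (col-mono χ (all-⊑ Y) i) (enough i)) ⟩
      suc κ * capRank χ cap Y  ∎))
      where open ≤-Reasoning

    shift-one : ∀ g z → g + z ≡ suc n′ → 1 ≤ z → n′ ≤ g + (z ∸ 1)
    shift-one g (suc z) e _ = ≤-reflexive (suc-injective (trans (sym e) (+-suc g z)))

    -- A copy falls short of full rank by one less than its number of classes, and `deficit` makes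
    -- that at most r / (c + 1). All copies are charged to the same r, which is why `cross` asks for
    -- a factor `suc c`; taking j = c + 1 then balances exactly.
    total : ∀ j X r → (∀ Y → Y ⊑ shadow j (∁ X) → capRank χ cap Y ≤ r) → suc c * (j * n′) ≤ suc c * unionRank j X + j * r
    total zero X r h = ≤-trans (≤-reflexive (*-zeroʳ (suc c))) z≤n
    total (suc j) X r h = begin
      suc c * (n′ + j * n′)  ≡⟨ *-distribˡ-+ (suc c) n′ _ ⟩
      suc c * n′ + suc c * (j * n′)  ≤⟨ +-mono-≤ first rest ⟩
      (suc c * g + r) + (suc c * u + j * r)  ≡⟨ re (suc c) g r u (j * r) ⟩
      suc c * (g + u) + (r + j * r)  ∎
      where
        open ≤-Reasoning
        g = graphRank es (take m X)
        u = unionRank j (drop m X)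
        re : ∀ k g r u w → (k * g + r) + (k * u + w) ≡ k * (g + u) + (r + w)
        re = solve-∀
        split : n′ ≤ g + (fixes (lab es (take m X)) ∸ 1)
        split = shift-one g _ (graphRank+fixes es (take m X)) (fixes≥1 (lab-idem es (take m X)))
        first : suc c * n′ ≤ suc c * g + r
        first = ≤-trans (*-monoʳ-≤ (suc c) split) (≤-trans (≤-reflexive (*-distribˡ-+ (suc c) g _))
          (+-monoʳ-≤ (suc c * g) (≤-trans (deficit (take m X) (∁ (take m X)) (⊑-refl _))
            (h _ (subst (_⊑ shadow (suc j) (∁ X)) (take-map not m X) (⊑∪ˡ (take m (∁ X)) _))))))
        rest : suc c * (j * n′) ≤ suc c * u + j * r
        rest = total j (drop m X) r (λ Y p → h Y (⊑-trans p (subst (λ Z → shadow j Z ⊑ shadow (suc j) (∁ X)) (drop-map not m X) (⊑∪ʳ (take m (∁ X)) _))))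

    condition : ∀ X → suc c * n′ ≤ unionRank (suc c) X + capRank χ cap (shadow (suc c) (∁ X))
    condition X = *-cancelˡ-≤ (suc c) (≤-trans (total (suc c) X _ (λ Y p → capRank-isRank χ cap .mono p))
      (≤-reflexive (sym (*-distribˡ-+ (suc c) (unionRank (suc c) X) _))))

    -- The target size is that of c + 1 spanning trees, so every copy attains its maximal rank. The
    -- same size bounds the shadow from below, so no edge is used twice.
    packing : Σ (Subset (suc c * m)) λ I → Each (suc c) Spanning I × (∀ i → col χ (shadow (suc c) I) i ≤ cap i) × ∣ I ∣ ≤ ∣ shadow (suc c) I ∣
    packing =
      let I , p , q , s = intersection (unionRank-isRank (suc c)) (shadow-isRank (suc c) (capRank-isRank χ cap)) (suc c * n′) condition
          tight = ≤-reflexive (trans s (sym q))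
      in I , full⇒each-spanning (suc c) I (≤-reflexive (sym p))
           , capRank-tight χ cap (shadow (suc c) I) (≤-trans (∣shadow∣≤ (suc c) I) tight)
           , ≤-trans tight (capRank-isRank χ cap .unit (shadow (suc c) I))

  Tight : ∀ c → Subset (c * m) → Set
  Tight c X = ∣ X ∣ ≤ ∣ shadow c X ∣

  tight-split : ∀ c X → Tight (suc c) X →
    ∣ take m X ∣ + ∣ shadow c (drop m X) ∣ ≤ ∣ take m X ∪ shadow c (drop m X) ∣ × Tight c (drop m X)
  tight-split c X h = ≤-trans (+-monoʳ-≤ ∣ take m X ∣ (∣shadow∣≤ c (drop m X))) h′ ,
    +-cancelˡ-≤ ∣ take m X ∣ _ _ (≤-trans h′ (∣∪∣≤ (take m X) _))
    where h′ = ≤-trans (≤-reflexive (∣take∣+∣drop∣ m X)) h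

  spanning⇒connected : ∀ {X} → Spanning X → Connected′ (select es X)
  spanning⇒connected {X} S E a x y = labFrom-least E {l = id} (λ { x .x refl → IsEquivalence.refl E }) {es = es} {X = X} (Allˢ-select a) x y (S x y)

  many-incident : ∀ c X → Each c Spanning X → Tight c X → ∀ {v y : Fin n} → y ≢ v → c ≤ # (inc v) (select es (shadow c X))
  many-incident zero X S T p = z≤n
  many-incident (suc c) X (s , S) T {v} p = let d , T′ = tight-split c X T in
    ≤-trans (+-mono-≤ (connected⇒incident (spanning⇒connected s) p) (many-incident c (drop m X) S T′ p))
            (≤-reflexive (sym (#-select-∪ (inc v) es (take m X) _ d)))

  -- `rich` is paid for by packing c further spanning subgraphs and releasing them into D: each
  -- contributes an edge at v.
  record Pack (c : ℕ) (cap : Fin n → ℕ) : Set₁ where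
    field
      T₁ T₂ T₃ D : List (Edge n)
      count      : ∀ p → # p T₁ + (# p T₂ + # p T₃) + # p D ≡ # p (toList es)
      conn₁      : Connected′ T₁
      conn₂      : Connected′ T₂
      conn₃      : Connected′ T₃
      sparse     : ∀ v → # (λ e → f e == v) T₁ + (# (λ e → f e == v) T₂ + # (λ e → f e == v) T₃) ≤ cap v
      rich       : ∀ {v y} → y ≢ v → c ≤ # (inc v) D

  select-all : ∀ {k} (xs : Vec (Edge n) k) → select xs (replicate k true) ≡ toList xs
  select-all [] = refl
  select-all (x ∷ xs) = cong (x ∷_) (select-all xs)

  disj-mono : ∀ {k} (A B B′ : Subset k) → B ⊑ B′ → ∣ A ∣ + ∣ B′ ∣ ≤ ∣ A ∪ B′ ∣ → ∣ A ∣ + ∣ B ∣ ≤ ∣ A ∪ B ∣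
  disj-mono [] [] [] [] h = z≤n
  disj-mono (true ∷ A) (true ∷ B) (true ∷ B′) (_ ∷ q) h =
    ⊥₀-elim (1+n≰n (≤-trans (≤-reflexive (sym (+-suc ∣ A ∣ _))) (≤-trans (s≤s⁻¹ h) (∣∪∣≤ A B′))))
  disj-mono (true ∷ A) (false ∷ B) (true ∷ B′) (_ ∷ q) h =
    ⊥₀-elim (1+n≰n (≤-trans (≤-reflexive (sym (+-suc ∣ A ∣ _))) (≤-trans (s≤s⁻¹ h) (∣∪∣≤ A B′))))
  disj-mono (true ∷ A) (false ∷ B) (false ∷ B′) (_ ∷ q) h = s≤s (disj-mono A B B′ q (s≤s⁻¹ h))
  disj-mono (false ∷ A) (true ∷ B) (true ∷ B′) (_ ∷ q) h =
    ≤-trans (≤-reflexive (+-suc ∣ A ∣ _)) (s≤s (disj-mono A B B′ q (s≤s⁻¹ (≤-trans (≤-reflexive (sym (+-suc ∣ A ∣ _))) h))))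
  disj-mono (false ∷ A) (false ∷ B) (true ∷ B′) (_ ∷ q) h =
    disj-mono A B B′ q (s≤s⁻¹ (≤-trans (≤-reflexive (sym (+-suc ∣ A ∣ _))) h))
  disj-mono (false ∷ A) (false ∷ B) (false ∷ B′) (_ ∷ q) h = disj-mono A B B′ q h

  module _ {c : ℕ} {cap : Fin n → ℕ} (X₁ X₂ X₃ : Subset m) (R₃ : Subset (c * m))
    (s₁ : Spanning X₁) (s₂ : Spanning X₂) (s₃ : Spanning X₃) (S : Each c Spanning R₃)
    (d₁ : ∣ X₁ ∣ + ∣ X₂ ∪ (X₃ ∪ shadow c R₃) ∣ ≤ ∣ X₁ ∪ (X₂ ∪ (X₃ ∪ shadow c R₃)) ∣)
    (d₂ : ∣ X₂ ∣ + ∣ X₃ ∪ shadow c R₃ ∣ ≤ ∣ X₂ ∪ (X₃ ∪ shadow c R₃) ∣)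
    (d₃ : ∣ X₃ ∣ + ∣ shadow c R₃ ∣ ≤ ∣ X₃ ∪ shadow c R₃ ∣)
    (t₃ : Tight c R₃)
    (le : ∀ i → col χ (X₁ ∪ (X₂ ∪ (X₃ ∪ shadow c R₃))) i ≤ cap i) where

    X₄ Z A : Subset m
    X₄ = shadow c R₃
    Z = X₁ ∪ (X₂ ∪ X₃)
    A = X₁ ∪ (X₂ ∪ (X₃ ∪ X₄))

    sum⁺ : ∀ p → # p (select es A) ≡ # p (select es X₁) + (# p (select es X₂) + (# p (select es X₃) + # p (select es X₄)))
    sum⁺ p = trans (#-select-∪ p es X₁ _ d₁) (cong (# p (select es X₁) +_)
      (trans (#-select-∪ p es X₂ _ d₂) (cong (# p (select es X₂) +_) (#-select-∪ p es X₃ _ d₃))))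

    sum : ∀ p → # p (select es Z) ≡ # p (select es X₁) + (# p (select es X₂) + # p (select es X₃))
    sum p = trans (#-select-∪ p es X₁ (X₂ ∪ X₃) (disj-mono X₁ (X₂ ∪ X₃) (X₂ ∪ (X₃ ∪ X₄)) (∪-mono (⊑-refl X₂) (⊑∪ˡ X₃ X₄)) d₁))
      (cong (# p (select es X₁) +_) (#-select-∪ p es X₂ X₃ (disj-mono X₂ X₃ (X₃ ∪ X₄) (⊑∪ˡ X₃ X₄) d₂)))

    sum⁺′ : ∀ p → # p (select es A) ≡ # p (select es Z) + # p (select es X₄)
    sum⁺′ p = trans (sum⁺ p) (trans (re (# p (select es X₁)) (# p (select es X₂)) (# p (select es X₃)) (# p (select es X₄))) (cong (_+ # p (select es X₄)) (sym (sum p))))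
      where re : ∀ a b c d → a + (b + (c + d)) ≡ a + (b + c) + d
            re = solve-∀

    assemble : Pack c cap
    assemble = record
      { T₁ = select es X₁ ; T₂ = select es X₂ ; T₃ = select es X₃ ; D = select es (∁ Z)
      ; count = λ p → trans (cong (_+ # p (select es (∁ Z))) (sym (sum p))) (#-select-∁ p es Z)
      ; conn₁ = spanning⇒connected s₁ ; conn₂ = spanning⇒connected s₂ ; conn₃ = spanning⇒connected s₃
      ; sparse = λ v → begin
          # (to v) (select es X₁) + (# (to v) (select es X₂) + # (to v) (select es X₃)) ≡⟨ sym (sum (to v)) ⟩
          # (to v) (select es Z)  ≤⟨ m≤m+n _ _ ⟩
          # (to v) (select es Z) + # (to v) (select es X₄) ≡⟨ sym (sum⁺′ (to v)) ⟩
          # (to v) (select es A)  ≡⟨ sym (col-select f es A v) ⟩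
          col χ A v  ≤⟨ le v ⟩
          cap v  ∎
      ; rich = λ {v} p → ≤-trans (many-incident c R₃ S t₃ p) (+-cancelˡ-≤ (# (inc v) (select es Z)) _ _ (begin
          # (inc v) (select es Z) + # (inc v) (select es X₄)  ≡⟨ sym (sum⁺′ (inc v)) ⟩
          # (inc v) (select es A)  ≤⟨ #-select≤ (inc v) es A ⟩
          # (inc v) (toList es)  ≡⟨ sym (#-select-∁ (inc v) es Z) ⟩
          # (inc v) (select es Z) + # (inc v) (select es (∁ Z))  ∎))
      }
      where open ≤-Reasoning
            to : Fin n → Edge n → Bool
            to v e = f e == v

  pack : ∀ κ c cap → (∀ v → # (λ e → f e == v) (toList es) ≤ suc κ * cap v) →
    (∀ l → Idem l → 2 ≤ fixes l → suc κ * ((3 + c) * fixes l) ≤ ∣ crossing l ∣) → Pack c cap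
  pack κ c cap enough cross =
    let I , (s₁ , s₂ , s₃ , S) , le , t₀ = packing κ (2 + c) cap enough′ cross
        R₁ = drop m I
        R₂ = drop m R₁
        d₁ , t₁ = tight-split (2 + c) I t₀
        d₂ , t₂ = tight-split (1 + c) R₁ t₁
        d₃ , t₃ = tight-split c R₂ t₂
    in assemble (take m I) (take m R₁) (take m R₂) (drop m R₂) s₁ s₂ s₃ S d₁ d₂ d₃ t₃ le
    where
      enough′ : ∀ i → col χ (replicate m true) i ≤ suc κ * cap i
      enough′ i = ≤-trans (≤-reflexive (trans (col-select f es (replicate m true) i) (cong (# (λ e → f e == i)) (select-all es)))) (enough i)

-- Edges, cuts and a maximum cut

opaque
  unfolding ∑
  #-concatMap-tabulate : ∀ {A B : Set} (p : B → Bool) (g : A → List B) {n} (f : Fin n → A) →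
    # p (concatMap g (L.tabulate f)) ≡ ∑ λ i → # p (g (f i))
  #-concatMap-tabulate p g {zero}  f = refl
  #-concatMap-tabulate p g {suc n} f =
    trans (#-++ p (g (f zero)) _) (cong (# p (g (f zero)) +_) (#-concatMap-tabulate p g (f ∘ suc)))

#-mono : ∀ {A : Set} {p q : A → Bool} → (∀ x → p x B.≤ q x) → ∀ xs → # p xs ≤ # q xs
#-mono h []       = z≤n
#-mono h (x ∷ xs) = +-mono-≤ (⟦⟧-mono (h x)) (#-mono h xs)

#-cong : ∀ {A : Set} {p q : A → Bool} → (∀ x → p x ≡ q x) → ∀ xs → # p xs ≡ # q xs
#-cong h []       = refl
#-cong h (x ∷ xs) = cong₂ _+_ (cong ⟦_⟧ (h x)) (#-cong h xs)

#-length : ∀ {A : Set} (xs : List A) → # (λ _ → true) xs ≡ length xs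
#-length []       = refl
#-length (x ∷ xs) = cong suc (#-length xs)

#-split : ∀ {A : Set} (p q : A → Bool) xs → # q xs ≡ # (λ x → p x ∧ q x) xs + # (λ x → not (p x) ∧ q x) xs
#-split p q []       = refl
#-split p q (x ∷ xs) with p x
... | true  = trans (cong (⟦ q x ⟧ +_) (#-split p q xs)) (sym (+-assoc ⟦ q x ⟧ _ _))
... | false = trans (cong (⟦ q x ⟧ +_) (#-split p q xs)) (+-left-comm ⟦ q x ⟧ (# (λ x → p x ∧ q x) xs) _)

∑-#≤ : ∀ {A : Set} {n} (p : Fin n → A → Bool) (q : A → Bool) k → (∀ x → ∑ (λ v → ⟦ p v x ⟧) ≤ k * ⟦ q x ⟧) →
  ∀ xs → ∑ (λ v → # (p v) xs) ≤ k * # q xs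
∑-#≤ {n = n} p q k h [] = ≤-trans (≤-reflexive (∑-0 n)) z≤n
∑-#≤ p q k h (x ∷ xs) = begin
  ∑ (λ v → ⟦ p v x ⟧ + # (p v) xs)  ≡⟨ ∑-+ (λ v → ⟦ p v x ⟧) (λ v → # (p v) xs) ⟩
  ∑ (λ v → ⟦ p v x ⟧) + ∑ (λ v → # (p v) xs)  ≤⟨ +-mono-≤ (h x) (∑-#≤ p q k h xs) ⟩
  k * ⟦ q x ⟧ + k * # q xs  ≡⟨ sym (*-distribˡ-+ k ⟦ q x ⟧ _) ⟩
  k * (⟦ q x ⟧ + # q xs)  ∎
  where open ≤-Reasoning

#-pos : ∀ {A : Set} {p : A → Bool} {x} → p x ≡ true → ∀ {xs} → x ∈ xs → 1 ≤ # p xs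
#-pos h (here refl) rewrite h = s≤s z≤n
#-pos h (there m) = ≤-trans (#-pos h m) (m≤n+m _ _)

#-find : ∀ {A : Set} {p : A → Bool} xs → 1 ≤ # p xs → ∃ λ x → x ∈ xs × p x ≡ true
#-find {p = p} (x ∷ xs) h with p x in eq
... | true  = x , here refl , eq
... | false = let y , m , q = #-find xs h in y , there m , q

keep : ∀ {A : Set} → (A → Bool) → List A → List A
keep p []       = []
keep p (x ∷ xs) = if p x then x ∷ keep p xs else keep p xs

#-keep : ∀ {A : Set} (p q : A → Bool) xs → # q (keep p xs) ≡ # (λ x → p x ∧ q x) xs
#-keep p q [] = refl
#-keep p q (x ∷ xs) with p x
... | true  = cong (⟦ q x ⟧ +_) (#-keep p q xs)
... | false = #-keep p q xs

keep-∈ : ∀ {A : Set} {p : A → Bool} {x} → p x ≡ true → ∀ {xs} → x ∈ xs → x ∈ keep p xs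
keep-∈ {p = p} h {y ∷ xs} (here refl) rewrite h = here refl
keep-∈ {p = p} h {y ∷ xs} (there m) with p y
... | true  = there (keep-∈ h m)
... | false = keep-∈ h m

keep-true : ∀ {A : Set} {p : A → Bool} {x} xs → x ∈ keep p xs → p x ≡ true × x ∈ xs
keep-true {p = p} (y ∷ xs) m with p y in eq
keep-true (y ∷ xs) (here refl) | true = eq , here refl
keep-true (y ∷ xs) (there m)   | true = let a , b = keep-true xs m in a , there b
keep-true (y ∷ xs) m | false = let a , b = keep-true xs m in a , there b

eqᴱ : ∀ {n} → Edge n → Edge n → Bool
eqᴱ (i , j) (i′ , j′) = (i == i′) ∧ (j == j′)

eqᴱ-refl : ∀ {n} (e : Edge n) → eqᴱ e e ≡ true
eqᴱ-refl (i , j) rewrite ==-refl i | ==-refl j = refl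

eqᴱ-true : ∀ {n} {e f : Edge n} → eqᴱ e f ≡ true → e ≡ f
eqᴱ-true {e = i , j} {i′ , j′} h with i Finₚ.≟ i′ | j Finₚ.≟ j′
... | yes refl | yes refl = refl

cross : ∀ {n} → (Fin n → Bool) → Edge n → Bool
cross X (i , j) = X i xor X j

module _ {n : ℕ} (G : Graph n) where

  isEdge : Fin n → Fin n → Bool
  isEdge i j = does (i Finₚ.<? j) ∧ adj G i j

  -- Names the local function of the definition of edges.
  edges-concatMap : Σ (Fin n → Fin n → List (Edge n)) λ h → edges G ≡ concatMap (λ i → concatMap (h i) (L.allFin n)) (L.allFin n)
  edges-concatMap = _ , refl

  #-edges : ∀ p → # p (edges G) ≡ ∑ λ i → ∑ λ j → ⟦ isEdge i j ∧ p (i , j) ⟧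
  #-edges p = trans (#-concatMap-tabulate p (λ i → concatMap (proj₁ edges-concatMap i) (L.allFin n)) id)
    (∑-cong λ i → trans (#-concatMap-tabulate p (proj₁ edges-concatMap i) id) (∑-cong (pair i)))
    where
      pair : ∀ i j → # p (proj₁ edges-concatMap i j) ≡ ⟦ isEdge i j ∧ p (i , j) ⟧
      pair i j with i Finₚ.<? j | adj G i j
      ... | yes q | true  rewrite dec-true (i Finₚ.<? j) q = +-identityʳ _
      ... | yes q | false rewrite dec-true (i Finₚ.<? j) q = refl
      ... | no q  | _     rewrite dec-false (i Finₚ.<? j) q = refl

  #-edge : ∀ i j → # (eqᴱ (i , j)) (edges G) ≡ ⟦ isEdge i j ⟧
  #-edge i j = begin
    # (eqᴱ (i , j)) (edges G)  ≡⟨ #-edges _ ⟩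
    ∑ (λ i′ → ∑ λ j′ → ⟦ isEdge i′ j′ ∧ ((i == i′) ∧ (j == j′)) ⟧)  ≡⟨ ∑-cong (λ i′ → ∑-cong (λ j′ → pt i′ j′)) ⟩
    ∑ (λ i′ → ∑ λ j′ → ⟦ isEdge i j ⟧ * (⟦ i == i′ ⟧ * ⟦ j == j′ ⟧))  ≡⟨ ∑-cong (λ i′ → trans (∑-* ⟦ isEdge i j ⟧ _) (cong (⟦ isEdge i j ⟧ *_) (trans (∑-* ⟦ i == i′ ⟧ _) (trans (cong (⟦ i == i′ ⟧ *_) (∑-δ j)) (*-identityʳ _))))) ⟩
    ∑ (λ i′ → ⟦ isEdge i j ⟧ * ⟦ i == i′ ⟧)  ≡⟨ trans (∑-* ⟦ isEdge i j ⟧ _) (trans (cong (⟦ isEdge i j ⟧ *_) (∑-δ i)) (*-identityʳ _)) ⟩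
    ⟦ isEdge i j ⟧  ∎
    where
      open ≡-Reasoning
      pt : ∀ i′ j′ → ⟦ isEdge i′ j′ ∧ ((i == i′) ∧ (j == j′)) ⟧ ≡ ⟦ isEdge i j ⟧ * (⟦ i == i′ ⟧ * ⟦ j == j′ ⟧)
      pt i′ j′ with i Finₚ.≟ i′ | j Finₚ.≟ j′
      ... | yes refl | yes refl = trans (cong ⟦_⟧ (Bₚ.∧-identityʳ _)) (sym (*-identityʳ _))
      ... | yes refl | no _ = trans (cong ⟦_⟧ (Bₚ.∧-zeroʳ (isEdge i′ j′))) (sym (*-zeroʳ ⟦ isEdge i j ⟧))
      ... | no _ | _ = trans (cong ⟦_⟧ (Bₚ.∧-zeroʳ (isEdge i′ j′))) (sym (*-zeroʳ ⟦ isEdge i j ⟧))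

  ∈-edges⁻ : ∀ {i j} → (i , j) ∈ edges G → i Fin.< j × adj G i j ≡ true
  ∈-edges⁻ {i} {j} m = conclude (≤-trans (#-pos (eqᴱ-refl (i , j)) m) (≤-reflexive (#-edge i j)))
    where
      conclude : 1 ≤ ⟦ isEdge i j ⟧ → i Fin.< j × adj G i j ≡ true
      conclude h with i Finₚ.<? j
      conclude h | yes p with adj G i j
      conclude h | yes p | true = p , refl
      conclude h | yes p | false rewrite dec-true (i Finₚ.<? j) p = ⊥₀-elim (1+n≰n h)
      conclude h | no q rewrite dec-false (i Finₚ.<? j) q = ⊥₀-elim (1+n≰n h)

  ∈-edges⁺ : ∀ {i j} → i Fin.< j → adj G i j ≡ true → (i , j) ∈ edges G
  ∈-edges⁺ {i} {j} p a =
    let f , m , e = #-find (edges G) (≤-reflexive (sym (trans (#-edge i j) (cong ⟦_⟧ isE))))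
    in subst (_∈ edges G) (sym (eqᴱ-true e)) m
    where isE : isEdge i j ≡ true
          isE rewrite dec-true (i Finₚ.<? j) p | a = refl

  #-edges≤1 : ∀ e → # (eqᴱ e) (edges G) ≤ 1
  #-edges≤1 (i , j) = ≤-trans (≤-reflexive (#-edge i j)) (bit (isEdge i j))
    where bit : ∀ b → ⟦ b ⟧ ≤ 1
          bit true = ≤-refl
          bit false = z≤n

  -- Deleting the edges of a cut with fewer than k edges would trap every walk from u inside X.
  cut≥ : ∀ {k} → EdgeConnected k G → ∀ (X : Fin n → Bool) {u v} → X u ≡ true → X v ≡ false → k ≤ # (cross X) (edges G)
  cut≥ {k} C X {u} {v} Xu Xv = ≮⇒≥ λ lt → true≢false (trans (sym (stays (C F (subst (_< k) (sym len) lt) u v))) Xv)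
    where
      F = keep (cross X) (edges G)
      len : length F ≡ # (cross X) (edges G)
      len = trans (sym (#-length F)) (trans (#-keep (cross X) _ (edges G)) (#-cong (λ e → Bₚ.∧-identityʳ _) (edges G)))
      true≢false : true ≢ false
      true≢false ()
      stays : ∀ {w} → Reach G F u w → X w ≡ true
      stays here = Xu
      stays (step {a} {w} r (e , out)) with X w in eq
      ... | true  = refl
      ... | false with stays r | Finₚ.<-cmp a w
      ...   | Xa | Relation.Binary.tri< p _ _ = ⊥₀-elim (out (inj₁ (keep-∈ (cong₂ _xor_ Xa eq) (∈-edges⁺ p e))))
      ...   | Xa | Relation.Binary.tri≈ _ refl _ = trans (sym eq) Xa
      ...   | Xa | Relation.Binary.tri> _ _ p = ⊥₀-elim (out (inj₂ (keep-∈ (cong₂ _xor_ eq Xa) (∈-edges⁺ p (trans (Graph.sym G w a) e)))))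

maximum : ∀ {n} (f : Subset n → ℕ) b → (∀ X → f X ≤ b) → ∃ λ X → ∀ Y → f Y ≤ f X
maximum {n} f b bound = climb b ⊥ (m≤n+m b _)
  where
    -- d bounds the gap between `f X` and the upper bound b; every improvement consumes at least one
    -- unit of it.
    climb : ∀ d X → b ≤ f X + d → ∃ λ X → ∀ Y → f Y ≤ f X
    climb d X h with anySubset? (λ Y → f X <? f Y)
    ... | no none = X , λ Y → ≮⇒≥ (λ lt → none (Y , lt))
    climb zero X h | yes (Y , lt) = ⊥₀-elim (<⇒≱ lt (≤-trans (bound Y) (≤-trans h (≤-reflexive (+-identityʳ _)))))
    climb (suc d) X h | yes (Y , lt) = climb d Y (≤-trans h (≤-trans (≤-reflexive (+-suc (f X) d)) (+-monoˡ-≤ d lt)))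

#≤length : ∀ {A : Set} (p : A → Bool) xs → # p xs ≤ length xs
#≤length p xs = ≤-trans (#-mono (λ _ → Bₚ.≤-maximum _) xs) (≤-reflexive (#-length xs))

-- Moving X to the other side does not enlarge a maximum cut.
maxCut : ∀ {n} (es : List (Edge n)) → Σ (Fin n → Bool) λ σ → ∀ X → # (cross X) es ≤ 2 * # (cross X) (keep (cross σ) es)
maxCut {n} es with maximum (λ X → # (cross (V.lookup X)) es) (length es) (λ X → #≤length _ es)
... | S , best = σ , half
  where
    σ = V.lookup S
    half : ∀ X → # (cross X) es ≤ 2 * # (cross X) (keep (cross σ) es)
    half X = begin
      # (cross X) es  ≡⟨ #-split (cross σ) (cross X) es ⟩
      in′ + out  ≤⟨ +-monoʳ-≤ in′ (+-cancelˡ-≤ stay out in′ flipped) ⟩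
      in′ + in′  ≡⟨ cong (in′ +_) (sym (+-identityʳ in′)) ⟩
      2 * in′  ≡⟨ cong (2 *_) (sym (#-keep (cross σ) (cross X) es)) ⟩
      2 * # (cross X) (keep (cross σ) es) ∎
      where
        open ≤-Reasoning
        in′ = # (λ e → cross σ e ∧ cross X e) es
        out = # (λ e → not (cross σ e) ∧ cross X e) es
        stay = # (λ e → not (cross X e) ∧ cross σ e) es
        τ : Fin n → Bool
        τ v = σ v xor X v
        bits : ∀ a b c d → (a xor c) xor (b xor d) ≡ (a xor b) xor (c xor d)
        bits true true true d = refl
        bits true true false true = refl
        bits true true false false = refl
        bits true false true true = refl
        bits true false true false = refl
        bits true false false d = refl
        bits false true true true = refl
        bits false true true false = refl
        bits false true false d = refl
        bits false false c d = refl
        -- Switching sides on X exchanges, among the edges that cross X, those inside the cut with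
        -- those outside it; the edges not crossing X keep their status.
        cut-τ : # (cross τ) es ≡ stay + out
        cut-τ = trans (#-split (cross X) (cross τ) es)
          (trans (+-comm (# (λ e → cross X e ∧ cross τ e) es) _)
            (cong₂ _+_ (#-cong (λ e → trans (cong (not (cross X e) ∧_) (bits (σ (proj₁ e)) (σ (proj₂ e)) _ _)) (b₁ (cross X e) (cross σ e))) es)
                       (#-cong (λ e → trans (cong (cross X e ∧_) (bits (σ (proj₁ e)) (σ (proj₂ e)) _ _)) (b₂ (cross X e) (cross σ e))) es)))
          where
            b₁ : ∀ x s → not x ∧ (s xor x) ≡ not x ∧ s
            b₁ true s = refl
            b₁ false true = refl
            b₁ false false = refl
            b₂ : ∀ x s → x ∧ (s xor x) ≡ not s ∧ x
            b₂ true true = refl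
            b₂ true false = refl
            b₂ false true = refl
            b₂ false false = refl
        flipped : stay + out ≤ stay + in′
        flipped = begin
          stay + out  ≡⟨ sym cut-τ ⟩
          # (cross τ) es  ≡⟨ #-cong (λ e → sym (cong₂ _xor_ (lookup∘tabulate τ (proj₁ e)) (lookup∘tabulate τ (proj₂ e)))) es ⟩
          # (cross (V.lookup (V.tabulate τ))) es ≤⟨ best (V.tabulate τ) ⟩
          # (cross σ) es  ≡⟨ #-split (cross X) (cross σ) es ⟩
          # (λ e → cross X e ∧ cross σ e) es + stay ≡⟨ cong (_+ stay) (#-cong (λ e → Bₚ.∧-comm (cross X e) _) es) ⟩
          in′ + stay  ≡⟨ +-comm in′ stay ⟩
          stay + in′  ∎

-- Every crossing edge leaves exactly two classes.
crossing≥ : ∀ {n} (k : ℕ) (es : List (Edge n)) →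
  (∀ X {u v} → X u ≡ true → X v ≡ false → k ≤ 2 * # (cross X) es) →
  ∀ (l : Labeling {n}) → Idem l → 2 ≤ fixes l → k * fixes l ≤ 4 * # (λ e → not (l (proj₁ e) == l (proj₂ e))) es
crossing≥ {n} k es h l I two = begin
  k * fixes l  ≡⟨ sym (∑-* k _) ⟩
  ∑ (λ v → k * ⟦ l v == v ⟧)  ≤⟨ ∑-mono at ⟩
  ∑ (λ v → 2 * # (cross (λ x → l x == v)) es)  ≡⟨ ∑-* 2 _ ⟩
  2 * ∑ (λ v → # (cross (λ x → l x == v)) es)  ≤⟨ *-monoʳ-≤ 2 (∑-#≤ (λ v → cross (λ x → l x == v)) (λ e → not (l (proj₁ e) == l (proj₂ e))) 2 (λ e → one (l (proj₁ e)) (l (proj₂ e))) es) ⟩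
  -- One factor 2 is the loss allowed in `h`, which comes from the maximum cut; the other counts a
  -- crossing edge at both of its classes.
  2 * (2 * # (λ e → not (l (proj₁ e) == l (proj₂ e))) es) ≡⟨ sym (*-assoc 2 2 (# (λ e → not (l (proj₁ e) == l (proj₂ e))) es)) ⟩
  4 * # (λ e → not (l (proj₁ e) == l (proj₂ e))) es  ∎
  where
    open ≤-Reasoning
    at : ∀ v → k * ⟦ l v == v ⟧ ≤ 2 * # (cross (λ x → l x == v)) es
    at v with l v Finₚ.≟ v
    ... | no _ = ≤-trans (≤-reflexive (*-zeroʳ k)) z≤n
    -- A second fixed point lies outside the class of v, so the boundary of this class is a genuine
    -- cut and `h` applies.
    ... | yes p with Finₚ.any? (λ w → (l w Finₚ.≟ w) ×-dec ¬? (v Finₚ.≟ w))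
    ...   | yes (w , q , r) = ≤-trans (≤-reflexive (*-identityʳ k)) (h (λ x → l x == v) {v} {w} (trans (cong (_== v) p) (==-refl v)) (trans (cong (_== v) q) (==-≢ (r ∘ sym))))
    ...   | no none = ⊥₀-elim (1+n≰n (≤-trans two (≤-trans (∑-mono pt) (≤-reflexive (∑-δ v)))))
      where pt : ∀ w → ⟦ l w == w ⟧ ≤ ⟦ v == w ⟧
            pt w with l w Finₚ.≟ w | v Finₚ.≟ w
            ... | no _ | _ = z≤n
            ... | yes _ | yes _ = ≤-refl
            ... | yes a | no b = ⊥₀-elim (none (w , a , b))
    one : ∀ a b → ∑ (λ v → ⟦ (a == v) xor (b == v) ⟧) ≤ 2 * ⟦ not (a == b) ⟧
    one a b with a Finₚ.≟ b
    ... | yes refl = ≤-reflexive (trans (∑-cong (λ v → cong ⟦_⟧ (Bₚ.xor-same (a == v)))) (∑-0 n))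
    ... | no _ = ≤-trans (∑-mono (λ v → xor≤ (a == v) (b == v)))
                   (≤-reflexive (trans (∑-+ (λ v → ⟦ a == v ⟧) (λ v → ⟦ b == v ⟧)) (cong₂ _+_ (∑-δ a) (∑-δ b))))
      where xor≤ : ∀ a b → ⟦ a xor b ⟧ ≤ ⟦ a ⟧ + ⟦ b ⟧
            xor≤ true true = z≤n
            xor≤ true false = ≤-refl
            xor≤ false b = ≤-refl

-- Growing edge-disjoint private trees

permute : ∀ {A : Set} {P : A → Set} {xs ys : List A} → xs ↭ ys → All P xs → All P ys
permute Perm.refl a = a
permute (Perm.prep x p) (q ∷ a) = q ∷ permute p a
permute (Perm.swap x y p) (q ∷ r ∷ a) = r ∷ q ∷ permute p a
permute (Perm.trans p q) a = permute q (permute p a)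

#-↭ : ∀ {A : Set} (p : A → Bool) {xs ys} → xs ↭ ys → # p xs ≡ # p ys
#-↭ p Perm.refl = refl
#-↭ p (Perm.prep x h) = cong (⟦ p x ⟧ +_) (#-↭ p h)
#-↭ p (Perm.swap {xs} {ys} x y h) = trans (cong (λ z → ⟦ p x ⟧ + (⟦ p y ⟧ + z)) (#-↭ p h)) (+-left-comm ⟦ p x ⟧ ⟦ p y ⟧ (# p ys))
#-↭ p (Perm.trans h k) = trans (#-↭ p h) (#-↭ p k)

∑-#≡ : ∀ {n} (xs : List (Fin n)) → ∑ (λ v → # (_== v) xs) ≡ length xs
∑-#≡ {n} [] = ∑-0 n
∑-#≡ (x ∷ xs) = trans (∑-+ (λ v → ⟦ x == v ⟧) (λ v → # (_== v) xs)) (cong₂ _+_ (∑-δ x) (∑-#≡ xs))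

#⇒↭ : ∀ {A : Set} (eq : A → A → Bool) → (∀ x → eq x x ≡ true) → (∀ x y → eq x y ≡ true → x ≡ y) →
  ∀ xs ys → (∀ v → # (λ x → eq x v) xs ≡ # (λ x → eq x v) ys) → xs ↭ ys
#⇒↭ eq r t [] [] h = ↭-refl
#⇒↭ eq r t [] (y ∷ ys) h = ⊥₀-elim (0≢1+n (trans (h y) (cong (λ b → ⟦ b ⟧ + # (λ x → eq x y) ys) (r y))))
#⇒↭ eq r t (x ∷ xs) ys h with #-find {p = λ z → eq z x} ys (≤-trans (≤-trans (≤-reflexive (cong ⟦_⟧ (sym (r x)))) (m≤m+n _ _)) (≤-reflexive (h x)))
... | z , m , e with t z x e
... | refl with ∈ₚ.∈-∃++ m
... | as , bs , refl = ↭-trans (Perm.prep x (#⇒↭ eq r t xs (as ++ bs) λ v → +-cancelˡ-≡ ⟦ eq x v ⟧ _ _ (trans (h v) (#-↭ (λ z → eq z v) (Permₚ.shift x as bs)))))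
                               (↭-sym (Permₚ.shift x as bs))

opaque
  -- The degree needed per requested branch of depth d. An edge received in one phase causes β
  -- requests of depth d in the next. Of the factor 4, one 2 absorbs the rounding up of capacities
  -- and one 2 the edges removed in the phase.
  growth : ℕ → ℕ → ℕ
  growth β zero    = 1
  growth β (suc d) = 4 * (β * growth β d)

  growth-suc : ∀ β d → growth β (suc d) ≡ 4 * (β * growth β d)
  growth-suc β d = refl

  growth≥1 : ∀ β d → 1 ≤ growth (suc β) d
  growth≥1 β zero = ≤-refl
  growth≥1 β (suc d) = *-mono-≤ {1} {4} (s≤s z≤n) (*-mono-≤ {1} {suc β} (s≤s z≤n) (growth≥1 β d))

module Growing {n : ℕ} (side : Fin n → Bool) (β₀ : ℕ) where
  β = suc β₀

  -- For an edge across the cut this is its end on the given side, `true` standing for A and `false`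
  -- for B. It is total, so that crossing need not be proved before counting.
  endp : Bool → Edge n → Fin n
  endp true  (i , j) = if side i then i else j
  endp false (i , j) = if side i then j else i

  joins : ∀ σ e → SameEdge (endp σ e , endp (not σ) e) e
  joins true  (i , j) with side i
  ... | true  = inj₁ refl
  ... | false = inj₂ refl
  joins false (i , j) with side i
  ... | true  = inj₂ refl
  ... | false = inj₁ refl

  -- Only one edge leaves v, so a single branch yields one path from v; behind that edge there are β
  -- choices at each further step, to dodge forbidden vertices.
  data Branch : ℕ → Fin n → Set where
    leaf : ∀ {v} → Branch 0 v
    node : ∀ {d v y} e → SameEdge (v , y) e → Vec (Branch d y) β → Branch (suc d) v

  edgesᵇ : ∀ {d v} → Branch d v → List (Edge n)
  edgesᵛ : ∀ {d v m} → Vec (Branch d v) m → List (Edge n)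
  edgesᵇ leaf = []
  edgesᵇ (node e _ ts) = e ∷ edgesᵛ ts
  edgesᵛ [] = []
  edgesᵛ (t ∷ ts) = edgesᵇ t ++ edgesᵛ ts

  edgesᵃ : ∀ {d rs} → All (Branch d) rs → List (Edge n)
  edgesᵃ [] = []
  edgesᵃ (t ∷ ts) = edgesᵇ t ++ edgesᵃ ts

  #-permute : ∀ p {d xs ys} (h : xs ↭ ys) (a : All (Branch d) xs) → # p (edgesᵃ (permute h a)) ≡ # p (edgesᵃ a)
  #-permute p Perm.refl a = refl
  #-permute p (Perm.prep x h) (t ∷ a) = trans (#-++ p (edgesᵇ t) _) (trans (cong (# p (edgesᵇ t) +_) (#-permute p h a)) (sym (#-++ p (edgesᵇ t) _)))
  #-permute p (Perm.swap x y h) (t ∷ s ∷ a) = begin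
    # p (edgesᵇ s ++ (edgesᵇ t ++ edgesᵃ (permute h a)))  ≡⟨ #-++ p (edgesᵇ s) _ ⟩
    # p (edgesᵇ s) + # p (edgesᵇ t ++ edgesᵃ (permute h a))  ≡⟨ cong (# p (edgesᵇ s) +_) (trans (#-++ p (edgesᵇ t) _) (cong (# p (edgesᵇ t) +_) (#-permute p h a))) ⟩
    # p (edgesᵇ s) + (# p (edgesᵇ t) + # p (edgesᵃ a))  ≡⟨ +-left-comm (# p (edgesᵇ s)) (# p (edgesᵇ t)) _ ⟩
    # p (edgesᵇ t) + (# p (edgesᵇ s) + # p (edgesᵃ a))  ≡⟨ cong (# p (edgesᵇ t) +_) (sym (#-++ p (edgesᵇ s) _)) ⟩
    # p (edgesᵇ t) + # p (edgesᵇ s ++ edgesᵃ a)  ≡⟨ sym (#-++ p (edgesᵇ t) _) ⟩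
    # p (edgesᵇ t ++ (edgesᵇ s ++ edgesᵃ a))  ∎
    where open ≡-Reasoning
  #-permute p (Perm.trans h k) a = trans (#-permute p k (permute h a)) (#-permute p h a)

  deg : Bool → Fin n → List (Edge n) → ℕ
  deg σ v = # (λ e → endp σ e == v)

  record Phase (σ : Bool) (es : List (Edge n)) (rs : List (Fin n)) (q : ℕ) : Set where
    field
      chosen rest : List (Edge n)
      count : ∀ p → # p chosen + # p rest ≡ # p es
      sent  : ∀ v → deg σ v chosen ≡ # (_== v) rs
      recv  : ∀ v → q * deg (not σ) v chosen ≤ q + deg (not σ) v es

  -- Intersection of two partition matroids, given by the two ends of the edges. Giving every edge
  -- the weight 1/q would satisfy all requests and respect the capacities of the receivers;
  -- `condition` is this fractional argument multiplied by q.
  phase : ∀ σ es rs q → 1 ≤ q → (∀ v → q * # (_== v) rs ≤ deg σ v es) → Phase σ es rs q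
  phase σ es rs (suc κ) _ h =
    let I , p , q , s = intersection (capRank-isRank χ₁ ρ) (capRank-isRank χ₂ cap) (length rs) condition
        le₁ = capRank-tight χ₁ ρ I (≤-reflexive (trans s (sym p)))
        le₂ = capRank-tight χ₂ cap I (≤-reflexive (trans s (sym q)))
    in record
      { chosen = select xs I ; rest = select xs (∁ I)
      ; count = λ p → trans (#-select-∁ p xs I) (cong (# p) (toList∘fromList es))
      ; sent = λ v → trans (sym (col-select (endp σ) xs I v))
                 (∑-squeeze le₁ (≤-reflexive (trans (∑-#≡ rs) (trans (sym s) (sym (∑-col χ₁ I))))) v)
      ; recv = λ v → ≤-trans (*-monoʳ-≤ q′ (≤-trans (≤-reflexive (sym (col-select (endp (not σ)) xs I v))) (le₂ v))) (cap-upper v)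
      }
    where
      q′ = suc κ
      xs = V.fromList es
      χ₁ = V.map (endp σ) xs
      χ₂ = V.map (endp (not σ)) xs
      ρ cap : Fin n → ℕ
      ρ v = # (_== v) rs
      -- Rounding up keeps the capacity at least the 1/q share of the degree; the price is the
      -- additive q in `recv`.
      cap v = suc (deg (not σ) v es / q′)
      cap-upper : ∀ v → q′ * cap v ≤ q′ + deg (not σ) v es
      cap-upper v = ≤-trans (≤-reflexive (*-suc q′ _)) (+-monoʳ-≤ q′ (≤-trans (≤-reflexive (*-comm q′ _)) (m/n*n≤m (deg (not σ) v es) q′)))
      cap-lower : ∀ v → deg (not σ) v es ≤ q′ * cap v
      cap-lower v = begin
        D  ≡⟨ m≡m%n+[m/n]*n D q′ ⟩
        D Data.Nat.% q′ + D / q′ * q′  ≤⟨ +-mono-≤ (<⇒≤ (m%n<n D q′)) (≤-reflexive (*-comm (D / q′) q′)) ⟩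
        q′ + q′ * (D / q′)  ≡⟨ sym (*-suc q′ _) ⟩
        q′ * cap v  ∎
        where open ≤-Reasoning
              D = deg (not σ) v es
      col-full : ∀ τ X v → col (V.map (endp τ) xs) X v ≤ deg τ v es
      col-full τ X v = ≤-trans (≤-reflexive (col-select (endp τ) xs X v)) (≤-trans (#-select≤ _ xs X) (≤-reflexive (cong (# _) (toList∘fromList es))))
      arith : ∀ r x z → q′ * r ≤ x + z → q′ * r ≤ q′ * (r ⊓ x) + z
      arith r x z le with ≤-total r x
      ... | inj₁ rx rewrite m≤n⇒m⊓n≡m rx = m≤m+n _ _
      ... | inj₂ xr rewrite m≥n⇒m⊓n≡n xr = ≤-trans le (+-monoˡ-≤ z (m≤m+n x _))
      condition : ∀ X → length rs ≤ capRank χ₁ ρ X + capRank χ₂ cap (∁ X)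
      condition X = *-cancelˡ-≤ q′ (begin
        q′ * length rs  ≡⟨ cong (q′ *_) (sym (∑-#≡ rs)) ⟩
        q′ * ∑ ρ  ≡⟨ sym (∑-* q′ ρ) ⟩
        ∑ (λ v → q′ * ρ v)  ≤⟨ ∑-mono (λ v → arith (ρ v) (col χ₁ X v) (col χ₁ (∁ X) v) (≤-trans (h v) (≤-reflexive (whole v)))) ⟩
        ∑ (λ v → q′ * (ρ v ⊓ col χ₁ X v) + col χ₁ (∁ X) v)  ≡⟨ ∑-+ (λ v → q′ * (ρ v ⊓ col χ₁ X v)) (col χ₁ (∁ X)) ⟩
        ∑ (λ v → q′ * (ρ v ⊓ col χ₁ X v)) + ∑ (col χ₁ (∁ X))  ≡⟨ cong₂ _+_ (∑-* q′ (λ v → ρ v ⊓ col χ₁ X v)) (∑-col χ₁ (∁ X)) ⟩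
        q′ * capRank χ₁ ρ X + ∣ ∁ X ∣  ≤⟨ +-monoʳ-≤ _ (capRank-lower χ₂ cap κ (∁ X) (λ v → ≤-trans (col-full (not σ) (∁ X) v) (cap-lower v))) ⟩
        q′ * capRank χ₁ ρ X + q′ * capRank χ₂ cap (∁ X)  ≡⟨ sym (*-distribˡ-+ q′ (capRank χ₁ ρ X) _) ⟩
        q′ * (capRank χ₁ ρ X + capRank χ₂ cap (∁ X))  ∎)
        where
          open ≤-Reasoning
          whole : ∀ v → deg σ v es ≡ col χ₁ X v + col χ₁ (∁ X) v
          whole v = trans (sym (trans (#-select-∁ (λ e → endp σ e == v) xs X) (cong (deg σ v) (toList∘fromList es))))
                          (sym (cong₂ _+_ (col-select (endp σ) xs X v) (col-select (endp σ) xs (∁ X) v)))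

  requests : Bool → List (Edge n) → List (Fin n)
  requests σ [] = []
  requests σ (e ∷ es) = L.replicate β (endp σ e) ++ requests σ es

  #-requests : ∀ σ v es → # (_== v) (requests σ es) ≡ β * deg σ v es
  #-requests σ v [] = sym (*-zeroʳ β)
  #-requests σ v (e ∷ es) = trans (#-++ (_== v) (L.replicate β (endp σ e)) _)
    (trans (cong₂ _+_ (rep β) (#-requests σ v es)) (sym (*-distribˡ-+ β ⟦ endp σ e == v ⟧ _)))
    where rep : ∀ k → # (_== v) (L.replicate k (endp σ e)) ≡ k * ⟦ endp σ e == v ⟧
          rep zero = refl
          rep (suc k) = cong (⟦ endp σ e == v ⟧ +_) (rep k)

  toVec : ∀ {d v} k {rs} → All (Branch d) (L.replicate k v ++ rs) → Vec (Branch d v) k × All (Branch d) rs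
  toVec zero a = [] , a
  toVec (suc k) (t ∷ a) = let ts , r = toVec k a in t ∷ ts , r

  #-toVec : ∀ p {d v} k {rs} (a : All (Branch d) (L.replicate k v ++ rs)) →
    # p (edgesᵛ (proj₁ (toVec k a))) + # p (edgesᵃ (proj₂ (toVec k a))) ≡ # p (edgesᵃ a)
  #-toVec p zero a = refl
  #-toVec p (suc k) (t ∷ a) = begin
    # p (edgesᵇ t ++ edgesᵛ ts) + # p (edgesᵃ r)  ≡⟨ cong (_+ # p (edgesᵃ r)) (#-++ p (edgesᵇ t) _) ⟩
    # p (edgesᵇ t) + # p (edgesᵛ ts) + # p (edgesᵃ r)  ≡⟨ +-assoc (# p (edgesᵇ t)) _ _ ⟩
    # p (edgesᵇ t) + (# p (edgesᵛ ts) + # p (edgesᵃ r))  ≡⟨ cong (# p (edgesᵇ t) +_) (#-toVec p k a) ⟩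
    # p (edgesᵇ t) + # p (edgesᵃ a)  ≡⟨ sym (#-++ p (edgesᵇ t) _) ⟩
    # p (edgesᵇ t ++ edgesᵃ a)  ∎
    where open ≡-Reasoning
          ts = proj₁ (toVec k a)
          r = proj₂ (toVec k a)

  extend : ∀ {d} σ es → All (Branch d) (requests (not σ) es) → All (Branch (suc d)) (L.map (endp σ) es)
  extend σ [] a = []
  extend σ (e ∷ es) a = let ts , r = toVec β a in node e (joins σ e) ts ∷ extend σ es r

  #-extend : ∀ p {d} σ es (a : All (Branch d) (requests (not σ) es)) → # p (edgesᵃ (extend σ es a)) ≡ # p es + # p (edgesᵃ a)
  #-extend p σ [] [] = refl
  #-extend p σ (e ∷ es) a = begin
    ⟦ p e ⟧ + # p (edgesᵛ ts ++ edgesᵃ (extend σ es r))  ≡⟨ cong (⟦ p e ⟧ +_) (trans (#-++ p (edgesᵛ ts) _) (cong (# p (edgesᵛ ts) +_) (#-extend p σ es r))) ⟩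
    ⟦ p e ⟧ + (# p (edgesᵛ ts) + (# p es + # p (edgesᵃ r)))  ≡⟨ re ⟦ p e ⟧ (# p (edgesᵛ ts)) (# p es) (# p (edgesᵃ r)) ⟩
    ⟦ p e ⟧ + # p es + (# p (edgesᵛ ts) + # p (edgesᵃ r))  ≡⟨ cong (⟦ p e ⟧ + # p es +_) (#-toVec p β a) ⟩
    ⟦ p e ⟧ + # p es + # p (edgesᵃ a)  ∎
    where open ≡-Reasoning
          ts = proj₁ (toVec β a)
          r = proj₂ (toVec β a)
          re : ∀ a b c d → a + (b + (c + d)) ≡ a + c + (b + d)
          re = solve-∀

  Q : ℕ → ℕ
  Q = growth β

  record Grown (d : ℕ) (es : List (Edge n)) (rs : List (Fin n)) : Set where
    field
      branches : All (Branch d) rs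
      rest     : List (Edge n)
      count    : ∀ p → # p (edgesᵃ branches) + # p rest ≡ # p es
      remains  : ∀ σ v → deg σ v es ≤ 2 ^ d * deg σ v rest

  leaves : ∀ rs → All (Branch 0) rs
  leaves [] = []
  leaves (r ∷ rs) = leaf ∷ leaves rs

  #-leaves : ∀ p rs → # p (edgesᵃ (leaves rs)) ≡ 0
  #-leaves p [] = refl
  #-leaves p (r ∷ rs) = #-leaves p rs

  -- The alternative in `rich` accounts for the sides: a vertex has degree 0 in the role of the
  -- opposite side. Elsewhere the degree is at least 4w, so the additive rounding in `recv` at most
  -- doubles the load.
  module Step {σ es rs} (c w : ℕ) (c≥1 : 1 ≤ c) (c≤w : c ≤ w) (P : Phase σ es rs (4 * w))
    (h : ∀ v → 4 * w * # (_== v) rs ≤ deg σ v es)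
    (rich : ∀ σ v → deg σ v es ≡ 0 ⊎ 4 * w ≤ deg σ v es) where
    open Phase P renaming (chosen to I)

    splits : ∀ τ v → deg τ v I + deg τ v rest ≡ deg τ v es
    splits τ v = count _

    w≥1 : 1 ≤ w
    w≥1 = ≤-trans c≥1 c≤w

    load-arith : ∀ u D → 4 * w * u ≤ 4 * w + D → 4 * w ≤ D → 2 * (w * u) ≤ D
    load-arith u D r big = *-cancelˡ-≤ 2 (begin
      2 * (2 * (w * u))  ≡⟨ re w u ⟩
      4 * w * u  ≤⟨ r ⟩
      4 * w + D  ≤⟨ +-monoˡ-≤ D big ⟩
      D + D  ≡⟨ cong (D +_) (sym (+-identityʳ D)) ⟩
      2 * D  ∎)
      where open ≤-Reasoning
            re : ∀ w u → 2 * (2 * (w * u)) ≡ 4 * w * u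
            re = solve-∀

    load : ∀ v → 2 * (w * deg (not σ) v I) ≤ deg (not σ) v es
    load v with rich (not σ) v
    ... | inj₁ z = ≤-trans (≤-reflexive (trans (cong (λ x → 2 * (w * x)) (n≤0⇒n≡0 (≤-trans (m≤m+n _ _) (≤-reflexive (trans (splits (not σ) v) z))))) (cong (2 *_) (*-zeroʳ w)))) z≤n
    ... | inj₂ big = load-arith (deg (not σ) v I) (deg (not σ) v es) (recv v) big

    4w : 2 ≤ 4 * w
    4w = ≤-trans (s≤s (s≤s z≤n)) (*-monoʳ-≤ 4 w≥1)

    half : ∀ τ v → 2 * deg τ v I ≤ deg τ v es
    half τ v with τ Bₚ.≟ σ
    ... | yes refl = ≤-trans (≤-reflexive (cong (2 *_) (sent v))) (≤-trans (*-monoˡ-≤ (# (_== v) rs) 4w) (h v))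
    ... | no p = subst (λ τ → 2 * deg τ v I ≤ deg τ v es) (sym (Bₚ.¬-not p))
            (≤-trans (*-monoʳ-≤ 2 (≤-trans (≤-reflexive (sym (*-identityˡ _))) (*-monoˡ-≤ (deg (not σ) v I) w≥1))) (load v))

    halve : ∀ u D′ D → u + D′ ≡ D → 2 * u ≤ D → D ≤ 2 * D′
    halve u D′ .(u + D′) refl le = +-cancelˡ-≤ (2 * u) (u + D′) (2 * D′) (begin
      2 * u + (u + D′)  ≤⟨ +-monoˡ-≤ (u + D′) le ⟩
      (u + D′) + (u + D′) ≡⟨ re u D′ ⟩
      2 * u + 2 * D′  ∎)
      where open ≤-Reasoning
            re : ∀ a b → (a + b) + (a + b) ≡ 2 * a + 2 * b
            re = solve-∀

    kept : ∀ τ v → deg τ v es ≤ 2 * deg τ v rest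
    kept τ v = halve (deg τ v I) (deg τ v rest) (deg τ v es) (splits τ v) (half τ v)

    rich′ : ∀ τ v → deg τ v rest ≡ 0 ⊎ c ≤ deg τ v rest
    rich′ τ v with rich τ v
    ... | inj₁ z = inj₁ (n≤0⇒n≡0 (≤-trans (m≤n+m _ (deg τ v I)) (≤-reflexive (trans (splits τ v) z))))
    ... | inj₂ big = inj₂ (*-cancelˡ-≤ 2 (≤-trans (*-mono-≤ {2} {4} (s≤s (s≤s z≤n)) c≤w) (≤-trans big (kept τ v))))

    -- The edges left at a receiver still cover w per received edge. For w = β · Q d this is the
    -- hypothesis of the following phase, with β requests per received edge.
    next : ∀ v → w * deg (not σ) v I ≤ deg (not σ) v rest
    next v = arith (deg (not σ) v I) (deg (not σ) v rest) (deg (not σ) v es) (splits (not σ) v) (load v)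
      where
        arith : ∀ u D′ D → u + D′ ≡ D → 2 * (w * u) ≤ D → w * u ≤ D′
        arith u D′ .(u + D′) refl le = +-cancelˡ-≤ u _ _ (begin
          u + w * u  ≤⟨ +-monoˡ-≤ (w * u) (≤-trans (≤-reflexive (sym (*-identityˡ u))) (*-monoˡ-≤ u w≥1)) ⟩
          w * u + w * u  ≡⟨ cong (w * u +_) (sym (+-identityʳ _)) ⟩
          2 * (w * u)  ≤⟨ le ⟩
          u + D′  ∎)
          where open ≤-Reasoning

    perm : L.map (endp σ) I ↭ rs
    perm = #⇒↭ _==_ ==-refl (λ x y → ==-true) _ rs (λ v → trans (#-map v I) (sent v))
      where #-map : ∀ v xs → # (_== v) (L.map (endp σ) xs) ≡ deg σ v xs
            #-map v [] = refl
            #-map v (x ∷ xs) = cong (⟦ endp σ x == v ⟧ +_) (#-map v xs)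

    finish : ∀ {d} → Grown d rest (requests (not σ) I) → Grown (suc d) es rs
    finish {d} G = record
      { branches = permute perm (extend σ I G.branches)
      ; rest = G.rest
      ; count = λ p → trans (cong (_+ # p G.rest) (trans (#-permute p perm (extend σ I G.branches)) (#-extend p σ I G.branches)))
                       (trans (+-assoc (# p I) _ _) (trans (cong (# p I +_) (G.count p)) (count p)))
      ; remains = λ τ v → ≤-trans (kept τ v) (≤-trans (*-monoʳ-≤ 2 (G.remains τ v)) (≤-reflexive (sym (*-assoc 2 (2 ^ d) _))))
      }
      where module G = Grown G

  -- The growth is breadth-first: one phase provides the first edge of all branches simultaneously,
  -- and the receivers on the other side then request the branches behind those edges.
  grow : ∀ d σ es rs → (∀ v → Q d * # (_== v) rs ≤ deg σ v es) → (∀ σ v → deg σ v es ≡ 0 ⊎ Q d ≤ deg σ v es) → Grown d es rs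
  grow zero σ es rs h rich = record
    { branches = leaves rs ; rest = es ; count = λ p → cong (_+ # p es) (#-leaves p rs) ; remains = λ σ v → ≤-reflexive (sym (+-identityʳ _)) }
  grow (suc d) σ es rs h rich = S.finish (grow d (not σ) (Phase.rest P) (requests (not σ) (Phase.chosen P))
      (λ v → ≤-trans (≤-reflexive (trans (cong (Q d *_) (#-requests (not σ) v (Phase.chosen P))) (re (Q d) β _))) (S.next v)) S.rich′)
    where
      w = β * Q d
      w≥Q : Q d ≤ w
      w≥Q = m≤m+n (Q d) _
      h′ : ∀ v → 4 * w * # (_== v) rs ≤ deg σ v es
      h′ v = subst (λ z → z * # (_== v) rs ≤ deg σ v es) (growth-suc β d) (h v)
      rich′ : ∀ τ v → deg τ v es ≡ 0 ⊎ 4 * w ≤ deg τ v es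
      rich′ τ v = subst (λ z → deg τ v es ≡ 0 ⊎ z ≤ deg τ v es) (growth-suc β d) (rich τ v)
      P = phase σ es rs (4 * w) (≤-trans (growth≥1 β₀ d) (≤-trans w≥Q (m≤m+n w _))) h′
      module S = Step (Q d) w (growth≥1 β₀ d) w≥Q P h′ rich′
      re : ∀ a b u → a * (b * u) ≡ b * a * u
      re = solve-∀

-- Parity joins

-- The boundary modulo 2, so that boundaries telescope along walks and a loop contributes nothing.
bd : ∀ {n} → Fin n → Edge n → Bool
bd v (i , j) = (i == v) xor (j == v)

par : ∀ {n} → Fin n → List (Edge n) → Bool
par v []       = false
par v (e ∷ es) = bd v e xor par v es

xor-interchange : ∀ a b c d → (a xor b) xor (c xor d) ≡ (a xor c) xor (b xor d)
xor-interchange a b c d = begin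
  (a xor b) xor (c xor d)  ≡⟨ Bₚ.xor-assoc a b _ ⟩
  a xor (b xor (c xor d))  ≡⟨ cong (a xor_) (trans (sym (Bₚ.xor-assoc b c d)) (trans (cong (_xor d) (Bₚ.xor-comm b c)) (Bₚ.xor-assoc c b d))) ⟩
  a xor (c xor (b xor d))  ≡⟨ sym (Bₚ.xor-assoc a c _) ⟩
  (a xor c) xor (b xor d)  ∎
  where open ≡-Reasoning

xor-cancelˡ : ∀ a b → a xor (a xor b) ≡ b
xor-cancelˡ a b = trans (sym (Bₚ.xor-assoc a a b)) (cong (_xor b) (Bₚ.xor-same a))

xor-chain : ∀ a b c → (a xor b) xor (b xor c) ≡ a xor c
xor-chain a b c = trans (Bₚ.xor-assoc a b _) (cong (a xor_) (xor-cancelˡ b c))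

par-++ : ∀ {n} (v : Fin n) xs ys → par v (xs ++ ys) ≡ par v xs xor par v ys
par-++ v [] ys = refl
par-++ v (x ∷ xs) ys = trans (cong (bd v x xor_) (par-++ v xs ys)) (sym (Bₚ.xor-assoc (bd v x) _ _))

odd : ℕ → Bool
odd zero    = false
odd (suc k) = not (odd k)

odd-+ : ∀ a b → odd (a + b) ≡ odd a xor odd b
odd-+ zero b = refl
odd-+ (suc a) b = trans (cong not (odd-+ a b)) (Bₚ.not-distribˡ-xor (odd a) (odd b))

par-odd : ∀ {n} (v : Fin n) es → par v es ≡ odd (# (bd v) es)
par-odd v [] = refl
par-odd v (e ∷ es) = trans (cong₂ _xor_ (bit (bd v e)) (par-odd v es)) (sym (odd-+ ⟦ bd v e ⟧ _))
  where bit : ∀ b → b ≡ odd ⟦ b ⟧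
        bit true = refl
        bit false = refl

par-↭ : ∀ {n} (v : Fin n) {xs ys} → xs ↭ ys → par v xs ≡ par v ys
par-↭ v {xs} {ys} h = trans (par-odd v xs) (trans (cong odd (#-↭ (bd v) h)) (sym (par-odd v ys)))

flip : ∀ {n} {u v : Fin n} {e} → SameEdge (u , v) e → SameEdge (v , u) e
flip (inj₁ p) = inj₂ p
flip (inj₂ p) = inj₁ p

bd-joins : ∀ {n} {u w : Fin n} {e} → SameEdge (u , w) e → ∀ v → bd v e ≡ (u == v) xor (w == v)
bd-joins (inj₁ refl) v = refl
bd-joins {u = u} {w} (inj₂ refl) v = Bₚ.xor-comm (w == v) (u == v)

module _ {n : ℕ} (ls : List (Edge n)) where

  -- A T-join inside `ls`, where T is the set on which `o` holds.
  Realizable : (Fin n → Bool) → Set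
  Realizable o = Σ (Subset (length ls)) λ X → ∀ v → par v (select (V.fromList ls) X) ≡ o v

par-none : ∀ {n} (v : Fin n) {m} (xs : Vec (Edge n) m) → par v (select xs ⊥) ≡ false
par-none v [] = refl
par-none v (x ∷ xs) = par-none v xs

par-xor : ∀ {n} (v : Fin n) {m} (xs : Vec (Edge n) m) X Y →
  par v (select xs (V.zipWith _xor_ X Y)) ≡ par v (select xs X) xor par v (select xs Y)
par-xor v [] [] [] = refl
par-xor v (x ∷ xs) (false ∷ X) (false ∷ Y) = par-xor v xs X Y
par-xor v (x ∷ xs) (true ∷ X) (false ∷ Y) = trans (cong (bd v x xor_) (par-xor v xs X Y)) (sym (Bₚ.xor-assoc (bd v x) _ _))
par-xor v (x ∷ xs) (false ∷ X) (true ∷ Y) = trans (cong (bd v x xor_) (par-xor v xs X Y))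
  (trans (sym (Bₚ.xor-assoc (bd v x) (par v (select xs X)) _)) (trans (cong (_xor par v (select xs Y)) (Bₚ.xor-comm (bd v x) _)) (Bₚ.xor-assoc (par v (select xs X)) _ _)))
par-xor v (x ∷ xs) (true ∷ X) (true ∷ Y) = trans (par-xor v xs X Y)
  (sym (trans (xor-interchange (bd v x) _ (bd v x) _) (cong (_xor _) (Bₚ.xor-same (bd v x)))))

realize-zero : ∀ {n} (ls : List (Edge n)) → Realizable ls (λ _ → false)
realize-zero ls = ⊥ , λ v → par-none v (V.fromList ls)

realize-xor : ∀ {n} {ls : List (Edge n)} {o o′} → Realizable ls o → Realizable ls o′ → Realizable ls (λ v → o v xor o′ v)
realize-xor {ls = ls} (X , p) (Y , q) = V.zipWith _xor_ X Y , λ v → trans (par-xor v (V.fromList ls) X Y) (cong₂ _xor_ (p v) (q v))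

realize-cong : ∀ {n} {ls : List (Edge n)} {o o′} → (∀ v → o v ≡ o′ v) → Realizable ls o → Realizable ls o′
realize-cong h (X , p) = X , λ v → trans (p v) (h v)

-- Symmetric differences of joins are joins, so this is an equivalence relation. It contains the
-- edges of `ls`, and connectivity makes it total.
Linked : ∀ {n} → List (Edge n) → Fin n → Fin n → Set
Linked ls u w = Realizable ls (λ v → (u == v) xor (w == v))

linked-isEquivalence : ∀ {n} (ls : List (Edge n)) → IsEquivalence (Linked ls)
linked-isEquivalence ls = record
  { refl  = λ {u} → realize-cong {ls = ls} (λ v → sym (Bₚ.xor-same (u == v))) (realize-zero ls)
  ; sym   = λ {u} {w} → realize-cong {ls = ls} (λ v → Bₚ.xor-comm (u == v) (w == v))
  ; trans = λ {u} {w} {x} p q → realize-cong {ls = ls} (λ v → xor-chain (u == v) (w == v) (x == v)) (realize-xor {ls = ls} p q)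
  }

linked-edges : ∀ {n} (ls : List (Edge n)) → All (λ e → Linked ls (proj₁ e) (proj₂ e)) ls
linked-edges [] = []
linked-edges (e ∷ ls) = (true ∷ ⊥ , λ v → trans (cong (bd v e xor_) (par-none v (V.fromList ls))) (Bₚ.xor-identityʳ _))
  ∷ All.map (λ (X , p) → false ∷ X , p) (linked-edges ls)

parity-join : ∀ {n} {ls : List (Edge n)} → (∀ u w → Linked ls u w) → ∀ es → Realizable ls (λ v → par v es)
parity-join {ls = ls} h [] = realize-zero ls
parity-join {ls = ls} h (e ∷ es) = realize-xor {ls = ls} (h (proj₁ e) (proj₂ e)) (parity-join {ls = ls} h es)

connected⇒linked : ∀ {n} {ls : List (Edge n)} → Connected′ ls → ∀ u w → Linked ls u w
connected⇒linked {ls = ls} C = C (linked-isEquivalence ls) (linked-edges ls)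

-- Euler tours

infixr 5 _∷⟨_⟩_
data Walk {n : ℕ} : Fin n → Fin n → Set where
  stop    : ∀ {u} → Walk u u
  _∷⟨_⟩_ : ∀ {u v w} e → SameEdge (u , v) e → Walk v w → Walk u w

walkEdges : ∀ {n} {u v : Fin n} → Walk u v → List (Edge n)
walkEdges stop = []
walkEdges (e ∷⟨ _ ⟩ w) = e ∷ walkEdges w

_++ʷ_ : ∀ {n} {u v w : Fin n} → Walk u v → Walk v w → Walk u w
stop ++ʷ q = q
(e ∷⟨ j ⟩ p) ++ʷ q = e ∷⟨ j ⟩ (p ++ʷ q)

walkEdges-++ : ∀ {n} {u v w : Fin n} (p : Walk u v) (q : Walk v w) → walkEdges (p ++ʷ q) ≡ walkEdges p ++ walkEdges q
walkEdges-++ stop q = refl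
walkEdges-++ (e ∷⟨ _ ⟩ p) q = cong (e ∷_) (walkEdges-++ p q)

par-find : ∀ {n} (v : Fin n) es → par v es ≡ true → ∃ λ e → e ∈ es × bd v e ≡ true
par-find v (e ∷ es) h with bd v e in eq
... | true  = e , here refl , eq
... | false = let f , m , q = par-find v es h in f , there m , q

bd-other : ∀ {n} {v : Fin n} {e} → bd v e ≡ true → ∃ λ z → SameEdge (v , z) e
bd-other {v = v} {i , j} h with i Finₚ.≟ v | j Finₚ.≟ v
... | yes refl | no _ = j , inj₁ refl
... | no _ | yes refl = i , inj₂ refl
bd-other {v = v} {i , j} () | yes refl | yes refl

extract : ∀ {A : Set} {x : A} {xs} → x ∈ xs → ∃ λ ys → xs ↭ x ∷ ys
extract m with ∈ₚ.∈-∃++ m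
... | as , bs , refl = as ++ bs , Permₚ.shift _ as bs

close : ∀ {n} k (x y : Fin n) es → length es ≤ k → (∀ v → par v es ≡ (x == v) xor (y == v)) →
  Σ (Walk y x) λ w → Σ (List (Edge n)) λ rest → walkEdges w ++ rest ↭ es × (∀ v → par v rest ≡ false)
close k x y es le h with y Finₚ.≟ x
... | yes refl = stop , es , ↭-refl , λ v → trans (h v) (Bₚ.xor-same (y == v))
close zero x y [] le h | no p = case trans (h y) (cong₂ _xor_ (==-≢ (p ∘ sym)) (==-refl y)) of λ ()
close (suc k) x y es le h | no p =
  let e , m , b = par-find y es (trans (h y) (cong₂ _xor_ (==-≢ (p ∘ sym)) (==-refl y)))
      z , j = bd-other {v = y} {e} b
      es′ , perm = extract m
      w , rest , q , even = close k x z es′ (s≤s⁻¹ (≤-trans (≤-reflexive (sym (Permₚ.↭-length perm))) le)) (par′ j perm)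
  in e ∷⟨ j ⟩ w , rest , ↭-trans (Perm.prep e q) (↭-sym perm) , even
  where
    par′ : ∀ {z e es′} → SameEdge (y , z) e → es ↭ e ∷ es′ → ∀ v → par v es′ ≡ (x == v) xor (z == v)
    par′ {z} {e} {es′} j perm v = begin
      par v es′  ≡⟨ sym (xor-cancelˡ (bd v e) _) ⟩
      bd v e xor (bd v e xor par v es′)  ≡⟨ cong₂ _xor_ (bd-joins j v) (trans (sym (par-↭ v perm)) (h v)) ⟩
      ((y == v) xor (z == v)) xor ((x == v) xor (y == v))  ≡⟨ Bₚ.xor-comm ((y == v) xor (z == v)) _ ⟩
      ((x == v) xor (y == v)) xor ((y == v) xor (z == v))  ≡⟨ xor-chain (x == v) (y == v) (z == v) ⟩
      (x == v) xor (z == v)  ∎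
      where open ≡-Reasoning

visits : ∀ {n} {a b : Fin n} → Walk a b → Fin n → Bool
visits {a = a} stop u = a == u
visits {a = a} (_ ∷⟨ _ ⟩ w) u = (a == u) ∨ visits w u

visits-start : ∀ {n} {a b : Fin n} (w : Walk a b) → visits w a ≡ true
visits-start {a = a} stop = ==-refl a
visits-start {a = a} (_ ∷⟨ _ ⟩ w) rewrite ==-refl a = refl

visits-edges : ∀ {n} {a b : Fin n} (w : Walk a b) → All (λ e → visits w (proj₁ e) ≡ true × visits w (proj₂ e) ≡ true) (walkEdges w)
visits-edges stop = []
visits-edges {a = a} (_∷⟨_⟩_ {v = v} e j w) = head j ∷ All.map (λ (p , q) → later _ p , later _ q) (visits-edges w)
  where
    later : ∀ x → visits w x ≡ true → (a == x) ∨ visits w x ≡ true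
    later x p rewrite p = Bₚ.∨-zeroʳ (a == x)
    first : (a == a) ∨ visits w a ≡ true
    first rewrite ==-refl a = refl
    head : ∀ {e} → SameEdge (a , v) e → (a == proj₁ e) ∨ visits w (proj₁ e) ≡ true × (a == proj₂ e) ∨ visits w (proj₂ e) ≡ true
    head (inj₁ refl) = first , later v (visits-start w)
    head (inj₂ refl) = later v (visits-start w) , first

split-at : ∀ {n} {a b : Fin n} (w : Walk a b) u → visits w u ≡ true → Σ (Walk a u) λ p → Σ (Walk u b) λ q → walkEdges p ++ walkEdges q ≡ walkEdges w
split-at {a = a} stop u h with ==-true {i = a} {u} h
... | refl = stop , stop , refl
split-at {a = a} (e ∷⟨ j ⟩ w) u h with a Finₚ.≟ u
... | yes refl = stop , (e ∷⟨ j ⟩ w) , refl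
... | no _ = let p , q , r = split-at w u h in e ∷⟨ j ⟩ p , q , cong (e ∷_) r

splice-↭ : ∀ {A : Set} (c₁ x c₂ r es : List A) → x ++ r ↭ es → (c₁ ++ (x ++ c₂)) ++ r ↭ (c₁ ++ c₂) ++ es
splice-↭ c₁ x c₂ r es h = ↭-trans (↭-reflexive (Lₚ.++-assoc c₁ (x ++ c₂) r))
  (↭-trans (Permₚ.++⁺ˡ c₁ (↭-trans (Permₚ.++⁺ʳ r (Permₚ.++-comm x c₂)) (↭-trans (↭-reflexive (Lₚ.++-assoc c₂ x r)) (Permₚ.++⁺ˡ c₂ h))))
           (↭-reflexive (sym (Lₚ.++-assoc c₁ c₂ es))))

↭-connected : ∀ {n} {xs ys : List (Edge n)} → xs ↭ ys → Connected′ xs → Connected′ ys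
↭-connected h C E a = C E (permute (↭-sym h) a)

tour-from : ∀ {n} k {x : Fin n} (c : Walk x x) es → length es ≤ k → Connected′ (walkEdges c ++ es) → (∀ v → par v es ≡ false) →
  Σ (Walk x x) λ w → walkEdges w ↭ walkEdges c ++ es
tour-from k c [] le C even = c , ↭-reflexive (sym (Lₚ.++-identityʳ _))
tour-from (suc k) {x} c es@(e₀ ∷ _) le C even with # (λ e → visits c (proj₁ e) ∨ visits c (proj₂ e)) es in eq
... | zero = ⊥₀-elim (contra (trans (sym (visits-start c)) (trans (C eqv (Allₚ.++⁺ (All.map (λ (p , q) → trans p (sym q)) (visits-edges c)) (All.map (λ (p , q) → trans p (sym q)) out)) x (proj₁ e₀)) (proj₁ (All.head out)))))
  where
    contra : true ≢ false
    contra ()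
    eqv : IsEquivalence (λ u w → visits c u ≡ visits c w)
    eqv = record { refl = refl ; sym = sym ; trans = trans }
    none : ∀ fs → # (λ e → visits c (proj₁ e) ∨ visits c (proj₂ e)) fs ≡ 0 → All (λ e → visits c (proj₁ e) ≡ false × visits c (proj₂ e) ≡ false) fs
    none [] _ = []
    none (f ∷ fs) h with visits c (proj₁ f) ∨ visits c (proj₂ f) in eq
    ... | false = ∨-false eq ∷ none fs h
    out = none es eq
... | suc _ =
  let e , m , b = #-find es (≤-trans (s≤s z≤n) (≤-reflexive (sym eq)))
      u , z , j , vis = touch e (visits c (proj₁ e)) refl b
      es′ , perm = extract m
      le′ = s≤s⁻¹ (≤-trans (≤-reflexive (sym (Permₚ.↭-length perm))) le)
      w , rest , q , even′ = close k u z es′ le′ (par′ j perm)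
      p₁ , p₂ , r = split-at c u vis
      eq′ = trans (walkEdges-++ p₁ ((e ∷⟨ j ⟩ w) ++ʷ p₂)) (cong (walkEdges p₁ ++_) (walkEdges-++ (e ∷⟨ j ⟩ w) p₂))
      same = ↭-trans (↭-reflexive (cong (_++ rest) eq′)) (↭-trans (splice-↭ (walkEdges p₁) (e ∷ walkEdges w) (walkEdges p₂) rest es (↭-trans (Perm.prep e q) (↭-sym perm)))
               (↭-reflexive (cong (_++ es) r)))
      t , s = tour-from k (p₁ ++ʷ ((e ∷⟨ j ⟩ w) ++ʷ p₂)) rest
                (≤-trans (≤-trans (m≤n+m _ (length (walkEdges w))) (≤-reflexive (trans (sym (Lₚ.length-++ (walkEdges w))) (Permₚ.↭-length q)))) le′)
                (↭-connected (↭-sym same) C) even′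
  in t , ↭-trans s same
  where
    touch : ∀ e t → visits c (proj₁ e) ≡ t → t ∨ visits c (proj₂ e) ≡ true → ∃ λ u → ∃ λ z → SameEdge (u , z) e × visits c u ≡ true
    touch e true p _ = proj₁ e , proj₂ e , inj₁ refl , p
    touch e false p q = proj₂ e , proj₁ e , inj₂ refl , q
    par′ : ∀ {u z e es′} → SameEdge (u , z) e → es ↭ e ∷ es′ → ∀ v → par v es′ ≡ (u == v) xor (z == v)
    par′ {e = e} j perm v = trans (sym (xor-cancelˡ (bd v e) _)) (trans (cong₂ _xor_ (bd-joins j v) (trans (sym (par-↭ v perm)) (even v))) (Bₚ.xor-identityʳ _))

euler : ∀ {n} (x : Fin n) es → Connected′ es → (∀ v → par v es ≡ false) → Σ (Walk x x) λ w → walkEdges w ↭ es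
euler x es C even = tour-from (length es) stop es ≤-refl C even

-- Cutting a tour into trails of length 5

record Trail {n : ℕ} : Set where
  constructor trail
  field
    {t₀ t₁ t₂ t₃ t₄ t₅} : Fin n
    e₁ e₂ e₃ e₄ e₅ : Edge n
    j₁ : SameEdge (t₀ , t₁) e₁
    j₂ : SameEdge (t₁ , t₂) e₂
    j₃ : SameEdge (t₂ , t₃) e₃
    j₄ : SameEdge (t₃ , t₄) e₄
    j₅ : SameEdge (t₄ , t₅) e₅

trailEdges : ∀ {n} → Trail {n} → List (Edge n)
trailEdges T = e₁ ∷ e₂ ∷ e₃ ∷ e₄ ∷ e₅ ∷ []
  where open Trail T

chunk : ∀ {n} m {x y : Fin n} (w : Walk x y) → length (walkEdges w) ≡ m * 5 →
  Σ (List (Trail {n})) λ Ts → concatMap trailEdges Ts ≡ walkEdges w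
chunk zero stop h = [] , refl
chunk (suc m) (e₁ ∷⟨ j₁ ⟩ e₂ ∷⟨ j₂ ⟩ e₃ ∷⟨ j₃ ⟩ e₄ ∷⟨ j₄ ⟩ e₅ ∷⟨ j₅ ⟩ w) h =
  let Ts , q = chunk m w (suc-injective (suc-injective (suc-injective (suc-injective (suc-injective h)))))
  in trail e₁ e₂ e₃ e₄ e₅ j₁ j₂ j₃ j₄ j₅ ∷ Ts , cong (λ es → e₁ ∷ e₂ ∷ e₃ ∷ e₄ ∷ e₅ ∷ es) q

-- Exchanging ends of trails with reserved paths

-- If every candidate met an obstruction, the pigeonhole principle would give two candidates
-- excluded by the same one.
pick : ∀ {p m} (bad : Fin p → Fin m → Set) → (∀ k i → Dec (bad k i)) → p < m →
  (∀ k i j → bad k i → bad k j → i ≡ j) → ∃ λ i → ∀ k → ¬ bad k i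
pick bad bad? lt unique with Finₚ.any? (λ i → Finₚ.all? (λ k → ¬? (bad? k i)))
... | yes q = q
... | no none = let i , j , i<j , e = Finₚ.pigeonhole lt f in ⊥₀-elim (Finₚ.<⇒≢ i<j (unique (f i) i j (fbad i) (subst (λ k → bad k j) (sym e) (fbad j))))
  where
    some : ∀ i → ∃ λ k → bad k i
    some i with Finₚ.any? (λ k → bad? k i)
    ... | yes q = q
    ... | no q = ⊥₀-elim (none (i , λ k b → q (k , b)))
    f = proj₁ ∘ some
    fbad : ∀ i → bad (f i) i
    fbad i = proj₂ (some i)

∑-pair : ∀ {n} (f : Fin n → ℕ) {i j} → i ≢ j → f i + f j ≤ ∑ f
∑-pair {n} f {i} {j} p = begin
  f i + f j  ≡⟨ sym (cong₂ _+_ (weigh i) (weigh j)) ⟩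
  ∑ (λ v → f i * ⟦ i == v ⟧) + ∑ (λ v → f j * ⟦ j == v ⟧)  ≡⟨ sym (∑-+ (λ v → f i * ⟦ i == v ⟧) (λ v → f j * ⟦ j == v ⟧)) ⟩
  ∑ (λ v → f i * ⟦ i == v ⟧ + f j * ⟦ j == v ⟧)  ≤⟨ ∑-mono pt ⟩
  ∑ f  ∎
  where
    open ≤-Reasoning
    weigh : ∀ i → ∑ (λ v → f i * ⟦ i == v ⟧) ≡ f i
    weigh i = trans (∑-* (f i) (λ v → ⟦ i == v ⟧)) (trans (cong (f i *_) (∑-δ i)) (*-identityʳ (f i)))
    pt : ∀ v → f i * ⟦ i == v ⟧ + f j * ⟦ j == v ⟧ ≤ f v
    pt v with i Finₚ.≟ v | j Finₚ.≟ v
    ... | yes refl | yes refl = ⊥₀-elim (p refl)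
    ... | yes refl | no _ rewrite *-zeroʳ (f j) | *-identityʳ (f i) = ≤-reflexive (+-identityʳ (f i))
    ... | no _ | yes refl rewrite *-zeroʳ (f i) | *-identityʳ (f j) = ≤-refl
    ... | no _ | no _ rewrite *-zeroʳ (f i) | *-zeroʳ (f j) = z≤n

module _ {n : ℕ} (G : Graph n) where

  mult : Edge n → ℕ
  mult e = # (eqᴱ e) (edges G)

  valid : ∀ {e} → 1 ≤ mult e → e ∈ edges G
  valid {e} h = let f , m , q = #-find (edges G) h in subst (_∈ edges G) (sym (eqᴱ-true {e = e} q)) m

  edge-unique : ∀ {u v e e′} → SameEdge (u , v) e → SameEdge (u , v) e′ → e ∈ edges G → e′ ∈ edges G → e ≡ e′
  edge-unique (inj₁ refl) (inj₁ refl) _ _ = refl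
  edge-unique (inj₂ refl) (inj₂ refl) _ _ = refl
  edge-unique (inj₁ refl) (inj₂ refl) m m′ = ⊥₀-elim (Finₚ.<-asym (proj₁ (∈-edges⁻ G m)) (proj₁ (∈-edges⁻ G m′)))
  edge-unique (inj₂ refl) (inj₁ refl) m m′ = ⊥₀-elim (Finₚ.<-asym (proj₁ (∈-edges⁻ G m)) (proj₁ (∈-edges⁻ G m′)))

  -- One round of exchanges, abstract in the two parts of a trail. Slot i of the reserve at v keeps
  -- a fixed remainder while its A-part varies. `okS` says that the A-part fits this remainder, so
  -- the reserved trails are good at the end as well.
  module Exchange (A B : Fin n → Set) (r : ℕ) (edgesA : ∀ {v} → A v → List (Edge n)) (edgesB : ∀ {v} → B v → List (Edge n))
    (okB : ∀ {v} → A v → B v → Set) (okS : ∀ {v} → A v → Fin r → Set)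
    (choose : ∀ {v} (as : Fin r → A v) → (∀ e → ∑ (λ i → # (eqᴱ e) (edgesA (as i))) ≤ mult e) → ∀ (a : A v) (b : B v) → ∃ λ i → okB (as i) b × okS a i) where

    Item : Set
    Item = Σ (Fin n) λ v → A v × B v

    edgesI : Item → List (Edge n)
    edgesI (v , a , b) = edgesA a ++ edgesB b

    State : Set
    State = ∀ v → Fin r → A v

    total : (Edge n → Bool) → State → ℕ
    total p as = ∑ λ v → ∑ λ i → # p (edgesA (as v i))

    replace : State → ∀ v → Fin r → A v → State
    replace as v i a v′ i′ with v Finₚ.≟ v′ | i Finₚ.≟ i′
    ... | yes refl | yes refl = a
    ... | _ | _ = as v′ i′

    replace-at : ∀ as v i a → replace as v i a v i ≡ a
    replace-at as v i a with v Finₚ.≟ v | i Finₚ.≟ i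
    ... | yes refl | yes refl = refl
    ... | no p | _ = ⊥₀-elim (p refl)
    ... | yes refl | no p = ⊥₀-elim (p refl)

    replace-v : ∀ as v i a v′ i′ → v′ ≢ v → replace as v i a v′ i′ ≡ as v′ i′
    replace-v as v i a v′ i′ p with v Finₚ.≟ v′ | i Finₚ.≟ i′
    ... | yes refl | _ = ⊥₀-elim (p refl)
    ... | no _ | _ = refl

    replace-i : ∀ as v i a i′ → i′ ≢ i → replace as v i a v i′ ≡ as v i′
    replace-i as v i a i′ p with v Finₚ.≟ v | i Finₚ.≟ i′
    ... | _ | yes refl = ⊥₀-elim (p refl)
    ... | yes refl | no _ = refl
    ... | no _ | no _ = refl

    replace-ok : ∀ as v i a → (∀ v i → okS (as v i) i) → okS a i → ∀ v′ i′ → okS (replace as v i a v′ i′) i′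
    replace-ok as v i a h q v′ i′ with v Finₚ.≟ v′ | i Finₚ.≟ i′
    ... | yes refl | yes refl = q
    ... | yes refl | no _ = h v′ i′
    ... | no _ | _ = h v′ i′

    total-replace : ∀ p as v i a → total p (replace as v i a) + # p (edgesA (as v i)) ≡ total p as + # p (edgesA a)
    total-replace p as v i a = +-cancelʳ-≡ (g v) _ _ (begin
      total p as′ + x + g v  ≡⟨ re (total p as′) x (g v) ⟩
      (total p as′ + g v) + x  ≡⟨ cong (_+ x) (∑-update g′ g v λ v′ q → ∑-cong λ i′ → cong (λ z → # p (edgesA z)) (replace-v as v i a v′ i′ q)) ⟩
      (total p as + g′ v) + x  ≡⟨ +-assoc (total p as) _ _ ⟩
      total p as + (g′ v + x)  ≡⟨ cong (total p as +_) inner ⟩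
      total p as + (g v + y)  ≡⟨ re′ (total p as) (g v) y ⟩
      total p as + y + g v  ∎)
      where
        open ≡-Reasoning
        as′ = replace as v i a
        g g′ : Fin n → ℕ
        g v = ∑ λ i → # p (edgesA (as v i))
        g′ v = ∑ λ i → # p (edgesA (as′ v i))
        x = # p (edgesA (as v i))
        y = # p (edgesA a)
        re : ∀ a b c → a + b + c ≡ (a + c) + b
        re = solve-∀
        re′ : ∀ a b c → a + (b + c) ≡ a + c + b
        re′ = solve-∀
        inner : g′ v + x ≡ g v + y
        inner = trans (∑-update (λ i → # p (edgesA (as′ v i))) (λ i → # p (edgesA (as v i))) i λ i′ q → cong (λ z → # p (edgesA z)) (replace-i as v i a i′ q))
          (cong (λ z → g v + # p (edgesA z)) (replace-at as v i a))

    record Result (items : List Item) (as : State) : Set where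
      field
        items′ : List Item
        as′ : State
        goodB : All (λ (v , a , b) → okB a b) items′
        goodS : ∀ v i → okS (as′ v i) i
        count : ∀ p → total p as′ + # p (concatMap edgesI items′) ≡ total p as + # p (concatMap edgesI items)

    run : ∀ items as → (∀ v i → okS (as v i) i) → (∀ e → total (eqᴱ e) as + # (eqᴱ e) (concatMap edgesI items) ≤ mult e) → Result items as
    run [] as h inv = record { items′ = [] ; as′ = as ; goodB = [] ; goodS = h ; count = λ p → refl }
    run ((v , a , b) ∷ items) as h inv =
      let i , q , s = choose (as v) (λ e → ≤-trans (∑-term (λ v → ∑ λ i → # (eqᴱ e) (edgesA (as v i))) v) (≤-trans (m≤m+n _ _) (inv e))) a b
      in continue i q s
      where
        rest = concatMap edgesI items
        continue : ∀ i → okB (as v i) b → okS a i → Result ((v , a , b) ∷ items) as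
        continue i q s = record
          -- The item takes the A-part stored in slot i and deposits its own there; the multiset of
          -- edges does not change.
          { items′ = (v , as v i , b) ∷ R.items′ ; as′ = R.as′ ; goodB = q ∷ R.goodB ; goodS = R.goodS
          ; count = λ p → begin
              total p R.as′ + # p ((edgesA (as v i) ++ edgesB b) ++ concatMap edgesI R.items′)
                ≡⟨ cong (total p R.as′ +_) (trans (#-++ p (edgesA (as v i) ++ edgesB b) _) (cong (_+ # p (concatMap edgesI R.items′)) (#-++ p (edgesA (as v i)) _))) ⟩
              total p R.as′ + (# p (edgesA (as v i)) + # p (edgesB b) + # p (concatMap edgesI R.items′))
                ≡⟨ re₁ (total p R.as′) _ _ (# p (concatMap edgesI R.items′)) ⟩
              (total p R.as′ + # p (concatMap edgesI R.items′)) + # p (edgesA (as v i)) + # p (edgesB b)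
                ≡⟨ cong (λ z → z + # p (edgesA (as v i)) + # p (edgesB b)) (R.count p) ⟩
              (total p as₁ + # p rest) + # p (edgesA (as v i)) + # p (edgesB b)
                ≡⟨ same p i ⟩
              total p as + # p ((edgesA a ++ edgesB b) ++ rest) ∎
          }
          where
            open ≡-Reasoning
            as₁ = replace as v i a
            re₁ : ∀ a b c d → a + (b + c + d) ≡ (a + d) + b + c
            re₁ = solve-∀
            re₂ : ∀ a b c d → (a + b) + c + d ≡ (a + c) + (d + b)
            re₂ = solve-∀
            re₃ : ∀ a b c d → (a + b) + (c + d) ≡ a + (b + c + d)
            re₃ = solve-∀
            same : ∀ p i → (total p (replace as v i a) + # p rest) + # p (edgesA (as v i)) + # p (edgesB b) ≡ total p as + # p ((edgesA a ++ edgesB b) ++ rest)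
            same p i = begin
              (total p (replace as v i a) + # p rest) + # p (edgesA (as v i)) + # p (edgesB b)  ≡⟨ re₂ (total p (replace as v i a)) (# p rest) _ _ ⟩
              (total p (replace as v i a) + # p (edgesA (as v i))) + (# p (edgesB b) + # p rest) ≡⟨ cong (_+ (# p (edgesB b) + # p rest)) (total-replace p as v i a) ⟩
              (total p as + # p (edgesA a)) + (# p (edgesB b) + # p rest)  ≡⟨ re₃ (total p as) (# p (edgesA a)) (# p (edgesB b)) (# p rest) ⟩
              total p as + (# p (edgesA a) + # p (edgesB b) + # p rest)  ≡⟨ cong (total p as +_) (sym (trans (#-++ p (edgesA a ++ edgesB b) _) (cong (_+ # p rest) (#-++ p (edgesA a) _)))) ⟩
              total p as + # p ((edgesA a ++ edgesB b) ++ rest)  ∎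
            inv₁ : ∀ e → total (eqᴱ e) as₁ + # (eqᴱ e) rest ≤ mult e
            inv₁ e = ≤-trans (≤-trans (m≤m+n _ _) (≤-trans (m≤m+n _ (# (eqᴱ e) (edgesB b))) (≤-reflexive (same (eqᴱ e) i)))) (inv e)
            module R = Result (run items as₁ (replace-ok as v i a h s) inv₁)

  -- A trail is cut at its third vertex into `Head` and `Tail`, and at its second vertex into `Leaf`
  -- and `Stub`.
  record Head (u : Fin n) : Set where
    constructor head
    field
      {x₀ x₁} : Fin n
      e₁ e₂ : Edge n
      j₁ : SameEdge (x₀ , x₁) e₁
      j₂ : SameEdge (x₁ , u) e₂

  record Tail (u : Fin n) : Set where
    constructor tail
    field
      {x₃ x₄ x₅} : Fin n
      e₃ e₄ e₅ : Edge n
      j₃ : SameEdge (u , x₃) e₃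
      j₄ : SameEdge (x₃ , x₄) e₄
      j₅ : SameEdge (x₄ , x₅) e₅

  record Leaf (v : Fin n) : Set where
    constructor leafAt
    field
      {x} : Fin n
      e₁ : Edge n
      j₁ : SameEdge (x , v) e₁

  record Stub (v : Fin n) : Set where
    constructor stub
    field
      {x₂ x₃ x₄ x₅} : Fin n
      e₂ e₃ e₄ e₅ : Edge n
      j₂ : SameEdge (v , x₂) e₂
      j₃ : SameEdge (x₂ , x₃) e₃
      j₄ : SameEdge (x₃ , x₄) e₄
      j₅ : SameEdge (x₄ , x₅) e₅

  headEdges : ∀ {u} → Head u → List (Edge n)
  headEdges h = Head.e₁ h ∷ Head.e₂ h ∷ []

  tailEdges : ∀ {u} → Tail u → List (Edge n)
  tailEdges t = Tail.e₃ t ∷ Tail.e₄ t ∷ Tail.e₅ t ∷ []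

  leafEdges : ∀ {v} → Leaf v → List (Edge n)
  leafEdges l = Leaf.e₁ l ∷ []

  stubEdges : ∀ {v} → Stub v → List (Edge n)
  stubEdges s = Stub.e₂ s ∷ Stub.e₃ s ∷ Stub.e₄ s ∷ Stub.e₅ s ∷ []

  -- G is simple, so at most one member of an edge-disjoint family at v contains the edge to w.
  same-first : ∀ {r v w} (es : Fin r → List (Edge n)) → (∀ e → ∑ (λ i → # (eqᴱ e) (es i)) ≤ mult e) →
    ∀ {i j e e′} → e ∈ es i → e′ ∈ es j → SameEdge (w , v) e → SameEdge (w , v) e′ → i ≡ j
  same-first es h {i} {j} {e} {e′} m m′ s s′ with i Finₚ.≟ j
  ... | yes p = p
  ... | no p with edge-unique s s′ (valid (≤-trans (at i m) (h e))) (valid (≤-trans (at j m′) (h e′)))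
    where at : ∀ i {f} → f ∈ es i → 1 ≤ ∑ (λ i → # (eqᴱ f) (es i))
          at i {f} m = ≤-trans (#-pos (eqᴱ-refl f) m) (∑-term (λ i → # (eqᴱ f) (es i)) i)
  ... | refl = ⊥₀-elim (1+n≰n (≤-trans (+-mono-≤ (#-pos (eqᴱ-refl e) m) (#-pos (eqᴱ-refl e) m′))
                 (≤-trans (∑-pair (λ i → # (eqᴱ e) (es i)) p) (≤-trans (h e) (#-edges≤1 G e)))))

  -- x₁ x₂ x₃ x₄ is a path as soon as x₁ ≢ x₄, because consecutive edges are distinct.
  module Cores (tails : ∀ u → Fin 3 → Tail u) (apart : ∀ u i j → Tail.x₄ (tails u i) ≡ Tail.x₄ (tails u j) → i ≡ j) where

    Core : ∀ {u} → Head u → Tail u → Set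
    Core h t = Head.x₁ h ≢ Tail.x₄ t

    -- Two obstructions against three reserves: the new head may collide with t, or the old head
    -- with the reserved tail. The first excludes one slot because edge-disjoint heads reach u from
    -- distinct vertices, the second because of `apart`.
    chooseHead : ∀ {u} (hs : Fin 3 → Head u) → (∀ e → ∑ (λ i → # (eqᴱ e) (headEdges (hs i))) ≤ mult e) →
      ∀ h t → ∃ λ i → Core (hs i) t × Core h (tails u i)
    chooseHead {u} hs inv h t =
      let i , good = pick bad bad? (s≤s (s≤s (s≤s z≤n))) unique
      in i , good zero , good (suc zero)
      where
        bad : Fin 2 → Fin 3 → Set
        bad zero       i = Head.x₁ (hs i) ≡ Tail.x₄ t
        bad (suc zero) i = Head.x₁ h ≡ Tail.x₄ (tails u i)
        bad? : ∀ k i → Dec (bad k i)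
        bad? zero       i = Head.x₁ (hs i) Finₚ.≟ Tail.x₄ t
        bad? (suc zero) i = Head.x₁ h Finₚ.≟ Tail.x₄ (tails u i)
        unique : ∀ k i j → bad k i → bad k j → i ≡ j
        unique zero i j p q = same-first (headEdges ∘ hs) inv (there (here refl)) (there (here refl)) (subst (λ w → SameEdge (w , u) _) p (Head.j₂ (hs i))) (subst (λ w → SameEdge (w , u) _) q (Head.j₂ (hs j)))
        unique (suc zero) i j p q = apart u i j (trans (sym p) q)

    module X = Exchange Head Tail 3 headEdges tailEdges Core (λ {u} h i → Core h (tails u i)) chooseHead

  -- These are the vertices at distance at least three from the end of the leaf; nearer coincidences
  -- would produce a loop or a repeated edge.
  Clear : ∀ {v} → Leaf v → Stub v → Set
  Clear l s = Leaf.x l ≢ Stub.x₃ s × Leaf.x l ≢ Stub.x₄ s × Leaf.x l ≢ Stub.x₅ s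

  On : ∀ {v} → Fin n → Stub v → Set
  On w s = w ≡ Stub.x₃ s ⊎ w ≡ Stub.x₄ s ⊎ w ≡ Stub.x₅ s

  -- `K` carries what is already known about a stub. An exchange of leaves does not alter the stub,
  -- so this knowledge persists.
  module Ends (stubs : ∀ v → Fin 5 → Stub v) (disjoint : ∀ v w i j → On w (stubs v i) → On w (stubs v j) → i ≡ j)
    (K : ∀ {v} → Stub v → Set) where

    -- Four obstructions against five reserves: the new leaf may end at one of three vertices of s,
    -- or the old leaf may end on the reserved stub. The last excludes only one slot, as the
    -- reserved stubs are disjoint there.
    chooseLeaf : ∀ {v} (ls : Fin 5 → Leaf v) → (∀ e → ∑ (λ i → # (eqᴱ e) (leafEdges (ls i))) ≤ mult e) →
      ∀ l (s : Σ (Stub v) K) → ∃ λ i → Clear (ls i) (proj₁ s) × Clear l (stubs v i)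
    chooseLeaf {v} ls inv l (s , _) =
      let i , good = pick bad bad? (s≤s (s≤s (s≤s (s≤s (s≤s z≤n))))) unique
      in i , (good zero , good (suc zero) , good (suc (suc zero))) ,
         ((λ p → good (suc (suc (suc zero))) (inj₁ p)) , (λ p → good (suc (suc (suc zero))) (inj₂ (inj₁ p))) , (λ p → good (suc (suc (suc zero))) (inj₂ (inj₂ p))))
      where
        bad : Fin 4 → Fin 5 → Set
        bad zero             i = Leaf.x (ls i) ≡ Stub.x₃ s
        bad (suc zero)       i = Leaf.x (ls i) ≡ Stub.x₄ s
        bad (suc (suc zero)) i = Leaf.x (ls i) ≡ Stub.x₅ s
        bad (suc (suc (suc zero))) i = On (Leaf.x l) (stubs v i)
        bad? : ∀ k i → Dec (bad k i)
        bad? zero             i = Leaf.x (ls i) Finₚ.≟ Stub.x₃ s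
        bad? (suc zero)       i = Leaf.x (ls i) Finₚ.≟ Stub.x₄ s
        bad? (suc (suc zero)) i = Leaf.x (ls i) Finₚ.≟ Stub.x₅ s
        bad? (suc (suc (suc zero))) i = (Leaf.x l Finₚ.≟ _) ⊎-dec ((Leaf.x l Finₚ.≟ _) ⊎-dec (Leaf.x l Finₚ.≟ _))
        same : ∀ w i j → Leaf.x (ls i) ≡ w → Leaf.x (ls j) ≡ w → i ≡ j
        same w i j p q = same-first (leafEdges ∘ ls) inv (here refl) (here refl) (subst (λ w → SameEdge (w , v) _) p (Leaf.j₁ (ls i))) (subst (λ w → SameEdge (w , v) _) q (Leaf.j₁ (ls j)))
        unique : ∀ k i j → bad k i → bad k j → i ≡ j
        unique zero             i j = same _ i j
        unique (suc zero)       i j = same _ i j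
        unique (suc (suc zero)) i j = same _ i j
        unique (suc (suc (suc zero))) i j = disjoint v _ i j

    module X = Exchange Leaf (λ v → Σ (Stub v) K) 5 leafEdges (λ s → stubEdges (proj₁ s)) (λ l s → Clear l (proj₁ s)) (λ {v} l i → Clear l (stubs v i)) chooseLeaf

-- From trails and reserved paths to a decomposition

concatMap-∘ : ∀ {A B C : Set} (g : B → List C) (h : A → List B) xs →
  concatMap g (concatMap h xs) ≡ concatMap (λ x → concatMap g (h x)) xs
concatMap-∘ g h [] = refl
concatMap-∘ g h (x ∷ xs) = trans (Lₚ.concatMap-++ g (h x) _) (cong (concatMap g (h x) ++_) (concatMap-∘ g h xs))

flat : ∀ {A : Set} {n r} → (Fin n → Fin r → A) → List A
flat {n = n} f = concatMap (λ u → L.tabulate (f u)) (L.tabulate id)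

#-flat : ∀ {A B : Set} (p : B → Bool) (g : A → List B) {n r} (f : Fin n → Fin r → A) →
  # p (concatMap g (flat f)) ≡ ∑ λ u → ∑ λ i → # p (g (f u i))
#-flat p g f = trans (cong (# p) (concatMap-∘ g (λ u → L.tabulate (f u)) (L.tabulate id)))
  (trans (#-concatMap-tabulate p (λ u → concatMap g (L.tabulate (f u))) id) (∑-cong λ u → #-concatMap-tabulate p g (f u)))

All-flat : ∀ {A : Set} {P : A → Set} {n r} {f : Fin n → Fin r → A} → (∀ u i → P (f u i)) → All P (flat f)
All-flat h = Allₚ.concat⁺ (Allₚ.map⁺ (Allₚ.tabulate⁺ λ u → Allₚ.tabulate⁺ (h u)))

#-concatMap-++ : ∀ {A B : Set} (p : B → Bool) (g : A → List B) xs ys → # p (concatMap g (xs ++ ys)) ≡ # p (concatMap g xs) + # p (concatMap g ys)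
#-concatMap-++ p g xs ys = trans (cong (# p) (Lₚ.concatMap-++ g xs ys)) (#-++ p (concatMap g xs) _)

length-filter : ∀ {A : Set} {P : A → Set} (P? : ∀ x → Dec (P x)) xs → length (L.filter P? xs) ≡ # (λ x → does (P? x)) xs
length-filter P? [] = refl
length-filter P? (x ∷ xs) with does (P? x)
... | true  = cong suc (length-filter P? xs)
... | false = length-filter P? xs

∑∑-+ : ∀ {n r} (f g : Fin n → Fin r → ℕ) → ∑ (λ u → ∑ λ i → f u i + g u i) ≡ ∑ (λ u → ∑ (f u)) + ∑ (λ u → ∑ (g u))
∑∑-+ f g = trans (∑-cong λ u → ∑-+ (f u) (g u)) (∑-+ (λ u → ∑ (f u)) (λ u → ∑ (g u)))

module _ {n : ℕ} (G : Graph n) where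

  adjacent : ∀ {u v e} → SameEdge (u , v) e → e ∈ edges G → adj G u v ≡ true
  adjacent (inj₁ refl) m = proj₂ (∈-edges⁻ G m)
  adjacent {u} {v} (inj₂ refl) m = trans (Graph.sym G u v) (proj₂ (∈-edges⁻ G m))

  loopless : ∀ {u v e} → SameEdge (u , v) e → e ∈ edges G → u ≢ v
  loopless s m refl with trans (sym (Graph.irrefl G _)) (adjacent s m)
  ... | ()

  turn : ∀ {e f : Edge n} → SameEdge e f → SameEdge f e
  turn (inj₁ refl) = inj₁ refl
  turn (inj₂ refl) = inj₂ refl

  same-count : ∀ {u v e f} → SameEdge (u , v) f → e ∈ edges G → f ∈ edges G → does (sameEdge? e (u , v)) ≡ eqᴱ e f
  same-count {u} {v} {e} {f} s me mf with eqᴱ e f in eq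
  ... | true with eqᴱ-true {e = e} eq
  ...   | refl = dec-true (sameEdge? e (u , v)) (turn s)
  same-count {u} {v} {e} {f} s me mf | false = dec-false (sameEdge? e (u , v)) λ t →
    case trans (sym (trans (cong (eqᴱ e) (edge-unique G s (turn t) mf me)) (eqᴱ-refl e))) eq of λ ()

  -- Together with `Clear` this lists exactly the pairs at distance at least three along the trail.
  -- Pairs at distance one differ because G has no loops, those at distance two because consecutive
  -- edges are distinct.
  Static : ∀ {v} → Stub G v → Set
  Static {v} s = v ≢ Stub.x₄ s × v ≢ Stub.x₅ s × Stub.x₂ s ≢ Stub.x₅ s

  dup : ∀ {e : Edge n} as {bs} → e ∈ bs → # (eqᴱ e) (as ++ e ∷ bs) ≤ mult G e → ⊥₀
  dup {e} as {bs} m h = 1+n≰n (begin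
    2  ≤⟨ +-mono-≤ (≤-reflexive (sym (cong ⟦_⟧ (eqᴱ-refl e)))) (#-pos {p = eqᴱ e} (eqᴱ-refl e) m) ⟩
    # (eqᴱ e) (e ∷ bs)  ≤⟨ m≤n+m (# (eqᴱ e) (e ∷ bs)) (# (eqᴱ e) as) ⟩
    # (eqᴱ e) as + # (eqᴱ e) (e ∷ bs) ≡⟨ sym (#-++ (eqᴱ e) as (e ∷ bs)) ⟩
    # (eqᴱ e) (as ++ e ∷ bs)  ≤⟨ h ⟩
    mult G e  ≤⟨ #-edges≤1 G e ⟩
    1  ∎)
    where open ≤-Reasoning

  module Path {v} (l : Leaf G v) (s : Stub G v) (c : Clear G l s) (k : Static s)
    (le : ∀ e → # (eqᴱ e) (leafEdges G l ++ stubEdges G s) ≤ mult G e) where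
    open Leaf l
    open Stub s

    on : ∀ {e} → e ∈ leafEdges G l ++ stubEdges G s → e ∈ edges G
    on {e} m = valid G (≤-trans (#-pos {p = eqᴱ e} (eqᴱ-refl e) m) (le e))

    m₁ = on (here refl)
    m₂ = on (there (here refl))
    m₃ = on (there (there (here refl)))
    m₄ = on (there (there (there (here refl))))
    m₅ = on (there (there (there (there (here refl)))))

    -- Consecutive edges are distinct.
    skip : ∀ {a b c e f} as {bs} → SameEdge (a , b) e → SameEdge (b , c) f → e ∈ edges G → f ∈ edges G →
      as ++ e ∷ f ∷ bs ≡ leafEdges G l ++ stubEdges G s → a ≢ c
    skip {e = e} as p q me mf eq refl with edge-unique G p (flip q) me mf
    ... | refl = dup as (here refl) (subst (λ es → # (eqᴱ e) es ≤ mult G e) (sym eq) (le e))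

    vs : Vec (Fin n) 6
    vs = x ∷ v ∷ x₂ ∷ x₃ ∷ x₄ ∷ x₅ ∷ []

    unique : VecU.Unique vs
    unique =
      (loopless j₁ m₁ VA.∷ skip [] j₁ j₂ m₁ m₂ refl VA.∷ proj₁ c VA.∷ proj₁ (proj₂ c) VA.∷ proj₂ (proj₂ c) VA.∷ VA.[]) VP.∷
      (loopless j₂ m₂ VA.∷ skip (e₁ ∷ []) j₂ j₃ m₂ m₃ refl VA.∷ proj₁ k VA.∷ proj₁ (proj₂ k) VA.∷ VA.[]) VP.∷
      (loopless j₃ m₃ VA.∷ skip (e₁ ∷ e₂ ∷ []) j₃ j₄ m₃ m₄ refl VA.∷ proj₂ (proj₂ k) VA.∷ VA.[]) VP.∷
      (loopless j₄ m₄ VA.∷ skip (e₁ ∷ e₂ ∷ e₃ ∷ []) j₄ j₅ m₄ m₅ refl VA.∷ VA.[]) VP.∷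
      (loopless j₅ m₅ VA.∷ VA.[]) VP.∷ VA.[] VP.∷ VP.[]

    path : P5In G
    path = record
      { vtx = V.lookup vs
      ; inj = λ {i} {j} → VecUₚ.lookup-injective unique i j
      ; isPath = λ { zero → adjacent j₁ m₁ ; (suc zero) → adjacent j₂ m₂ ; (suc (suc zero)) → adjacent j₃ m₃
                   ; (suc (suc (suc zero))) → adjacent j₄ m₄ ; (suc (suc (suc (suc zero)))) → adjacent j₅ m₅ } }

    path-count : ∀ e → e ∈ edges G → # (λ f → does (sameEdge? e f)) (p5Edges path) ≡ # (eqᴱ e) (leafEdges G l ++ stubEdges G s)
    path-count e m
      rewrite same-count j₁ m m₁ | same-count j₂ m m₂ | same-count j₃ m m₃ | same-count j₄ m m₄ | same-count j₅ m m₅ = refl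

  Good : Σ (Fin n) (λ v → Leaf G v × Σ (Stub G v) Static) → Set
  Good (v , l , s , _) = Clear G l s

  goodEdges : Σ (Fin n) (λ v → Leaf G v × Σ (Stub G v) Static) → List (Edge n)
  goodEdges (v , l , s , _) = leafEdges G l ++ stubEdges G s

  paths : ∀ items → All Good items → (∀ e → # (eqᴱ e) (concatMap goodEdges items) ≤ mult G e) →
    Σ (List (P5In G)) λ Ps → ∀ e → e ∈ edges G → # (λ f → does (sameEdge? e f)) (concatMap p5Edges Ps) ≡ # (eqᴱ e) (concatMap goodEdges items)
  paths [] [] le = [] , λ e m → refl
  paths ((v , l , s , k) ∷ items) (c ∷ cs) le = P.path ∷ proj₁ rec , λ e m →
      trans (#-++ (λ f → does (sameEdge? e f)) (p5Edges P.path) (concatMap p5Edges (proj₁ rec)))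
      (trans (cong₂ _+_ (P.path-count e m) (proj₂ rec e m)) (sym (#-++ (eqᴱ e) (leafEdges G l ++ stubEdges G s) (concatMap goodEdges items))))
    where
      split : ∀ e → # (eqᴱ e) (leafEdges G l ++ stubEdges G s) + # (eqᴱ e) (concatMap goodEdges items) ≤ mult G e
      split e = ≤-trans (≤-reflexive (sym (#-++ (eqᴱ e) (leafEdges G l ++ stubEdges G s) (concatMap goodEdges items)))) (le e)
      module P = Path l s c k (λ e → ≤-trans (m≤m+n _ _) (split e))
      rec = paths items cs (λ e → ≤-trans (m≤n+m _ (# (eqᴱ e) (leafEdges G l ++ stubEdges G s))) (split e))

  -- Slot by slot, a head with its tail and a leaf with its stub form reserved 5-trails. The numbers
  -- 3 and 5 exceed the numbers of obstructions in `chooseHead` and `chooseLeaf` by one.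
  record Reserves : Set where
    field
      heads    : ∀ u → Fin 3 → Head G u
      tails    : ∀ u → Fin 3 → Tail G u
      apart    : ∀ u i j → Tail.x₄ (tails u i) ≡ Tail.x₄ (tails u j) → i ≡ j
      core     : ∀ u i → Head.x₁ (heads u i) ≢ Tail.x₄ (tails u i)
      leaves   : ∀ v → Fin 5 → Leaf G v
      stubs    : ∀ v → Fin 5 → Stub G v
      disjoint : ∀ v w i j → On G w (stubs v i) → On G w (stubs v j) → i ≡ j
      clear    : ∀ v i → Clear G (leaves v i) (stubs v i)
      static   : ∀ v i → Static (stubs v i)

    weight : (Edge n → Bool) → ℕ
    weight p = ∑ (λ u → ∑ λ i → # p (headEdges G (heads u i)) + # p (tailEdges G (tails u i)))
             + ∑ (λ u → ∑ λ i → # p (leafEdges G (leaves u i)) + # p (stubEdges G (stubs u i)))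

  module Final (Ts : List (Trail {n})) (R : Reserves) (exact : ∀ e → # (eqᴱ e) (concatMap trailEdges Ts) + Reserves.weight R (eqᴱ e) ≡ mult G e) where
    open Reserves R
    module C = Cores G tails apart

    item₀ : Trail {n} → C.X.Item
    item₀ T = t₂ , head e₁ e₂ j₁ j₂ , tail e₃ e₄ e₅ j₃ j₄ j₅
      where open Trail T

    items₀ = L.map item₀ Ts

    edges₀ : ∀ Ts → concatMap C.X.edgesI (L.map item₀ Ts) ≡ concatMap trailEdges Ts
    edges₀ [] = refl
    edges₀ (T ∷ Ts) = cong (trailEdges T ++_) (edges₀ Ts)

    T₀ H₀ TL L₀ SL : (Edge n → Bool) → ℕ
    T₀ p = # p (concatMap C.X.edgesI items₀)
    H₀ p = ∑ λ u → ∑ λ i → # p (headEdges G (heads u i))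
    TL p = ∑ λ u → ∑ λ i → # p (tailEdges G (tails u i))
    L₀ p = ∑ λ u → ∑ λ i → # p (leafEdges G (leaves u i))
    SL p = ∑ λ u → ∑ λ i → # p (stubEdges G (stubs u i))

    total₀ : ∀ e → T₀ (eqᴱ e) + ((H₀ (eqᴱ e) + TL (eqᴱ e)) + (L₀ (eqᴱ e) + SL (eqᴱ e))) ≡ mult G e
    total₀ e = trans (cong₂ _+_ (cong (# (eqᴱ e)) (edges₀ Ts)) (sym (cong₂ _+_ (∑∑-+ (λ u i → # (eqᴱ e) (headEdges G (heads u i))) (λ u i → # (eqᴱ e) (tailEdges G (tails u i)))) (∑∑-+ (λ u i → # (eqᴱ e) (leafEdges G (leaves u i))) (λ u i → # (eqᴱ e) (stubEdges G (stubs u i))))))) (exact e)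

    r₀ = C.X.run items₀ heads core (λ e → ≤-trans (≤-trans (≤-reflexive (+-comm (H₀ (eqᴱ e)) (T₀ (eqᴱ e)))) (+-monoʳ-≤ (T₀ (eqᴱ e)) (≤-trans (m≤m+n _ (TL (eqᴱ e))) (m≤m+n _ _)))) (≤-reflexive (total₀ e)))
    module R₀ = C.X.Result r₀

    reserve₀ : Fin n → Fin 3 → C.X.Item
    reserve₀ u i = u , R₀.as′ u i , tails u i

    -- The reserves of the first round become ordinary items from here on, since their ends have yet
    -- to be exchanged.
    all₀ : List C.X.Item
    all₀ = R₀.items′ ++ flat reserve₀

    core₀ : All (λ (v , h , t) → C.Core h t) all₀
    core₀ = Allₚ.++⁺ R₀.goodB (All-flat {f = reserve₀} R₀.goodS)

    count₀ : ∀ p → # p (concatMap C.X.edgesI all₀) ≡ T₀ p + (H₀ p + TL p)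
    count₀ p = begin
      # p (concatMap C.X.edgesI all₀)  ≡⟨ #-concatMap-++ p C.X.edgesI R₀.items′ _ ⟩
      a + # p (concatMap C.X.edgesI (flat reserve₀)) ≡⟨ cong (a +_) (trans (#-flat p C.X.edgesI reserve₀) (trans (∑-cong λ u → ∑-cong λ i → #-++ p (headEdges G (R₀.as′ u i)) (tailEdges G (tails u i))) (∑∑-+ (λ u i → # p (headEdges G (R₀.as′ u i))) (λ u i → # p (tailEdges G (tails u i)))))) ⟩
      a + (b + TL p)  ≡⟨ re a b (TL p) ⟩
      (b + a) + TL p  ≡⟨ cong (_+ TL p) (R₀.count p) ⟩
      (H₀ p + T₀ p) + TL p  ≡⟨ sym (re (T₀ p) (H₀ p) (TL p)) ⟩
      T₀ p + (H₀ p + TL p)  ∎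
      where
        open ≡-Reasoning
        a = # p (concatMap C.X.edgesI R₀.items′)
        b = C.X.total p R₀.as′
        re : ∀ a b c → a + (b + c) ≡ (b + a) + c
        re = solve-∀

    K₁ : ∀ {v} → Stub G v → Set
    K₁ {v} s = v ≢ Stub.x₄ s

    module E₁ = Ends G stubs disjoint K₁
    module E₂ = Ends G stubs disjoint Static

    convert₁ : ∀ items → All (λ (v , h , t) → C.Core h t) items → Σ (List E₁.X.Item) λ items′ → concatMap E₁.X.edgesI items′ ≡ concatMap C.X.edgesI items
    convert₁ [] [] = [] , refl
    convert₁ ((u , head e₁ e₂ j₁ j₂ , tail e₃ e₄ e₅ j₃ j₄ j₅) ∷ items) (c ∷ cs) =
      let is , q = convert₁ items cs
      in (_ , leafAt e₁ j₁ , stub e₂ e₃ e₄ e₅ j₂ j₃ j₄ j₅ , c) ∷ is , cong (λ es → e₁ ∷ e₂ ∷ e₃ ∷ e₄ ∷ e₅ ∷ es) q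

    convert₂ : ∀ items → All (λ (v , l , s , _) → Clear G l s) items →
      Σ (List E₂.X.Item) λ items′ → ∀ p → # p (concatMap E₂.X.edgesI items′) ≡ # p (concatMap E₁.X.edgesI items)
    convert₂ [] [] = [] , λ p → refl
    convert₂ ((v , leafAt e₁ j₁ , stub e₂ e₃ e₄ e₅ j₂ j₃ j₄ j₅ , k) ∷ items) ((c₃ , c₄ , _) ∷ cs) =
      let is , q = convert₂ items cs
      -- The trail is reversed. The core condition and the two inequalities of the first vertex just
      -- gained form `Static` for the new stub. The inequality between the two extreme vertices is
      -- dropped, as the last edge is about to be exchanged.
      in (_ , leafAt e₅ (flip j₅) , stub e₄ e₃ e₂ e₁ (flip j₄) (flip j₃) (flip j₂) (flip j₁) , k ∘ sym , c₄ ∘ sym , c₃ ∘ sym) ∷ is ,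
         λ p → trans (cong (λ z → ⟦ p e₅ ⟧ + (⟦ p e₄ ⟧ + (⟦ p e₃ ⟧ + (⟦ p e₂ ⟧ + (⟦ p e₁ ⟧ + z))))) (q p)) (re ⟦ p e₁ ⟧ ⟦ p e₂ ⟧ ⟦ p e₃ ⟧ ⟦ p e₄ ⟧ ⟦ p e₅ ⟧ _)
      where re : ∀ a b c d e z → e + (d + (c + (b + (a + z)))) ≡ a + (b + (c + (d + (e + z))))
            re = solve-∀

    items₁ = proj₁ (convert₁ all₀ core₀)

    count₁ : ∀ p → # p (concatMap E₁.X.edgesI items₁) ≡ T₀ p + (H₀ p + TL p)
    count₁ p = trans (cong (# p) (proj₂ (convert₁ all₀ core₀))) (count₀ p)

    total₁ : ∀ e → L₀ (eqᴱ e) + # (eqᴱ e) (concatMap E₁.X.edgesI items₁) + SL (eqᴱ e) ≡ mult G e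
    total₁ e = trans (cong (λ z → L₀ (eqᴱ e) + z + SL (eqᴱ e)) (count₁ (eqᴱ e))) (trans (re (L₀ (eqᴱ e)) (T₀ (eqᴱ e)) (H₀ (eqᴱ e) + TL (eqᴱ e)) (SL (eqᴱ e))) (total₀ e))
      where re : ∀ a b c d → a + (b + c) + d ≡ b + (c + (a + d))
            re = solve-∀

    r₁ = E₁.X.run items₁ leaves clear (λ e → ≤-trans (m≤m+n _ (SL (eqᴱ e))) (≤-reflexive (total₁ e)))
    module R₁ = E₁.X.Result r₁

    items₂ = proj₁ (convert₂ R₁.items′ R₁.goodB)

    total₂ : ∀ e → E₂.X.total (eqᴱ e) R₁.as′ + # (eqᴱ e) (concatMap E₂.X.edgesI items₂) + SL (eqᴱ e) ≡ mult G e
    total₂ e = trans (cong (_+ SL (eqᴱ e)) (trans (cong (E₂.X.total (eqᴱ e) R₁.as′ +_) (proj₂ (convert₂ R₁.items′ R₁.goodB) (eqᴱ e))) (R₁.count (eqᴱ e)))) (total₁ e)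

    -- The second pass continues with the reserve leaves left by the first: the reserved stubs are
    -- unchanged, and `R₁.goodS` is the required starting condition.
    r₂ = E₂.X.run items₂ R₁.as′ R₁.goodS (λ e → ≤-trans (m≤m+n _ (SL (eqᴱ e))) (≤-reflexive (total₂ e)))
    module R₂ = E₂.X.Result r₂

    reserve₂ : Fin n → Fin 5 → E₂.X.Item
    reserve₂ v i = v , R₂.as′ v i , stubs v i , static v i

    all₂ : List E₂.X.Item
    all₂ = R₂.items′ ++ flat reserve₂

    good₂ : All Good all₂
    good₂ = Allₚ.++⁺ R₂.goodB (All-flat {f = reserve₂} R₂.goodS)

    count₂ : ∀ e → # (eqᴱ e) (concatMap goodEdges all₂) ≡ mult G e
    count₂ e = begin
      # p (concatMap goodEdges all₂)  ≡⟨ #-concatMap-++ p goodEdges R₂.items′ _ ⟩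
      a + # p (concatMap goodEdges (flat reserve₂)) ≡⟨ cong (a +_) (trans (#-flat p goodEdges reserve₂) (trans (∑-cong λ u → ∑-cong λ i → #-++ p (leafEdges G (R₂.as′ u i)) (stubEdges G (stubs u i))) (∑∑-+ (λ u i → # p (leafEdges G (R₂.as′ u i))) (λ u i → # p (stubEdges G (stubs u i)))))) ⟩
      a + (b + SL p)  ≡⟨ re a b (SL p) ⟩
      (b + a) + SL p  ≡⟨ cong (_+ SL p) (R₂.count p) ⟩
      _  ≡⟨ total₂ e ⟩
      mult G e  ∎
      where
        open ≡-Reasoning
        p = eqᴱ e
        a = # p (concatMap goodEdges R₂.items′)
        b = E₂.X.total p R₂.as′
        re : ∀ a b c → a + (b + c) ≡ (b + a) + c
        re = solve-∀

    decomposition : P5Decomposition G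
    decomposition =
      let Ps , h = paths all₂ good₂ (λ e → ≤-reflexive (count₂ e))
      in Ps , λ e m → trans (length-filter (sameEdge? e) (concatMap p5Edges Ps)) (trans (h e m) (trans (count₂ e) (≤-antisym (#-edges≤1 G e) (#-pos (eqᴱ-refl e) m))))

-- Links along an Euler tour, and private trees at every vertex

∣map∣ : ∀ {A : Set} (p : A → Bool) {m} (xs : Vec A m) → ∣ V.map p xs ∣ ≡ # p (toList xs)
∣map∣ p [] = refl
∣map∣ p (x ∷ xs) = trans (∣∣-∷ (p x) (V.map p xs)) (cong (⟦ p x ⟧ +_) (∣map∣ p xs))

sub-∈ : ∀ {n} {xs ys : List (Edge n)} → (∀ p → # p xs ≤ # p ys) → ∀ {e} → e ∈ xs → e ∈ ys
sub-∈ {ys = ys} h {e} m =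
  let f , m′ , q = #-find {p = eqᴱ e} ys (≤-trans (#-pos (eqᴱ-refl e) m) (h (eqᴱ e)))
  in subst (_∈ ys) (sym (eqᴱ-true {e = e} q)) m′

-- Two consecutive edges of the tour; in the application a and a′ lie in A and the centre b lies in
-- B.
record Link {n : ℕ} : Set where
  constructor link
  field
    {a b a′} : Fin n
    f g : Edge n
    jf : SameEdge (a , b) f
    jg : SameEdge (b , a′) g

linkEdges : ∀ {n} → Link {n} → List (Edge n)
linkEdges l = Link.f l ∷ Link.g l ∷ []

module Sides {n : ℕ} (side : Fin n → Bool) (β₀ : ℕ) where
  open Growing side β₀ public

  Cross : Edge n → Set
  Cross e = cross side e ≡ true

  cross-joins : ∀ {u v e} → Cross e → SameEdge (u , v) e → side v ≡ not (side u)
  cross-joins {u} {v} c (inj₁ refl) = flipped (side u) (side v) c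
    where flipped : ∀ a b → a xor b ≡ true → b ≡ not a
          flipped true false _ = refl
          flipped false true _ = refl
  cross-joins {u} {v} c (inj₂ refl) = flipped (side v) (side u) c
    where flipped : ∀ a b → a xor b ≡ true → a ≡ not b
          flipped true false _ = refl
          flipped false true _ = refl

  endp-joins : ∀ {τ u v e} → side u ≡ τ → side v ≡ not τ → SameEdge (u , v) e → endp τ e ≡ u
  endp-joins {true}  p q (inj₁ refl) rewrite p = refl
  endp-joins {true}  p q (inj₂ refl) rewrite q = refl
  endp-joins {false} p q (inj₁ refl) rewrite p = refl
  endp-joins {false} p q (inj₂ refl) rewrite q = refl

  side-endp : ∀ τ {e} → Cross e → side (endp τ e) ≡ τ
  side-endp true {i , j} c with side i in eq
  ... | true  = eq
  ... | false = c
  side-endp false {i , j} c with side i in eq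
  ... | true  = Bₚ.not-injective c
  ... | false = eq

  deg-off : ∀ τ v {es} → side v ≢ τ → All Cross es → deg τ v es ≡ 0
  deg-off τ v p [] = refl
  deg-off τ v {e ∷ es} p (c ∷ cs) = cong₂ _+_ (cong ⟦_⟧ (==-≢ λ q → p (trans (cong side (sym q)) (side-endp τ c)))) (deg-off τ v p cs)

  inc≤deg : ∀ v {es} → All Cross es → # (inc v) es ≤ deg (side v) v es
  inc≤deg v [] = z≤n
  inc≤deg v {e@(i , j) ∷ es} (c ∷ cs) = +-mono-≤ (bit c) (inc≤deg v cs)
    where
      bit : Cross (i , j) → ⟦ inc v (i , j) ⟧ ≤ ⟦ endp (side v) (i , j) == v ⟧
      bit c with i Finₚ.≟ v | j Finₚ.≟ v
      ... | yes refl | _ = ≤-reflexive (cong ⟦_⟧ (sym (trans (cong (_== v) (endp-joins {side v} refl (cross-joins c (inj₁ refl)) (inj₁ refl))) (==-refl v))))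
      ... | no _ | yes refl = ≤-reflexive (cong ⟦_⟧ (sym (trans (cong (_== v) (endp-joins {side v} {v} {i} refl (cross-joins {v} {i} c (inj₂ refl)) (inj₂ refl))) (==-refl v))))
      ... | no _ | no _ = z≤n

  links : ∀ {x y} (w : Walk x y) → side x ≡ true → side y ≡ true → All Cross (walkEdges w) → List (Link {n})
  links stop p q [] = []
  links (e ∷⟨ j ⟩ stop) p q (c ∷ []) = ⊥₀-elim (case trans (sym q) (trans (cross-joins c j) (cong not p)) of λ ())
  links (e ∷⟨ j ⟩ (f ∷⟨ k ⟩ w)) p q (c ∷ d ∷ cs) = link e f j k ∷ links w (trans (cross-joins d k) (cong not (trans (cross-joins c j) (cong not p)))) q cs

  #-links : ∀ p {x y} (w : Walk x y) hx hy cs → # p (concatMap linkEdges (links w hx hy cs)) ≡ # p (walkEdges w)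
  #-links p stop hx hy [] = refl
  #-links p (e ∷⟨ j ⟩ stop) hx hy (c ∷ []) = ⊥₀-elim (case trans (sym hy) (trans (cross-joins c j) (cong not hx)) of λ ())
  #-links p (e ∷⟨ j ⟩ (f ∷⟨ k ⟩ w)) hx hy (c ∷ d ∷ cs) = cong (λ z → ⟦ p e ⟧ + (⟦ p f ⟧ + z)) (#-links p w _ hy cs)

  centres : List (Link {n}) → List (Fin n)
  centres = L.map Link.b

  -- Each link is charged to its first edge, whose end in B is the centre.
  #-centres : ∀ v {x y} (w : Walk x y) hx hy cs → # (_== v) (centres (links w hx hy cs)) ≤ deg false v (walkEdges w)
  #-centres v stop hx hy [] = z≤n
  #-centres v (e ∷⟨ j ⟩ stop) hx hy (c ∷ []) = ⊥₀-elim (case trans (sym hy) (trans (cross-joins c j) (cong not hx)) of λ ())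
  #-centres v (_∷⟨_⟩_ {v = b} e j (f ∷⟨ k ⟩ w)) hx hy (c ∷ d ∷ cs) =
    +-mono-≤ (≤-reflexive (cong (λ z → ⟦ z == v ⟧) (sym (endp-joins {false} {b} (trans (cross-joins c j) (cong not hx)) hx (flip j)))))
             (≤-trans (#-centres v w _ hy cs) (m≤n+m _ ⟦ endp false f == v ⟧))

  -- Consecutive links share an A-vertex, so a relation between the two ends of every link
  -- propagates along the whole tour.
  chain : ∀ {R : Fin n → Fin n → Set} → IsEquivalence R → ∀ {x y} (w : Walk x y) hx hy cs →
    All (λ l → R (Link.a l) (Link.a′ l)) (links w hx hy cs) → All (λ e → R x (endp true e)) (walkEdges w)
  chain E stop hx hy [] [] = []
  chain E (e ∷⟨ j ⟩ stop) hx hy (c ∷ []) _ = ⊥₀-elim (case trans (sym hy) (trans (cross-joins c j) (cong not hx)) of λ ())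
  chain {R} E {x} (_∷⟨_⟩_ {v = b} e j (_∷⟨_⟩_ {v = z} f k w)) hx hy (c ∷ d ∷ cs) (r ∷ rs) =
    subst (R x) (sym (endp-joins {true} hx hb j)) (IsEquivalence.refl E)
    ∷ subst (R x) (sym (endp-joins {true} {z} {b} hz hb (flip k))) r
    ∷ All.map (IsEquivalence.trans E r) (chain E w _ hy cs rs)
    where
      hb : side b ≡ false
      hb = trans (cross-joins c j) (cong not hx)
      hz : side z ≡ true
      hz = trans (cross-joins d k) (cong not hb)

  copies : ∀ {m} → (Fin m → Fin n) → (Fin m → ℕ) → List (Fin n)
  copies {zero}  g c = []
  copies {suc m} g c = L.replicate (c zero) (g zero) ++ copies (g ∘ suc) (c ∘ suc)

  collect : ∀ {m d} (g : Fin m → Fin n) c → All (Branch d) (copies g c) → ∀ i → Vec (Branch d (g i)) (c i)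
  collect g c a zero    = proj₁ (toVec (c zero) a)
  collect g c a (suc i) = collect (g ∘ suc) (c ∘ suc) (proj₂ (toVec (c zero) a)) i

  opaque
    unfolding ∑
    #-collect : ∀ p {m d} (g : Fin m → Fin n) c (a : All (Branch d) (copies g c)) → ∑ (λ i → # p (edgesᵛ (collect g c a i))) ≡ # p (edgesᵃ a)
    #-collect p {zero} g c [] = refl
    #-collect p {suc m} g c a = trans (cong (# p (edgesᵛ (proj₁ (toVec (c zero) a))) +_) (#-collect p (g ∘ suc) (c ∘ suc) (proj₂ (toVec (c zero) a)))) (#-toVec p (c zero) a)

    #-copies′ : ∀ v {m} (g : Fin m → Fin n) c → # (_== v) (copies g c) ≡ ∑ λ i → c i * ⟦ g i == v ⟧
    #-copies′ v {zero} g c = refl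
    #-copies′ v {suc m} g c = trans (#-++ (_== v) (L.replicate (c zero) (g zero)) _) (cong₂ _+_ (rep (c zero)) (#-copies′ v (g ∘ suc) (c ∘ suc)))
      where rep : ∀ k → # (_== v) (L.replicate k (g zero)) ≡ k * ⟦ g zero == v ⟧
            rep zero = refl
            rep (suc k) = cong (⟦ g zero == v ⟧ +_) (rep k)

  #-copies : ∀ v c → # (_== v) (copies id c) ≡ c v
  #-copies v c = trans (#-copies′ v id c) (trans (∑-cong pt) (trans (∑-* (c v) (λ i → ⟦ v == i ⟧)) (trans (cong (c v *_) (∑-δ v)) (*-identityʳ _))))
    where pt : ∀ i → c i * ⟦ i == v ⟧ ≡ c v * ⟦ v == i ⟧
          pt i with i Finₚ.≟ v
          ... | yes refl = cong (λ z → c v * ⟦ z ⟧) (sym (==-refl v))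
          ... | no p = trans (*-zeroʳ (c i)) (sym (trans (cong (λ z → c v * ⟦ z ⟧) (==-≢ (p ∘ sym))) (*-zeroʳ (c v))))

  splitᵃ : ∀ {d} xs {ys} → All (Branch d) (xs ++ ys) → All (Branch d) xs × All (Branch d) ys
  splitᵃ [] a = [] , a
  splitᵃ (x ∷ xs) (t ∷ a) = let p , q = splitᵃ xs a in t ∷ p , q

  #-splitᵃ : ∀ p {d} xs {ys} (a : All (Branch d) (xs ++ ys)) → # p (edgesᵃ (proj₁ (splitᵃ xs a))) + # p (edgesᵃ (proj₂ (splitᵃ xs a))) ≡ # p (edgesᵃ a)
  #-splitᵃ p [] a = refl
  #-splitᵃ p (x ∷ xs) (t ∷ a) = trans (cong (_+ # p (edgesᵃ (proj₂ (splitᵃ xs a)))) (#-++ p (edgesᵇ t) _))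
    (trans (+-assoc (# p (edgesᵇ t)) _ _) (trans (cong (# p (edgesᵇ t) +_) (#-splitᵃ p xs a)) (sym (#-++ p (edgesᵇ t) _))))

-- The constants

module Numbers (β₀ C₀ : ℕ) where
  C : ℕ
  C = suc C₀

  opaque
    q κ c k : ℕ
    q = growth (suc β₀) 5
    -- If u of the d edges at a vertex of B are used, up to u links and C own trees must be supplied
    -- by the others, so q (u + C) + u ≤ d is wanted. The choice `suc κ` = 2 (q + 1) gives the part
    -- proportional to u half of d.
    κ = suc (2 * q)
    -- Growing trees of depth 5 leaves at least a fraction 1 / 2 ^ 5 of every degree.
    c = 32 * (q * C)
    -- The 4 is that of `crossing≥`, `suc κ` is the share kept by the capacities, and 3 + c is the
    -- number of spanning subgraphs packed.
    k = 4 * (suc κ * (3 + c))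

    q-def : q ≡ growth (suc β₀) 5
    q-def = refl

    c-def : c ≡ 32 * (q * C)
    c-def = refl

    k-def : k ≡ 4 * (suc κ * (3 + c))
    k-def = refl

  opaque
    unfolding κ
    room-expand : ∀ u → 2 * (q * (u + C) + u) ≡ suc κ * u + 2 * (q * C)
    room-expand u = re q u C
      where re : ∀ q u C → 2 * (q * (u + C) + u) ≡ suc (suc (2 * q)) * u + 2 * (q * C)
            re = solve-∀

  2qC≤c : 2 * (q * C) ≤ c
  2qC≤c = ≤-trans (*-monoˡ-≤ (q * C) {2} {32} (s≤s (s≤s z≤n))) (≤-reflexive (sym c-def))

  c-cancel : ∀ d → c ≤ 2 ^ 5 * d → q * C ≤ d
  c-cancel d h = *-cancelˡ-≤ 32 (≤-trans (≤-reflexive (sym c-def)) h)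

  -- A vertex of large degree d keeps enough edges after u ≤ 1 + d / (κ + 1) of them are removed.
  room : ∀ d u → k ≤ 2 * d → suc κ * u ≤ suc κ + d → q * (u + C) + u ≤ d
  room d u big le = *-cancelˡ-≤ 2 (begin
    2 * (q * (u + C) + u)  ≡⟨ room-expand u ⟩
    suc κ * u + 2 * (q * C)  ≤⟨ +-monoˡ-≤ (2 * (q * C)) le ⟩
    suc κ + d + 2 * (q * C)  ≡⟨ re′ (suc κ) d (2 * (q * C)) ⟩
    d + (suc κ + 2 * (q * C))  ≤⟨ +-monoʳ-≤ d bound ⟩
    d + d  ≡⟨ cong (d +_) (sym (+-identityʳ d)) ⟩
    2 * d  ∎)
    where
      open ≤-Reasoning
      re′ : ∀ a d b → a + d + b ≡ d + (a + b)
      re′ = solve-∀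
      bound : suc κ + 2 * (q * C) ≤ d
      bound = *-cancelˡ-≤ 2 (begin
        2 * (suc κ + 2 * (q * C))  ≤⟨ *-monoʳ-≤ 2 (+-monoʳ-≤ (suc κ) 2qC≤c) ⟩
        2 * (suc κ + c)  ≤⟨ *-monoʳ-≤ 2 (+-mono-≤ (≤-reflexive (sym (*-identityʳ (suc κ)))) (≤-trans (≤-reflexive (sym (*-identityˡ c))) (*-monoˡ-≤ c (s≤s (z≤n {κ}))))) ⟩
        2 * (suc κ * 1 + suc κ * c)  ≡⟨ cong (2 *_) (sym (*-distribˡ-+ (suc κ) 1 c)) ⟩
        2 * (suc κ * (1 + c))  ≤⟨ *-mono-≤ {2} {4} (s≤s (s≤s z≤n)) (*-monoʳ-≤ (suc κ) (+-monoˡ-≤ c {1} {3} (s≤s z≤n))) ⟩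
        4 * (suc κ * (3 + c))  ≡⟨ sym k-def ⟩
        k  ≤⟨ big ⟩
        2 * d  ∎)

-- Packing, tour and private trees inside the maximum cut

module Build {n″ : ℕ} (β₀ C₀ : ℕ) (side : Fin (suc (suc n″)) → Bool) (H : List (Edge (suc (suc n″))))
  (H-cross : All (λ e → cross side e ≡ true) H)
  (cut-H : ∀ X {u v} → X u ≡ true → X v ≡ false → Numbers.k β₀ C₀ ≤ 2 * # (cross X) H) where
  open Numbers β₀ C₀
  open Sides side β₀ public

  n : ℕ
  n = suc (suc n″)

  other : ∀ (v : Fin n) → ∃ λ y → y ≢ v
  other zero    = suc zero , λ ()
  other (suc v) = zero , λ ()

  xor≤∨ : ∀ a b → (a xor b) B.≤ (a ∨ b)
  xor≤∨ true true = f≤t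
  xor≤∨ true false = b≤b
  xor≤∨ false b = b≤b

  big : ∀ v → k ≤ 2 * deg (side v) v H
  big v = ≤-trans (cut-H (_== v) {v} {proj₁ (other v)} (==-refl v) (==-≢ (proj₂ (other v))))
    (*-monoʳ-≤ 2 (≤-trans (#-mono (λ e → xor≤∨ (proj₁ e == v) (proj₂ e == v)) H) (inc≤deg v H-cross)))

  cap : Fin n → ℕ
  cap v = suc (deg false v H / suc κ)

  cap-lower : ∀ v → deg false v H ≤ suc κ * cap v
  cap-lower v = begin
    d  ≡⟨ m≡m%n+[m/n]*n d (suc κ) ⟩
    d Data.Nat.% suc κ + d / suc κ * suc κ ≤⟨ +-mono-≤ (<⇒≤ (m%n<n d (suc κ))) (≤-reflexive (*-comm (d / suc κ) (suc κ))) ⟩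
    suc κ + suc κ * (d / suc κ)  ≡⟨ sym (*-suc (suc κ) (d / suc κ)) ⟩
    suc κ * cap v  ∎
    where open ≤-Reasoning
          d = deg false v H

  cap-upper : ∀ v → suc κ * cap v ≤ suc κ + deg false v H
  cap-upper v = ≤-trans (≤-reflexive (*-suc (suc κ) _)) (+-monoʳ-≤ (suc κ) (≤-trans (≤-reflexive (*-comm (suc κ) (deg false v H / suc κ))) (m/n*n≤m (deg false v H) (suc κ))))

  module Pk = Packing (V.fromList H) (endp false)

  opaque
   packed : Pk.Pack c cap
   packed = Pk.pack κ c cap
    (λ v → ≤-trans (≤-reflexive (cong (deg false v) (toList∘fromList H))) (cap-lower v))
    (λ l I two → *-cancelˡ-≤ 4 (begin
      4 * (suc κ * ((3 + c) * fixes l))  ≡⟨ trans (re (suc κ) (3 + c) (fixes l)) (cong (_* fixes l) (sym k-def)) ⟩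
      k * fixes l  ≤⟨ crossing≥ k H cut-H l I two ⟩
      4 * # (crosses l) H  ≡⟨ cong (4 *_) (sym (trans (∣map∣ (crosses l) (V.fromList H)) (cong (# (crosses l)) (toList∘fromList H)))) ⟩
      4 * ∣ Pk.crossing l ∣  ∎))
    where
      open ≤-Reasoning
      crosses : Labeling {n} → Edge n → Bool
      crosses l e = not (l (proj₁ e) == l (proj₂ e))
      re : ∀ a b f → 4 * (a * (b * f)) ≡ 4 * (a * b) * f
      re = solve-∀

  -- All that is retained of the tour is `joined`: the links connect the whole side A. `bound`
  -- expresses at once that the parts are edge-disjoint and that they lie in H.
  record Setup : Set₁ where
    field
      ls     : List (Link {n})
      T₃     : List (Edge n)
      own    : ∀ v → Vec (Branch 5 v) C
      linkB  : All (Branch 5) (centres ls)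
      conn₃  : Connected′ T₃
      joined : ∀ {R : Fin n → Fin n → Set} → IsEquivalence R → All (λ l → R (Link.a l) (Link.a′ l)) ls →
               ∀ u v → side u ≡ true → side v ≡ true → R u v
      bound  : ∀ p → # p (concatMap linkEdges ls) + (# p T₃ + (∑ (λ v → # p (edgesᵛ (own v))) + # p (edgesᵃ linkB))) ≤ # p H

  module FromPack (P : Pk.Pack c cap) where
    open Pk.Pack P

    count-H : ∀ p → # p T₁ + (# p T₂ + # p T₃) + # p D ≡ # p H
    count-H p = trans (count p) (cong (# p) (toList∘fromList H))

    cross-⊆ : ∀ {xs} → (∀ p → # p xs ≤ # p H) → All Cross xs
    cross-⊆ h = All.tabulate λ m → All.lookup H-cross (sub-∈ h m)

    T₁≤ : ∀ p → # p T₁ ≤ # p H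
    T₁≤ p = ≤-trans (≤-trans (m≤m+n _ _) (m≤m+n _ (# p D))) (≤-reflexive (count-H p))

    D≤ : ∀ p → # p D ≤ # p H
    D≤ p = ≤-trans (m≤n+m (# p D) _) (≤-reflexive (count-H p))

    crossD : All Cross D
    crossD = cross-⊆ D≤

    crossT₁ : All Cross T₁
    crossT₁ = cross-⊆ T₁≤

    opaque
      join : Realizable T₂ (λ v → par v T₁)
      join = parity-join {ls = T₂} (connected⇒linked conn₂) T₁

    F K : List (Edge n)
    F = select (V.fromList T₂) (proj₁ join)
    K = T₁ ++ F

    F≤ : ∀ p → # p F ≤ # p T₂
    F≤ p = ≤-trans (#-select≤ p (V.fromList T₂) (proj₁ join)) (≤-reflexive (cong (# p) (toList∘fromList T₂)))

    K≤ : ∀ p → # p K ≤ # p T₁ + # p T₂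
    K≤ p = ≤-trans (≤-reflexive (#-++ p T₁ F)) (+-monoʳ-≤ (# p T₁) (F≤ p))

    K≤H : ∀ p → # p K ≤ # p H
    K≤H p = ≤-trans (K≤ p) (≤-trans (≤-trans (+-monoʳ-≤ (# p T₁) (m≤m+n (# p T₂) (# p T₃))) (m≤m+n _ (# p D))) (≤-reflexive (count-H p)))

    even-K : ∀ v → par v K ≡ false
    even-K v = trans (par-++ v T₁ F) (trans (cong (par v T₁ xor_) (proj₂ join v)) (Bₚ.xor-same (par v T₁)))

    conn-K : Connected′ K
    conn-K E a = conn₁ E (Allₚ.++⁻ˡ T₁ a)

    -- T₁ is spanning, so every vertex of A lies on the tour; this is what turns `chain` into
    -- `joined`.
    near : ∀ v → ∃ λ e → e ∈ T₁ × endp (side v) e ≡ v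
    near v = let e , m , h = #-find T₁ (≤-trans (connected⇒incident conn₁ (proj₂ (other v))) (inc≤deg v crossT₁)) in e , m , ==-true h

    x₀ : Fin n
    x₀ = endp true (proj₁ (near zero))

    side-x₀ : side x₀ ≡ true
    side-x₀ = side-endp true (All.lookup crossT₁ (proj₁ (proj₂ (near zero))))

    opaque
      tour : Σ (Walk x₀ x₀) λ w → walkEdges w ↭ K
      tour = euler x₀ K conn-K even-K

    w = proj₁ tour

    cross-w : All Cross (walkEdges w)
    cross-w = permute (↭-sym (proj₂ tour)) (cross-⊆ K≤H)

    lks : List (Link {n})
    lks = links w side-x₀ side-x₀ cross-w

    #-lks : ∀ p → # p (concatMap linkEdges lks) ≤ # p T₁ + # p T₂
    #-lks p = ≤-trans (≤-reflexive (trans (#-links p w side-x₀ side-x₀ cross-w) (#-↭ p (proj₂ tour)))) (K≤ p)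

    c₀ c₁ : Fin n → ℕ
    c₀ v = if side v then 0 else C
    c₁ v = if side v then C else 0

    used : Fin n → ℕ
    used v = deg false v T₁ + (deg false v T₂ + deg false v T₃)

    centres≤ : ∀ v → # (_== v) (centres lks) ≤ used v
    centres≤ v = ≤-trans (#-centres v w side-x₀ side-x₀ cross-w) (≤-trans (≤-reflexive (#-↭ _ (proj₂ tour)))
      (≤-trans (K≤ _) (+-monoʳ-≤ (deg false v T₁) (m≤m+n (deg false v T₂) (deg false v T₃)))))

    -- The requests at B: one branch for each link at its centre, and C own branches per vertex. The
    -- vertices of A are served by a second growth from the edges left over.
    requests₁ : List (Fin n)
    requests₁ = centres lks ++ copies id c₀

    need₁ : ∀ v → q * # (_== v) requests₁ ≤ deg false v D
    need₁ v = ≤-trans (≤-reflexive (cong (q *_) (trans (#-++ (_== v) (centres lks) _) (cong (# (_== v) (centres lks) +_) (#-copies v c₀))))) (by (side v) refl)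
      where
        by : ∀ b → side v ≡ b → q * (# (_== v) (centres lks) + c₀ v) ≤ deg false v D
        by true eq = ≤-trans (≤-reflexive (trans (cong (q *_) (cong₂ _+_ none (cong (λ b → if b then 0 else C) eq))) (*-zeroʳ q))) z≤n
          where none : # (_== v) (centres lks) ≡ 0
                none = n≤0⇒n≡0 (≤-trans (#-centres v w side-x₀ side-x₀ cross-w) (≤-reflexive (deg-off false v (λ p → case trans (sym eq) p of λ ()) cross-w)))
        -- Here the sparsity at B is spent: the number of links centred at v is at most the degree
        -- of v in the packed subgraphs, and `room` affords q edges for each of them.
        by false eq = +-cancelʳ-≤ (used v) _ _ (begin
          q * (# (_== v) (centres lks) + c₀ v) + used v ≡⟨ cong (λ b → q * (# (_== v) (centres lks) + (if b then 0 else C)) + used v) eq ⟩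
          q * (# (_== v) (centres lks) + C) + used v  ≤⟨ +-monoˡ-≤ (used v) (*-monoʳ-≤ q (+-monoˡ-≤ C (centres≤ v))) ⟩
          q * (used v + C) + used v  ≤⟨ room (deg false v H) (used v) (subst (λ b → k ≤ 2 * deg b v H) eq (big v)) (≤-trans (*-monoʳ-≤ (suc κ) (sparse v)) (cap-upper v)) ⟩
          deg false v H  ≡⟨ sym (count-H _) ⟩
          used v + deg false v D  ≡⟨ +-comm (used v) _ ⟩
          deg false v D + used v  ∎)
          where open ≤-Reasoning

    q≤qC : q ≤ q * C
    q≤qC = ≤-trans (≤-reflexive (sym (*-identityʳ q))) (*-monoʳ-≤ q (s≤s z≤n))

    deg-D : ∀ v → c ≤ deg (side v) v D
    deg-D v = ≤-trans (rich (proj₂ (other v))) (inc≤deg v crossD)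

    rich₁ : ∀ τ v → deg τ v D ≡ 0 ⊎ q ≤ deg τ v D
    rich₁ τ v = by (side v Bₚ.≟ τ)
      where
        by : Dec (side v ≡ τ) → deg τ v D ≡ 0 ⊎ q ≤ deg τ v D
        by (yes p) = inj₂ (subst (λ b → q ≤ deg b v D) p (≤-trans (≤-trans q≤qC (≤-trans (m≤m+n (q * C) _) 2qC≤c)) (deg-D v)))
        by (no p) = inj₁ (deg-off τ v p crossD)

    G₁ : Grown 5 D requests₁
    G₁ = grow 5 false D requests₁ (subst (λ z → ∀ v → z * # (_== v) requests₁ ≤ deg false v D) q-def need₁) (subst (λ z → ∀ τ v → deg τ v D ≡ 0 ⊎ z ≤ deg τ v D) q-def rich₁)

    module Second (G₁ : Grown 5 D requests₁) where
      module G₁ = Grown G₁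

      remain : ∀ v → q * C ≤ deg (side v) v G₁.rest
      remain v = c-cancel (deg (side v) v G₁.rest) (≤-trans (deg-D v) (G₁.remains (side v) v))

      need₂ : ∀ v → q * # (_== v) (copies id c₁) ≤ deg true v G₁.rest
      need₂ v = ≤-trans (≤-reflexive (cong (q *_) (#-copies v c₁))) (by (side v) refl)
        where
          by : ∀ b → side v ≡ b → q * c₁ v ≤ deg true v G₁.rest
          by true eq = ≤-trans (≤-reflexive (cong (λ b → q * (if b then C else 0)) eq)) (subst (λ b → q * C ≤ deg b v G₁.rest) eq (remain v))
          by false eq = ≤-trans (≤-reflexive (trans (cong (λ b → q * (if b then C else 0)) eq) (*-zeroʳ q))) z≤n

      rest≤ : ∀ p → # p G₁.rest ≤ # p D
      rest≤ p = ≤-trans (m≤n+m _ (# p (edgesᵃ G₁.branches))) (≤-reflexive (G₁.count p))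

      rich₂ : ∀ τ v → deg τ v G₁.rest ≡ 0 ⊎ q ≤ deg τ v G₁.rest
      rich₂ τ v = by (side v Bₚ.≟ τ)
        where
          by : Dec (side v ≡ τ) → deg τ v G₁.rest ≡ 0 ⊎ q ≤ deg τ v G₁.rest
          by (yes p) = inj₂ (subst (λ b → q ≤ deg b v G₁.rest) p (≤-trans q≤qC (remain v)))
          by (no p) = inj₁ (n≤0⇒n≡0 (≤-trans (rest≤ (λ e → endp τ e == v)) (≤-reflexive (deg-off τ v p crossD))))

      G₂ : Grown 5 G₁.rest (copies id c₁)
      G₂ = grow 5 true G₁.rest (copies id c₁) (subst (λ z → ∀ v → z * # (_== v) (copies id c₁) ≤ deg true v G₁.rest) q-def need₂) (subst (λ z → ∀ τ v → deg τ v G₁.rest ≡ 0 ⊎ z ≤ deg τ v G₁.rest) q-def rich₂)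

    module Collect (G₁ : Grown 5 D requests₁) (G₂ : Grown 5 (Grown.rest G₁) (copies id c₁)) where
      module G₁ = Grown G₁
      module G₂ = Grown G₂

      linkB : All (Branch 5) (centres lks)
      linkB = proj₁ (splitᵃ (centres lks) G₁.branches)

      A₁ : All (Branch 5) (copies id c₀)
      A₁ = proj₂ (splitᵃ (centres lks) G₁.branches)

      own₀ : ∀ v → Vec (Branch 5 v) (c₀ v)
      own₀ = collect id c₀ A₁

      own₁ : ∀ v → Vec (Branch 5 v) (c₁ v)
      own₁ = collect id c₁ G₂.branches

      merge₂ : ∀ {v} b → Vec (Branch 5 v) (if b then 0 else C) → Vec (Branch 5 v) (if b then C else 0) → Vec (Branch 5 v) C
      merge₂ true  _ ts = ts
      merge₂ false ts _ = ts

      #-merge₂ : ∀ p {v} b (ts : Vec (Branch 5 v) (if b then 0 else C)) us → # p (edgesᵛ (merge₂ b ts us)) ≤ # p (edgesᵛ ts) + # p (edgesᵛ us)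
      #-merge₂ p true  ts us = m≤n+m _ _
      #-merge₂ p false ts us = m≤m+n _ _

      own : ∀ v → Vec (Branch 5 v) C
      own v = merge₂ (side v) (own₀ v) (own₁ v)

      own≤ : ∀ p → ∑ (λ v → # p (edgesᵛ (own v))) ≤ # p (edgesᵃ A₁) + # p (edgesᵃ G₂.branches)
      own≤ p = begin
        ∑ (λ v → # p (edgesᵛ (own v)))  ≤⟨ ∑-mono (λ v → #-merge₂ p (side v) (own₀ v) (own₁ v)) ⟩
        ∑ (λ v → # p (edgesᵛ (own₀ v)) + # p (edgesᵛ (own₁ v)))  ≡⟨ ∑-+ (λ v → # p (edgesᵛ (own₀ v))) (λ v → # p (edgesᵛ (own₁ v))) ⟩
        ∑ (λ v → # p (edgesᵛ (own₀ v))) + ∑ (λ v → # p (edgesᵛ (own₁ v))) ≡⟨ cong₂ _+_ (#-collect p id c₀ A₁) (#-collect p id c₁ G₂.branches) ⟩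
        # p (edgesᵃ A₁) + # p (edgesᵃ G₂.branches)  ∎
        where open ≤-Reasoning

      private-edges : ∀ p → ∑ (λ v → # p (edgesᵛ (own v))) + # p (edgesᵃ linkB) ≤ # p D
      private-edges p = begin
        ∑ (λ v → # p (edgesᵛ (own v))) + b  ≤⟨ +-monoˡ-≤ b (own≤ p) ⟩
        a₁ + a₂ + b  ≡⟨ re a₁ a₂ b ⟩
        (b + a₁) + a₂  ≡⟨ cong (_+ a₂) (#-splitᵃ p (centres lks) G₁.branches) ⟩
        # p (edgesᵃ G₁.branches) + a₂  ≤⟨ +-monoʳ-≤ (# p (edgesᵃ G₁.branches)) (≤-trans (m≤m+n a₂ _) (≤-reflexive (G₂.count p))) ⟩
        # p (edgesᵃ G₁.branches) + # p G₁.rest  ≡⟨ G₁.count p ⟩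
        # p D  ∎
        where open ≤-Reasoning
              b = # p (edgesᵃ linkB)
              a₁ = # p (edgesᵃ A₁)
              a₂ = # p (edgesᵃ G₂.branches)
              re : ∀ x y z → x + y + z ≡ z + x + y
              re = solve-∀

      setup : Setup
      setup = record
        { ls = lks ; T₃ = T₃ ; own = own ; linkB = linkB ; conn₃ = conn₃
        ; joined = λ {R} E rs u v p r →
            let a = chain E w side-x₀ side-x₀ cross-w rs
                reach : ∀ u → side u ≡ true → R x₀ u
                reach u p = let e , m , h = near u
                            in subst (R x₀) (trans (cong (λ b → endp b e) (sym p)) h)
                                 (All.lookup a (Permₚ.∈-resp-↭ (↭-sym (proj₂ tour)) (∈ₚ.∈-++⁺ˡ m)))
            in IsEquivalence.trans E (IsEquivalence.sym E (reach u p)) (reach v r)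
        ; bound = λ p → ≤-trans (+-mono-≤ (#-lks p) (+-monoʳ-≤ (# p T₃) (private-edges p)))
                    (≤-reflexive (trans (re (# p T₁) (# p T₂) (# p T₃) (# p D)) (count-H p)))
        }
        where re : ∀ a b c d → (a + b) + (c + d) ≡ a + (b + c) + d
              re = solve-∀

    result : Setup
    result = Collect.setup G₁ (Second.G₂ G₁)

  setup : Setup
  setup = FromPack.result packed

-- Carving reserved paths out of the private trees

opaque
  unfolding ∑
  ∑-suc : ∀ {n} (f : Fin (suc n) → ℕ) → ∑ f ≡ f zero + ∑ (f ∘ suc)
  ∑-suc f = refl

  ∑-empty : ∀ (f : Fin 0 → ℕ) → ∑ f ≡ 0
  ∑-empty f = refl

  ∑-split : ∀ m {k} (f : Fin (m + k) → ℕ) → ∑ f ≡ ∑ (λ i → f (i Fin.↑ˡ k)) + ∑ (λ i → f (m Fin.↑ʳ i))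
  ∑-split zero f = refl
  ∑-split (suc m) f = trans (cong (f zero +_) (∑-split m (f ∘ suc))) (sym (+-assoc (f zero) _ _))

module Rays {n : ℕ} (G : Graph n) (side : Fin n → Bool) (β₀ : ℕ) where
  open Sides side β₀

  Bounded : List (Edge n) → Set
  Bounded es = ∀ e → # (eqᴱ e) es ≤ mult G e

  opaque
    unfolding ∑
    #-edgesᵛ : ∀ p {d v m} (ts : Vec (Branch d v) m) → # p (edgesᵛ ts) ≡ ∑ λ i → # p (edgesᵇ (V.lookup ts i))
    #-edgesᵛ p [] = refl
    #-edgesᵛ p (t ∷ ts) = trans (#-++ p (edgesᵇ t) _) (cong (# p (edgesᵇ t) +_) (#-edgesᵛ p ts))

  root : ∀ {d v} → Branch (suc d) v → Fin n
  root (node {y = y} e j ts) = y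

  rootEdge : ∀ {d v} → Branch (suc d) v → Edge n
  rootEdge (node e j ts) = e

  root-joins : ∀ {d v} (b : Branch (suc d) v) → SameEdge (v , root b) (rootEdge b)
  root-joins (node e j ts) = j

  rootEdge∈ : ∀ {d v} (b : Branch (suc d) v) → rootEdge b ∈ edgesᵇ b
  rootEdge∈ (node e j ts) = here refl

  ∈-index : ∀ {F : List (Fin n)} {w} (m : w ∈ F) → w ≡ L.lookup F (Any.index m)
  ∈-index (here p) = p
  ∈-index (there m) = ∈-index m

  Bounded-≤ : ∀ xs ys → (∀ p → # p xs ≤ # p ys) → Bounded ys → Bounded xs
  Bounded-≤ xs ys h w e = ≤-trans (h (eqᴱ e)) (w e)

  record Descent {d v} (b : Branch (suc (suc d)) v) (F : List (Fin n)) : Set where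
    field
      child : Branch (suc d) (root b)
      fresh : ∀ w → w ∈ F → root child ≢ w
      count : ∀ p → ⟦ p (rootEdge b) ⟧ + # p (edgesᵇ child) ≤ # p (edgesᵇ b)

  -- Edge-disjoint branches at y have distinct roots because G is simple, so each vertex of F rules
  -- out at most one of the β children.
  descend : ∀ {d v} (b : Branch (suc (suc d)) v) F → length F < β → Bounded (edgesᵇ b) → Descent b F
  descend (node {y = y} e j ts) F lt inv = record
    { child = V.lookup ts i
    ; fresh = λ w m q → good (Any.index m) (trans q (∈-index m))
    ; count = λ p → +-monoʳ-≤ ⟦ p e ⟧ (≤-trans (∑-term (λ i → # p (edgesᵇ (V.lookup ts i))) i) (≤-reflexive (sym (#-edgesᵛ p ts))))
    }
    where
      bad : Fin (length F) → Fin β → Set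
      bad k i = root (V.lookup ts i) ≡ L.lookup F k
      rooted : ∀ {w} i → root (V.lookup ts i) ≡ w → SameEdge (w , y) (rootEdge (V.lookup ts i))
      rooted i q = subst (λ w → SameEdge (w , y) (rootEdge (V.lookup ts i))) q (flip (root-joins (V.lookup ts i)))
      inv′ : ∀ f → ∑ (λ i → # (eqᴱ f) (edgesᵇ (V.lookup ts i))) ≤ mult G f
      inv′ f = ≤-trans (≤-reflexive (sym (#-edgesᵛ (eqᴱ f) ts))) (≤-trans (m≤n+m _ ⟦ eqᴱ f e ⟧) (inv f))
      chosen = pick bad (λ k i → root (V.lookup ts i) Finₚ.≟ L.lookup F k) lt
        (λ k i j p q → same-first G (λ i → edgesᵇ (V.lookup ts i)) inv′ (rootEdge∈ (V.lookup ts i)) (rootEdge∈ (V.lookup ts j)) (rooted i p) (rooted j q))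
      i = proj₁ chosen
      good = proj₂ chosen

  record Ray (v : Fin n) : Set where
    constructor ray
    field
      {r₁ r₂ r₃ r₄ r₅} : Fin n
      f₁ f₂ f₃ f₄ f₅ : Edge n
      k₁ : SameEdge (v , r₁) f₁
      k₂ : SameEdge (r₁ , r₂) f₂
      k₃ : SameEdge (r₂ , r₃) f₃
      k₄ : SameEdge (r₃ , r₄) f₄
      k₅ : SameEdge (r₄ , r₅) f₅

  rayEdges : ∀ {v} → Ray v → List (Edge n)
  rayEdges ρ = Ray.f₁ ρ ∷ Ray.f₂ ρ ∷ Ray.f₃ ρ ∷ Ray.f₄ ρ ∷ Ray.f₅ ρ ∷ []

  -- The vertices controlled by the choice of the ray: `r₁` is dictated by the branch, and a stub
  -- made from the ray ends at `r₄`.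
  OnRay : ∀ {v} → Fin n → Ray v → Set
  OnRay w ρ = w ≡ Ray.r₂ ρ ⊎ w ≡ Ray.r₃ ρ ⊎ w ≡ Ray.r₄ ρ

  record PickedRay {v} (b : Branch 5 v) (F : List (Fin n)) : Set where
    field
      theRay : Ray v
      start  : Ray.r₁ theRay ≡ root b
      avoids : ∀ w → w ∈ F → ¬ OnRay w theRay
      count  : ∀ p → # p (rayEdges theRay) ≤ # p (edgesᵇ b)

  pickRay : ∀ {v} (b : Branch 5 v) F → length F < β → Bounded (edgesᵇ b) → PickedRay b F
  pickRay b F lt w₁ = record
    { theRay = ray (rootEdge b) (rootEdge b₂) (rootEdge b₃) (rootEdge b₄) (rootEdge b₅)
                   (root-joins b) (root-joins b₂) (root-joins b₃) (root-joins b₄) (root-joins b₅)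
    ; start = refl
    ; avoids = λ { w m (inj₁ q) → D₁.fresh w m (sym q) ; w m (inj₂ (inj₁ q)) → D₂.fresh w m (sym q) ; w m (inj₂ (inj₂ q)) → D₃.fresh w m (sym q) }
    ; count = λ p → ≤-trans (+-monoʳ-≤ ⟦ p (rootEdge b) ⟧ (≤-trans (+-monoʳ-≤ ⟦ p (rootEdge b₂) ⟧ (≤-trans (+-monoʳ-≤ ⟦ p (rootEdge b₃) ⟧
                (≤-trans (+-monoʳ-≤ ⟦ p (rootEdge b₄) ⟧ (last p b₅)) (D₄.count p))) (D₃.count p))) (D₂.count p))) (D₁.count p)
    }
    where
      shrink : ∀ {d v} {b : Branch (suc (suc d)) v} {F} (D : Descent b F) → Bounded (edgesᵇ b) → Bounded (edgesᵇ (Descent.child D))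
      shrink {b = b} D = Bounded-≤ (edgesᵇ (Descent.child D)) (edgesᵇ b) (λ p → ≤-trans (m≤n+m (# p (edgesᵇ (Descent.child D))) _) (Descent.count D p))
      last : ∀ p {v} (b : Branch 1 v) → ⟦ p (rootEdge b) ⟧ + 0 ≤ # p (edgesᵇ b)
      last p (node e j ts) = +-monoʳ-≤ ⟦ p e ⟧ z≤n
      D₁ = descend b F lt w₁
      module D₁ = Descent D₁
      b₂ = D₁.child
      w₂ = shrink D₁ w₁
      D₂ = descend b₂ F lt w₂
      module D₂ = Descent D₂
      b₃ = D₂.child
      w₃ = shrink D₂ w₂
      D₃ = descend b₃ F lt w₃
      module D₃ = Descent D₃
      b₄ = D₃.child
      D₄ = descend b₄ F lt (shrink D₃ w₃)
      module D₄ = Descent D₄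
      b₅ = D₄.child

  record PickedRays {v m} (bs : Vec (Branch 5 v) m) (F : List (Fin n)) : Set where
    field
      theRays  : Fin m → Ray v
      starts   : ∀ i → Ray.r₁ (theRays i) ≡ root (V.lookup bs i)
      avoids   : ∀ i w → w ∈ F → ¬ OnRay w (theRays i)
      disjoint : ∀ i j w → OnRay w (theRays i) → OnRay w (theRays j) → i ≡ j
      count    : ∀ p → ∑ (λ i → # p (rayEdges (theRays i))) ≤ # p (edgesᵛ bs)

  -- Greedy choice: each ray adds its three controlled vertices to those that later rays must avoid,
  -- whence the 3 per ray in the hypothesis.
  pickRays : ∀ {v m} (bs : Vec (Branch 5 v) m) F → length F + 3 * m < β → Bounded (edgesᵛ bs) → PickedRays bs F
  pickRays [] F lt w = record
    { theRays = λ () ; starts = λ () ; avoids = λ () ; disjoint = λ () ; count = λ p → ≤-reflexive (∑-empty _) }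
  pickRays {v} {suc m} (b ∷ bs) F lt w = record
    { theRays = rs
    ; starts = λ { zero → P.start ; (suc i) → R.starts i }
    ; avoids = λ { zero → P.avoids ; (suc i) → λ w h → R.avoids i w (there (there (there h))) }
    ; disjoint = λ { zero zero w _ _ → refl ; zero (suc j) w p q → ⊥₀-elim (R.avoids j w (listed p) q)
                   ; (suc i) zero w p q → ⊥₀-elim (R.avoids i w (listed q) p) ; (suc i) (suc j) w p q → cong suc (R.disjoint i j w p q) }
    ; count = λ p → ≤-trans (≤-reflexive (∑-suc (λ i → # p (rayEdges (rs i))))) (≤-trans (+-mono-≤ (P.count p) (R.count p)) (≤-reflexive (sym (#-++ p (edgesᵇ b) _))))
    }
    where
      P = pickRay b F (≤-trans (s≤s (m≤m+n (length F) _)) lt) (Bounded-≤ (edgesᵇ b) (edgesᵇ b ++ edgesᵛ bs) (λ p → ≤-trans (m≤m+n (# p (edgesᵇ b)) (# p (edgesᵛ bs))) (≤-reflexive (sym (#-++ p (edgesᵇ b) (edgesᵛ bs))))) w)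
      module P = PickedRay P
      module ρ = Ray P.theRay
      F′ = ρ.r₂ ∷ ρ.r₃ ∷ ρ.r₄ ∷ F
      re : ∀ a m → 3 + a + 3 * m ≡ a + 3 * suc m
      re = solve-∀
      R = pickRays bs F′ (≤-trans (≤-reflexive (cong suc (re (length F) m))) lt) (Bounded-≤ (edgesᵛ bs) (edgesᵇ b ++ edgesᵛ bs) (λ p → ≤-trans (m≤n+m (# p (edgesᵛ bs)) (# p (edgesᵇ b))) (≤-reflexive (sym (#-++ p (edgesᵇ b) (edgesᵛ bs))))) w)
      module R = PickedRays R
      listed : ∀ {w} → OnRay w P.theRay → w ∈ F′
      listed (inj₁ q) = here q
      listed (inj₂ (inj₁ q)) = there (here q)
      listed (inj₂ (inj₂ q)) = there (there (here q))
      rs : Fin (suc m) → Ray v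
      rs zero = P.theRay
      rs (suc i) = R.theRays i

  record Local (v : Fin n) (bs : Vec (Branch 5 v) 17) : Set where
    field
      rays     : Fin 17 → Ray v
      off-v    : ∀ i → ¬ OnRay v (rays i)
      off-root : ∀ i j → ¬ OnRay (Ray.r₁ (rays i)) (rays j)
      disjoint : ∀ i j w → OnRay w (rays i) → OnRay w (rays j) → i ≡ j
      count    : ∀ p → ∑ (λ i → # p (rayEdges (rays i))) ≤ # p (edgesᵛ bs)

  -- 1 + 17 vertices are avoided from the beginning and 3 more after each ray; 70 exceeds 18 + 3 · 17.
  carve : 70 ≤ β → ∀ v (bs : Vec (Branch 5 v) 17) → Bounded (edgesᵛ bs) → Local v bs
  carve h v bs w = record
    { rays = R.theRays
    ; off-v = λ i → R.avoids i v (here refl)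
    ; off-root = λ i j → R.avoids j _ (there (subst (_∈ L.tabulate (λ i → root (V.lookup bs i))) (sym (R.starts i)) (∈ₚ.∈-tabulate⁺ {f = λ i → root (V.lookup bs i)} i)))
    ; disjoint = R.disjoint
    ; count = R.count
    }
    where
      module R = PickedRays (pickRays bs (v ∷ L.tabulate (λ i → root (V.lookup bs i))) h w)

  module Carved (bs : ∀ v → Vec (Branch 5 v) 17) (loc : ∀ v → Local v (bs v)) where
    module Loc v = Local (loc v)

    -- The 17 = 5 + 5 + 3 + 3 + 1 rays at a vertex become leaves, stubs, heads, tails and a spare.
    iL iS : Fin 5 → Fin 17
    iL i = i Fin.↑ˡ 12
    iS i = 5 Fin.↑ʳ (i Fin.↑ˡ 7)
    iH iT : Fin 3 → Fin 17
    iH i = 10 Fin.↑ʳ (i Fin.↑ˡ 4)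
    iT i = 13 Fin.↑ʳ (i Fin.↑ˡ 1)
    iQ : Fin 17
    iQ = 16 Fin.↑ʳ zero

    leafOf : ∀ {v} → Ray v → Leaf G v
    leafOf ρ = leafAt f₁ (flip k₁)
      where open Ray ρ

    stubOf : ∀ {v} → Ray v → Stub G v
    stubOf ρ = stub f₁ f₂ f₃ f₄ k₁ k₂ k₃ k₄
      where open Ray ρ

    headOf : ∀ {v} → Ray v → Head G v
    headOf ρ = head f₂ f₁ (flip k₂) (flip k₁)
      where open Ray ρ

    tailOf : ∀ {v} → Ray v → Tail G v
    tailOf ρ = tail f₁ f₂ f₃ k₁ k₂ k₃
      where open Ray ρ

    reserves : Reserves G
    reserves = record
      { heads = λ u i → headOf (Loc.rays u (iH i))
      ; tails = λ u i → tailOf (Loc.rays u (iT i))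
      ; apart = λ u i j e → Finₚ.↑ˡ-injective 1 i j (Finₚ.↑ʳ-injective 13 _ _ (Loc.disjoint u (iT i) (iT j) _ (inj₁ refl) (inj₁ e)))
      ; core = λ u i e → Loc.off-root u (iH i) (iT i) (inj₁ e)
      ; leaves = λ v i → leafOf (Loc.rays v (iL i))
      ; stubs = λ v i → stubOf (Loc.rays v (iS i))
      ; disjoint = λ v w i j p q → Finₚ.↑ˡ-injective 7 i j (Finₚ.↑ʳ-injective 5 _ _ (Loc.disjoint v (iS i) (iS j) w p q))
      ; clear = λ v i → (λ e → Loc.off-root v (iL i) (iS i) (inj₁ e)) , (λ e → Loc.off-root v (iL i) (iS i) (inj₂ (inj₁ e))) , (λ e → Loc.off-root v (iL i) (iS i) (inj₂ (inj₂ e)))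
      ; static = λ v i → (λ e → Loc.off-v v (iS i) (inj₂ (inj₁ e))) , (λ e → Loc.off-v v (iS i) (inj₂ (inj₂ e))) , (λ e → Loc.off-root v (iS i) (iS i) (inj₂ (inj₂ e)))
      }

    spare : ∀ v → Ray v
    spare v = Loc.rays v iQ

    module _ (p : Edge n → Bool) where
      private
        leaf≤ : ∀ {v} (ρ : Ray v) → # p (leafEdges G (leafOf ρ)) ≤ # p (rayEdges ρ)
        leaf≤ ρ = +-monoʳ-≤ ⟦ p (Ray.f₁ ρ) ⟧ z≤n

        stub≤ : ∀ {v} (ρ : Ray v) → # p (stubEdges G (stubOf ρ)) ≤ # p (rayEdges ρ)
        stub≤ ρ = +-monoʳ-≤ ⟦ p f₁ ⟧ (+-monoʳ-≤ ⟦ p f₂ ⟧ (+-monoʳ-≤ ⟦ p f₃ ⟧ (+-monoʳ-≤ ⟦ p f₄ ⟧ z≤n)))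
          where open Ray ρ

        tail≤ : ∀ {v} (ρ : Ray v) → # p (tailEdges G (tailOf ρ)) ≤ # p (rayEdges ρ)
        tail≤ ρ = +-monoʳ-≤ ⟦ p f₁ ⟧ (+-monoʳ-≤ ⟦ p f₂ ⟧ (+-monoʳ-≤ ⟦ p f₃ ⟧ z≤n))
          where open Ray ρ

        head≤ : ∀ {v} (ρ : Ray v) → # p (headEdges G (headOf ρ)) ≤ # p (rayEdges ρ)
        head≤ ρ = ≤-trans (≤-reflexive (re ⟦ p f₂ ⟧ ⟦ p f₁ ⟧)) (+-monoʳ-≤ ⟦ p f₁ ⟧ (+-monoʳ-≤ ⟦ p f₂ ⟧ z≤n))
          where open Ray ρ
                re : ∀ a b → a + (b + 0) ≡ b + (a + 0)
                re = solve-∀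

      weight≤ : Reserves.weight reserves p + ∑ (λ v → # p (rayEdges (spare v))) ≤ ∑ (λ v → # p (edgesᵛ (bs v)))
      weight≤ = ≤-trans (≤-reflexive (trans (cong (_+ ∑ Qs) (sym (∑-+ HT LS))) (sym (∑-+ (λ v → HT v + LS v) Qs)))) (∑-mono at)
        where
          HT LS Qs : Fin n → ℕ
          HT v = ∑ λ i → # p (headEdges G (headOf (Loc.rays v (iH i)))) + # p (tailEdges G (tailOf (Loc.rays v (iT i))))
          LS v = ∑ λ i → # p (leafEdges G (leafOf (Loc.rays v (iL i)))) + # p (stubEdges G (stubOf (Loc.rays v (iS i))))
          Qs v = # p (rayEdges (spare v))
          at : ∀ v → HT v + LS v + Qs v ≤ # p (edgesᵛ (bs v))
          at v = ≤-trans (+-mono-≤ (+-mono-≤ (≤-trans (≤-reflexive (∑-+ {3} _ _)) (+-mono-≤ (∑-mono (λ i → head≤ (Loc.rays v (iH i)))) (∑-mono (λ i → tail≤ (Loc.rays v (iT i))))))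
                                             (≤-trans (≤-reflexive (∑-+ {5} _ _)) (+-mono-≤ (∑-mono (λ i → leaf≤ (Loc.rays v (iL i)))) (∑-mono (λ i → stub≤ (Loc.rays v (iS i)))))))
                                   (∑-term (λ (i : Fin 1) → f (16 Fin.↑ʳ i)) zero))
                 (≤-trans (≤-reflexive (sym total)) (Loc.count v p))
            where
              f : Fin 17 → ℕ
              f i = # p (rayEdges (Loc.rays v i))
              re : ∀ l s h t q → l + (s + (h + (t + q))) ≡ h + t + (l + s) + q
              re = solve-∀
              total : ∑ f ≡ ∑ (f ∘ iH) + ∑ (f ∘ iT) + (∑ (f ∘ iL) + ∑ (f ∘ iS)) + ∑ (λ (i : Fin 1) → f (16 Fin.↑ʳ i))
              total = trans (∑-split 5 f) (trans (cong (∑ (f ∘ iL) +_) (trans (∑-split 5 (λ i → f (5 Fin.↑ʳ i))) (cong (∑ (f ∘ iS) +_)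
                (trans (∑-split 3 (λ i → f (10 Fin.↑ʳ i))) (cong (∑ (f ∘ iH) +_) (∑-split 3 (λ i → f (13 Fin.↑ʳ i)))))))) (re (∑ (f ∘ iL)) (∑ (f ∘ iS)) (∑ (f ∘ iH)) (∑ (f ∘ iT)) (∑ (λ (i : Fin 1) → f (16 Fin.↑ʳ i)))))

-- Toggles: 5-trails that can be exchanged to correct the parity of degrees

tEdges : ∀ {n} → List (Trail {n}) → List (Edge n)
tEdges = concatMap trailEdges

tEdges-++ : ∀ {n} (xs ys : List (Trail {n})) → tEdges (xs ++ ys) ≡ tEdges xs ++ tEdges ys
tEdges-++ = Lₚ.concatMap-++ trailEdges

-- Both states draw on the same pool, and they differ in parity exactly as by one edge `ends`.
-- Selecting states is thus selecting edges of an auxiliary graph.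
record Toggle {n : ℕ} : Set where
  field
    off on   : List (Trail {n})
    ends     : Edge n
    pool     : List (Edge n)
    fits-off : ∀ p → # p (tEdges off) ≤ # p pool
    fits-on  : ∀ p → # p (tEdges on) ≤ # p pool
    flips   : ∀ v → par v (tEdges on) ≡ par v (tEdges off) xor bd v ends
open Toggle

choose : ∀ {n} (τs : List (Toggle {n})) → Subset (length (L.map ends τs)) → List (Trail {n})
choose [] [] = []
choose (τ ∷ τs) (true ∷ X)  = on τ ++ choose τs X
choose (τ ∷ τs) (false ∷ X) = off τ ++ choose τs X

#-choose : ∀ {n} p (τs : List (Toggle {n})) X → # p (tEdges (choose τs X)) ≤ # p (concatMap pool τs)
#-choose p [] [] = z≤n
#-choose p (τ ∷ τs) (true ∷ X) = ≤-trans (≤-reflexive (trans (cong (# p) (tEdges-++ (on τ) (choose τs X))) (#-++ p (tEdges (on τ)) (tEdges (choose τs X)))))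
  (≤-trans (+-mono-≤ (fits-on τ p) (#-choose p τs X)) (≤-reflexive (sym (#-++ p (pool τ) (concatMap pool τs)))))
#-choose p (τ ∷ τs) (false ∷ X) = ≤-trans (≤-reflexive (trans (cong (# p) (tEdges-++ (off τ) (choose τs X))) (#-++ p (tEdges (off τ)) (tEdges (choose τs X)))))
  (≤-trans (+-mono-≤ (fits-off τ p) (#-choose p τs X)) (≤-reflexive (sym (#-++ p (pool τ) (concatMap pool τs)))))

par-tEdges-++ : ∀ {n} (v : Fin n) xs ys → par v (tEdges (xs ++ ys)) ≡ par v (tEdges xs) xor par v (tEdges ys)
par-tEdges-++ v xs ys = trans (cong (par v) (tEdges-++ xs ys)) (par-++ v (tEdges xs) (tEdges ys))

-- Relative to the position with everything off, the parities change by the boundary of the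
-- auxiliary edges switched on.
par-choose : ∀ {n} (v : Fin n) (τs : List (Toggle {n})) X →
  par v (tEdges (choose τs X)) ≡ par v (tEdges (concatMap off τs)) xor par v (select (V.fromList (L.map ends τs)) X)
par-choose v [] [] = refl
par-choose v (τ ∷ τs) (true ∷ X) = begin
  par v (tEdges (on τ ++ choose τs X))  ≡⟨ par-tEdges-++ v (on τ) (choose τs X) ⟩
  par v (tEdges (on τ)) xor par v (tEdges (choose τs X)) ≡⟨ cong₂ _xor_ (flips τ v) (par-choose v τs X) ⟩
  (o xor bd v (ends τ)) xor (r xor s)  ≡⟨ xor-interchange o (bd v (ends τ)) r s ⟩
  (o xor r) xor (bd v (ends τ) xor s)  ≡⟨ cong (_xor (bd v (ends τ) xor s)) (sym (par-tEdges-++ v (off τ) (concatMap off τs))) ⟩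
  _  ∎
  where
    open ≡-Reasoning
    o = par v (tEdges (off τ))
    r = par v (tEdges (concatMap off τs))
    s = par v (select (V.fromList (L.map ends τs)) X)
par-choose v (τ ∷ τs) (false ∷ X) = begin
  par v (tEdges (off τ ++ choose τs X))  ≡⟨ par-tEdges-++ v (off τ) (choose τs X) ⟩
  o xor par v (tEdges (choose τs X))  ≡⟨ cong (o xor_) (par-choose v τs X) ⟩
  o xor (r xor s)  ≡⟨ sym (Bₚ.xor-assoc o r s) ⟩
  (o xor r) xor s  ≡⟨ cong (_xor s) (sym (par-tEdges-++ v (off τ) (concatMap off τs))) ⟩
  _  ∎
  where
    open ≡-Reasoning
    o = par v (tEdges (off τ))
    r = par v (tEdges (concatMap off τs))
    s = par v (select (V.fromList (L.map ends τs)) X)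

complement : ∀ {n} (es us : List (Edge n)) → (∀ e → # (eqᴱ e) us ≤ # (eqᴱ e) es) → (∀ e → # (eqᴱ e) es ≤ 1) →
  Σ (List (Edge n)) λ W → (W ++ us ↭ es) × (∀ {e} → e ∈ es → # (eqᴱ e) us ≡ 0 → e ∈ W)
complement {n} es us le simple = W , #⇒↭ (λ x e → eqᴱ e x) eqᴱ-refl (λ x e h → sym (eqᴱ-true {e = e} {f = x} h)) (W ++ us) es counts ,
    λ {e} m z → keep-∈ (dec-true (# (eqᴱ e) us Data.Nat.≟ 0) z) m
  where
    unused : Edge n → Bool
    unused e = does (# (eqᴱ e) us Data.Nat.≟ 0)
    W = keep unused es
    at : ∀ e x → unused x ∧ eqᴱ e x ≡ unused e ∧ eqᴱ e x
    at e x with eqᴱ e x in eq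
    ... | true  = cong (λ z → unused z ∧ true) (sym (eqᴱ-true {e = e} {f = x} eq))
    ... | false = trans (Bₚ.∧-zeroʳ (unused x)) (sym (Bₚ.∧-zeroʳ (unused e)))
    constant : ∀ b (p : Edge n → Bool) xs → # (λ x → b ∧ p x) xs ≡ ⟦ b ⟧ * # p xs
    constant true p xs = sym (+-identityʳ _)
    constant false p [] = refl
    constant false p (x ∷ xs) = constant false p xs
    counts : ∀ e → # (eqᴱ e) (W ++ us) ≡ # (eqᴱ e) es
    counts e = trans (#-++ (eqᴱ e) W us) (trans (cong (_+ u) (trans (#-keep unused (eqᴱ e) es) (trans (#-cong (at e) es) (constant (unused e) (eqᴱ e) es)))) (by u refl))
      where
        u = # (eqᴱ e) us
        m = # (eqᴱ e) es
        by : ∀ x → u ≡ x → ⟦ does (u Data.Nat.≟ 0) ⟧ * m + u ≡ m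
        by zero eq rewrite eq = trans (+-identityʳ _) (+-identityʳ m)
        by (suc x) eq = trans (cong (_+ u) (cong (λ b → ⟦ b ⟧ * m) (dec-false (u Data.Nat.≟ 0) (λ z → 0≢1+n (trans (sym z) eq)))))
          (≤-antisym (le e) (≤-trans (simple e) (≤-trans (s≤s z≤n) (≤-reflexive (sym eq)))))

length-chunks : ∀ {A B : Set} (g : A → List B) → (∀ x → length (g x) ≡ 5) → ∀ xs → length (concatMap g xs) ≡ length xs * 5
length-chunks g h [] = refl
length-chunks g h (x ∷ xs) = trans (Lₚ.length-++ (g x)) (cong₂ _+_ (h x) (length-chunks g h xs))

module Toggles {n : ℕ} (G : Graph n) (side : Fin n → Bool) (β₀ : ℕ) where
  open Sides side β₀
  open Rays G side β₀

  xor-last : ∀ a b c d x → a xor (b xor (c xor (d xor (x xor false)))) ≡ (a xor (b xor (c xor d))) xor x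
  xor-last a b c d x = begin
    a xor (b xor (c xor (d xor (x xor false)))) ≡⟨ cong (λ z → a xor (b xor (c xor (d xor z)))) (Bₚ.xor-identityʳ x) ⟩
    a xor (b xor (c xor (d xor x)))  ≡⟨ cong (λ z → a xor (b xor z)) (sym (Bₚ.xor-assoc c d x)) ⟩
    a xor (b xor ((c xor d) xor x))  ≡⟨ cong (a xor_) (sym (Bₚ.xor-assoc b (c xor d) x)) ⟩
    a xor ((b xor (c xor d)) xor x)  ≡⟨ sym (Bₚ.xor-assoc a (b xor (c xor d)) x) ⟩
    (a xor (b xor (c xor d))) xor x  ∎
    where open ≡-Reasoning

  -- One of the two edges of the link completes the stub at its centre to a 5-trail.
  linkToggle : (l : Link {n}) → Ray (Link.b l) → Toggle {n}
  linkToggle l ρ = record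
    { off = trail f₄ f₃ f₂ f₁ f (flip k₄) (flip k₃) (flip k₂) (flip k₁) (flip jf) ∷ []
    ; on  = trail f₄ f₃ f₂ f₁ g (flip k₄) (flip k₃) (flip k₂) (flip k₁) jg ∷ []
    ; ends = a , a′
    ; pool = linkEdges l ++ rayEdges ρ
    ; fits-off = λ p → ≤-trans (m≤m+n _ (⟦ p g ⟧ + ⟦ p f₅ ⟧)) (≤-reflexive (re ⟦ p f₁ ⟧ ⟦ p f₂ ⟧ ⟦ p f₃ ⟧ ⟦ p f₄ ⟧ ⟦ p f₅ ⟧ ⟦ p f ⟧ ⟦ p g ⟧))
    ; fits-on  = λ p → ≤-trans (m≤m+n _ (⟦ p f ⟧ + ⟦ p f₅ ⟧)) (≤-reflexive (re′ ⟦ p f₁ ⟧ ⟦ p f₂ ⟧ ⟦ p f₃ ⟧ ⟦ p f₄ ⟧ ⟦ p f₅ ⟧ ⟦ p f ⟧ ⟦ p g ⟧))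
    ; flips = λ v → begin
        bd v f₄ xor (bd v f₃ xor (bd v f₂ xor (bd v f₁ xor (bd v g xor false))))  ≡⟨ xor-last (bd v f₄) (bd v f₃) (bd v f₂) (bd v f₁) (bd v g) ⟩
        K v xor bd v g  ≡⟨ sym (xor-chain (K v) (bd v f) (bd v g)) ⟩
        (K v xor bd v f) xor (bd v f xor bd v g)  ≡⟨ cong₂ _xor_ (sym (xor-last (bd v f₄) (bd v f₃) (bd v f₂) (bd v f₁) (bd v f)))
                                                                                      (trans (cong₂ _xor_ (bd-joins jf v) (bd-joins jg v)) (xor-chain (a == v) (b == v) (a′ == v))) ⟩
        (bd v f₄ xor (bd v f₃ xor (bd v f₂ xor (bd v f₁ xor (bd v f xor false))))) xor bd v (a , a′) ∎
    }
    where
      open Link l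
      open Ray ρ
      open ≡-Reasoning
      K : Fin n → Bool
      K v = bd v f₄ xor (bd v f₃ xor (bd v f₂ xor bd v f₁))
      re : ∀ a b c d e x y → (d + (c + (b + (a + (x + 0))))) + (y + e) ≡ x + (y + (a + (b + (c + (d + (e + 0))))))
      re = solve-∀
      re′ : ∀ a b c d e x y → (d + (c + (b + (a + (y + 0))))) + (x + e) ≡ x + (y + (a + (b + (c + (d + (e + 0))))))
      re′ = solve-∀

  -- The boundaries of consecutive edges telescope to the two ends of the ray.
  rayToggle : ∀ {v} → Ray v → Toggle {n}
  rayToggle {v} ρ = record
    { off = [] ; on = trail f₁ f₂ f₃ f₄ f₅ k₁ k₂ k₃ k₄ k₅ ∷ [] ; ends = v , r₅ ; pool = rayEdges ρ
    ; fits-off = λ p → z≤n ; fits-on = λ p → ≤-refl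
    ; flips = λ w → add w r₅ k₁ (add w r₅ k₂ (add w r₅ k₃ (add w r₅ k₄ (trans (Bₚ.xor-identityʳ (bd w f₅)) (bd-joins k₅ w)))))
    }
    where
      open Ray ρ
      add : ∀ w c {a b e x} → SameEdge (a , b) e → x ≡ (b == w) xor (c == w) → bd w e xor x ≡ (a == w) xor (c == w)
      add w c {a} {b} j q = trans (cong₂ _xor_ (bd-joins j w) q) (xor-chain (a == w) (b == w) (c == w))

  linkToggles : ∀ ls (as : All (Branch 5) (centres ls)) → Bounded (edgesᵃ as) →
    Σ (List (Toggle {n})) λ τs → (L.map ends τs ≡ L.map (λ l → Link.a l , Link.a′ l) ls) ×
      (∀ p → # p (concatMap pool τs) ≤ # p (concatMap linkEdges ls) + # p (edgesᵃ as))
  linkToggles [] [] inv = [] , refl , λ p → z≤n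
  linkToggles (l ∷ ls) (b ∷ as) inv =
    let τs , q , h = linkToggles ls as (Bounded-≤ (edgesᵃ as) (edgesᵇ b ++ edgesᵃ as) (λ p → ≤-trans (m≤n+m (# p (edgesᵃ as)) (# p (edgesᵇ b))) (≤-reflexive (sym (#-++ p (edgesᵇ b) (edgesᵃ as))))) inv)
        R = pickRay b [] (s≤s z≤n) (Bounded-≤ (edgesᵇ b) (edgesᵇ b ++ edgesᵃ as) (λ p → ≤-trans (m≤m+n (# p (edgesᵇ b)) (# p (edgesᵃ as))) (≤-reflexive (sym (#-++ p (edgesᵇ b) (edgesᵃ as))))) inv)
        ρ = PickedRay.theRay R
    in linkToggle l ρ ∷ τs , cong ((Link.a l , Link.a′ l) ∷_) q , λ p → begin
      # p ((linkEdges l ++ rayEdges ρ) ++ concatMap pool τs)  ≡⟨ trans (#-++ p (linkEdges l ++ rayEdges ρ) (concatMap pool τs)) (cong (_+ # p (concatMap pool τs)) (#-++ p (linkEdges l) (rayEdges ρ))) ⟩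
      # p (linkEdges l) + # p (rayEdges ρ) + # p (concatMap pool τs)  ≤⟨ +-mono-≤ (+-monoʳ-≤ (# p (linkEdges l)) (PickedRay.count R p)) (h p) ⟩
      # p (linkEdges l) + # p (edgesᵇ b) + (# p (concatMap linkEdges ls) + # p (edgesᵃ as)) ≡⟨ +-interchange (# p (linkEdges l)) (# p (edgesᵇ b)) (# p (concatMap linkEdges ls)) (# p (edgesᵃ as)) ⟩
      (# p (linkEdges l) + # p (concatMap linkEdges ls)) + (# p (edgesᵇ b) + # p (edgesᵃ as)) ≡⟨ sym (cong₂ _+_ (#-++ p (linkEdges l) (concatMap linkEdges ls)) (#-++ p (edgesᵇ b) (edgesᵃ as))) ⟩
      # p (linkEdges l ++ concatMap linkEdges ls) + # p (edgesᵇ b ++ edgesᵃ as)  ∎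
    where open ≤-Reasoning

-- Assembling the decomposition

module Finish {n″ : ℕ} (G : Graph (suc (suc n″))) (β₀ : ℕ) (β≥70 : 70 ≤ suc β₀) (side : Fin (suc (suc n″)) → Bool) (H : List (Edge (suc (suc n″))))
  (H-cross : All (λ e → cross side e ≡ true) H)
  (cut-H : ∀ X {u v} → X u ≡ true → X v ≡ false → Numbers.k β₀ 16 ≤ 2 * # (cross X) H)
  (H≤ : ∀ p → # p H ≤ # p (edges G))
  (S : Build.Setup β₀ 16 side H H-cross cut-H)
  (div : 5 ∣ length (edges G)) where

  n : ℕ
  n = suc (suc n″)

  open Sides side β₀
  open Rays G side β₀
  open Toggles G side β₀
  open Build.Setup S

  edgeBound : ∀ xs → (∀ p → # p xs ≤ # p H) → Bounded xs
  edgeBound xs h e = ≤-trans (h (eqᴱ e)) (H≤ (eqᴱ e))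

  owned : (Edge n → Bool) → ℕ
  owned p = ∑ (λ v → # p (edgesᵛ (own v)))

  private≤ : ∀ p → owned p + # p (edgesᵃ linkB) ≤ # p H
  private≤ p = ≤-trans (≤-trans (m≤n+m (owned p + # p (edgesᵃ linkB)) (# p T₃)) (m≤n+m (# p T₃ + (owned p + # p (edgesᵃ linkB))) (# p (concatMap linkEdges ls)))) (bound p)

  own≤ : ∀ v p → # p (edgesᵛ (own v)) ≤ # p H
  own≤ v p = ≤-trans (∑-term (λ v → # p (edgesᵛ (own v))) v) (≤-trans (m≤m+n (owned p) (# p (edgesᵃ linkB))) (private≤ p))

  opaque
    loc : ∀ v → Local v (own v)
    loc v = carve β≥70 v (own v) (edgeBound (edgesᵛ (own v)) (own≤ v))

  open Carved own loc

  opaque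
    linkTs : Σ (List (Toggle {n})) λ τs → (L.map ends τs ≡ L.map (λ l → Link.a l , Link.a′ l) ls) ×
      (∀ p → # p (concatMap pool τs) ≤ # p (concatMap linkEdges ls) + # p (edgesᵃ linkB))
    linkTs = linkToggles ls linkB (edgeBound (edgesᵃ linkB) (λ p → ≤-trans (m≤n+m (# p (edgesᵃ linkB)) (owned p)) (private≤ p)))

  τ₁ τ₂ τs : List (Toggle {n})
  τ₁ = proj₁ linkTs
  τ₂ = L.tabulate (λ v → rayToggle (spare v))
  τs = τ₁ ++ τ₂

  spares : (Edge n → Bool) → ℕ
  spares p = ∑ (λ v → # p (rayEdges (spare v)))

  pools≤ : ∀ p → # p (concatMap pool τs) ≤ (# p (concatMap linkEdges ls) + # p (edgesᵃ linkB)) + spares p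
  pools≤ p = ≤-trans (≤-reflexive (#-concatMap-++ p pool τ₁ τ₂)) (+-mono-≤ (proj₂ (proj₂ linkTs) p) (≤-reflexive (#-concatMap-tabulate p pool (λ v → rayToggle (spare v)))))

  spare≤ : ∀ v p → # p (rayEdges (spare v)) ≤ # p H
  spare≤ v p = ≤-trans (∑-term (λ v → # p (rayEdges (spare v))) v) (≤-trans (m≤n+m (spares p) (Reserves.weight reserves p))
    (≤-trans (weight≤ p) (≤-trans (m≤m+n (owned p) (# p (edgesᵃ linkB))) (private≤ p))))

  -- Each of the five edges changes sides, and five is odd. So the spare ray connects a vertex of B
  -- to A in the auxiliary graph.
  far-side : ∀ v → side v ≡ false → side (Ray.r₅ (spare v)) ≡ true
  far-side v h = trans (cj (there (there (there (there (here refl))))) k₅) (cong not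
    (trans (cj (there (there (there (here refl)))) k₄) (cong not
    (trans (cj (there (there (here refl))) k₃) (cong not
    (trans (cj (there (here refl)) k₂) (cong not
    (trans (cj (here refl) k₁) (cong not h)))))))))
    where
      open Ray (spare v)
      cj : ∀ {e a b} → e ∈ rayEdges (spare v) → SameEdge (a , b) e → side b ≡ not (side a)
      cj m j = cross-joins (All.lookup H-cross (sub-∈ (spare≤ v) m)) j

  endsList : List (Edge n)
  endsList = L.map ends τs

  all-linked : All (λ τ → Linked endsList (proj₁ (ends τ)) (proj₂ (ends τ))) τs
  all-linked = Allₚ.map⁻ (linked-edges endsList)

  eqv : IsEquivalence (Linked endsList)
  eqv = linked-isEquivalence endsList

  links-linked : All (λ l → Linked endsList (Link.a l) (Link.a′ l)) ls
  links-linked = Allₚ.map⁻ (subst (All (λ e → Linked endsList (proj₁ e) (proj₂ e))) (proj₁ (proj₂ linkTs)) (Allₚ.map⁺ (Allₚ.++⁻ˡ τ₁ all-linked)))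

  spare-linked : ∀ v → Linked endsList v (Ray.r₅ (spare v))
  spare-linked = Allₚ.tabulate⁻ {f = λ v → rayToggle (spare v)} (Allₚ.++⁻ʳ τ₁ all-linked)

  -- The links connect A, and the spare ray at a vertex of B attaches it to A.
  linked : ∀ u w → Linked endsList u w
  linked u w = IsEquivalence.trans eqv {u} {proj₁ (rep u)} {w} (proj₂ (proj₂ (rep u))) (IsEquivalence.trans eqv {proj₁ (rep u)} {proj₁ (rep w)} {w}
      (joined eqv links-linked (proj₁ (rep u)) (proj₁ (rep w)) (proj₁ (proj₂ (rep u))) (proj₁ (proj₂ (rep w))))
      (IsEquivalence.sym eqv {w} {proj₁ (rep w)} (proj₂ (proj₂ (rep w)))))
    where
      by : ∀ v b → side v ≡ b → ∃ λ x → side x ≡ true × Linked endsList v x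
      by v true  h = v , h , IsEquivalence.refl eqv {v}
      by v false h = Ray.r₅ (spare v) , far-side v h , spare-linked v
      rep : ∀ v → ∃ λ x → side x ≡ true × Linked endsList v x
      rep v = by v (side v) refl

  module R = Reserves reserves

  reserved₁ : Fin n → Fin 3 → List (Edge n)
  reserved₁ u i = headEdges G (R.heads u i) ++ tailEdges G (R.tails u i)

  reserved₂ : Fin n → Fin 5 → List (Edge n)
  reserved₂ v i = leafEdges G (R.leaves v i) ++ stubEdges G (R.stubs v i)

  opaque
    reservedEdges : List (Edge n)
    reservedEdges = concatMap id (flat reserved₁) ++ concatMap id (flat reserved₂)

    #-reserved : ∀ p → # p reservedEdges ≡ R.weight p
    #-reserved p = trans (#-++ p (concatMap id (flat reserved₁)) _) (cong₂ _+_
      (trans (#-flat p id reserved₁) (∑-cong λ u → ∑-cong λ i → #-++ p (headEdges G (R.heads u i)) (tailEdges G (R.tails u i))))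
      (trans (#-flat p id reserved₂) (∑-cong λ u → ∑-cong λ i → #-++ p (leafEdges G (R.leaves u i)) (stubEdges G (R.stubs u i)))))

    5∣reserved : 5 ∣ length reservedEdges
    5∣reserved = subst (5 ∣_) (sym (Lₚ.length-++ (concatMap id (flat reserved₁))))
      (∣m∣n⇒∣m+n (flat-length reserved₁ (λ _ _ → refl)) (flat-length reserved₂ (λ _ _ → refl)))
      where
        flat-length : ∀ {r} (f : Fin n → Fin r → List (Edge n)) → (∀ u i → length (f u i) ≡ 5) → 5 ∣ length (concatMap id (flat f))
        flat-length f h = all-5 (All-flat {P = λ xs → length xs ≡ 5} {f = f} h)
          where all-5 : ∀ {xss : List (List (Edge n))} → All (λ xs → length xs ≡ 5) xss → 5 ∣ length (concatMap id xss)
                all-5 [] = divides 0 refl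
                all-5 {xs ∷ xss} (q ∷ qs) = subst (5 ∣_) (sym (trans (Lₚ.length-++ xs) (cong (_+ length (concatMap id xss)) q))) (∣m∣n⇒∣m+n (divides 1 refl) (all-5 qs))

  baseEdges : List (Edge n)
  baseEdges = tEdges (concatMap off τs)

  opaque
    -- The join must compensate the parities of G, of the trails removed with everything off, and of
    -- the reserved paths. What is removed then has the same odd vertices as G.
    selection : Realizable endsList (λ v → par v (edges G ++ (baseEdges ++ reservedEdges)))
    selection = parity-join {ls = endsList} linked (edges G ++ (baseEdges ++ reservedEdges))

  chosen : List (Trail {n})
  chosen = choose τs (proj₁ selection)

  used : List (Edge n)
  used = tEdges chosen ++ reservedEdges

  used≤ : ∀ p → # p used + # p T₃ ≤ # p H
  used≤ p = begin
    # p used + t  ≡⟨ cong (_+ t) (trans (#-++ p (tEdges chosen) reservedEdges) (cong (# p (tEdges chosen) +_) (#-reserved p))) ⟩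
    # p (tEdges chosen) + R.weight p + t  ≤⟨ +-monoˡ-≤ t (+-monoˡ-≤ (R.weight p) (≤-trans (#-choose p τs (proj₁ selection)) (pools≤ p))) ⟩
    l + b + spares p + R.weight p + t  ≡⟨ re l b (spares p) (R.weight p) t ⟩
    l + (t + ((R.weight p + spares p) + b)) ≤⟨ +-monoʳ-≤ l (+-monoʳ-≤ t (+-monoˡ-≤ b (weight≤ p))) ⟩
    l + (t + (owned p + b))  ≤⟨ bound p ⟩
    # p H  ∎
    where
      open ≤-Reasoning
      t = # p T₃
      l = # p (concatMap linkEdges ls)
      b = # p (edgesᵃ linkB)
      re : ∀ l b s w t → l + b + s + w + t ≡ l + (t + ((w + s) + b))
      re = solve-∀

  used-par : ∀ v → par v used ≡ par v (edges G)
  used-par v = begin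
    par v (tEdges chosen ++ reservedEdges)  ≡⟨ par-++ v (tEdges chosen) reservedEdges ⟩
    par v (tEdges chosen) xor r  ≡⟨ cong (_xor r) (par-choose v τs (proj₁ selection)) ⟩
    (o xor _) xor r  ≡⟨ cong (λ z → (o xor z) xor r) (trans (proj₂ selection v) (trans (par-++ v (edges G) (baseEdges ++ reservedEdges)) (cong (g xor_) (par-++ v baseEdges reservedEdges)))) ⟩
    (o xor (g xor (o xor r))) xor r  ≡⟨ simplify o g r ⟩
    g  ∎
    where
      open ≡-Reasoning
      o = par v baseEdges
      r = par v reservedEdges
      g = par v (edges G)
      simplify : ∀ o g r → (o xor (g xor (o xor r))) xor r ≡ g
      simplify true true true = refl
      simplify true true false = refl
      simplify true false true = refl
      simplify true false false = refl
      simplify false true true = refl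
      simplify false true false = refl
      simplify false false true = refl
      simplify false false false = refl

  opaque
    rest : Σ (List (Edge n)) λ W → (W ++ used ↭ edges G) × (∀ {e} → e ∈ edges G → # (eqᴱ e) used ≡ 0 → e ∈ W)
    rest = complement (edges G) used (λ e → ≤-trans (m≤m+n (# (eqᴱ e) used) (# (eqᴱ e) T₃)) (≤-trans (used≤ (eqᴱ e)) (H≤ (eqᴱ e)))) (#-edges≤1 G)

  W : List (Edge n)
  W = proj₁ rest

  W-even : ∀ v → par v W ≡ false
  W-even v = cancel (par v W) (par v (edges G)) (trans (cong (par v W xor_) (sym (used-par v))) (trans (sym (par-++ v W used)) (par-↭ v (proj₁ (proj₂ rest)))))
    where cancel : ∀ a b → a xor b ≡ b → a ≡ false
          cancel false b _ = refl
          cancel true true ()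
          cancel true false ()

  -- An edge of G occurs only once in its edge list, so an edge counted in T₃ cannot be used as
  -- well; by `complement` it stays in W.
  T₃⊆W : ∀ {e} → e ∈ T₃ → e ∈ W
  T₃⊆W {e} m = proj₂ (proj₂ rest) (sub-∈ (λ p → ≤-trans (m≤n+m (# p T₃) (# p used)) (≤-trans (used≤ p) (H≤ p))) m)
    (n≤0⇒n≡0 (+-cancelʳ-≤ 1 (# (eqᴱ e) used) 0 (≤-trans (+-monoʳ-≤ (# (eqᴱ e) used) (#-pos {p = eqᴱ e} (eqᴱ-refl e) m)) (≤-trans (used≤ (eqᴱ e)) (≤-trans (H≤ (eqᴱ e)) (#-edges≤1 G e))))))

  W-connected : Connected′ W
  W-connected E a = conn₃ E (All.tabulate λ m → All.lookup a (T₃⊆W m))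

  5∣W : 5 ∣ length W
  5∣W = ∣m+n∣m⇒∣n (subst (5 ∣_) (trans (sym (Permₚ.↭-length (proj₁ (proj₂ rest)))) (trans (Lₚ.length-++ W) (+-comm (length W) (length used)))) div)
    (subst (5 ∣_) (sym (Lₚ.length-++ (tEdges chosen))) (∣m∣n⇒∣m+n (divides (length chosen) (length-chunks trailEdges (λ _ → refl) chosen)) 5∣reserved))

  opaque
    pieces : Σ (List (Trail {n})) λ Ts → tEdges Ts ↭ W
    pieces =
      let w , perm = euler zero W W-connected W-even
          Ts , q = chunk (quotient 5∣W) w (trans (Permₚ.↭-length perm) (_∣_.equality 5∣W))
      in Ts , ↭-trans (↭-reflexive q) perm

  trails : List (Trail {n})
  trails = proj₁ pieces ++ chosen

  exact : ∀ e → # (eqᴱ e) (tEdges trails) + R.weight (eqᴱ e) ≡ mult G e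
  exact e = begin
    # p (tEdges trails) + R.weight p  ≡⟨ cong₂ _+_ (trans (cong (# p) (tEdges-++ (proj₁ pieces) chosen)) (#-++ p (tEdges (proj₁ pieces)) (tEdges chosen))) (sym (#-reserved p)) ⟩
    # p (tEdges (proj₁ pieces)) + # p (tEdges chosen) + # p reservedEdges ≡⟨ cong (λ z → z + # p (tEdges chosen) + # p reservedEdges) (#-↭ p (proj₂ pieces)) ⟩
    # p W + # p (tEdges chosen) + # p reservedEdges  ≡⟨ +-assoc (# p W) (# p (tEdges chosen)) (# p reservedEdges) ⟩
    # p W + (# p (tEdges chosen) + # p reservedEdges)  ≡⟨ cong (# p W +_) (sym (#-++ p (tEdges chosen) reservedEdges)) ⟩
    # p W + # p used  ≡⟨ sym (#-++ p W used) ⟩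
    # p (W ++ used)  ≡⟨ #-↭ p (proj₁ (proj₂ rest)) ⟩
    mult G e  ∎
    where open ≡-Reasoning
          p = eqᴱ e

  conclusion : P5Decomposition G
  conclusion = Final.decomposition G trails reserves exact

large : ∀ {n″} (G : Graph (suc (suc n″))) → EdgeConnected (Numbers.k 69 16) G → 5 ∣ length (edges G) → P5Decomposition G
large G conn div = Finish.conclusion G 69 ≤-refl σ H H-cross cut-H H≤ (Build.setup 69 16 σ H H-cross cut-H) div
  where
    σ = proj₁ (maxCut (edges G))
    H = keep (cross σ) (edges G)
    H-cross : All (λ e → cross σ e ≡ true) H
    H-cross = All.tabulate λ m → proj₁ (keep-true (edges G) m)
    cut-H : ∀ X {u v} → X u ≡ true → X v ≡ false → Numbers.k 69 16 ≤ 2 * # (cross X) H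
    cut-H X {u} {v} p r = ≤-trans (cut≥ G conn X {u} {v} p r) (proj₂ (maxCut (edges G)) X)
    H≤ : ∀ p → # p H ≤ # p (edges G)
    H≤ p = ≤-trans (≤-reflexive (#-keep (cross σ) p (edges G))) (#-mono (λ e → below (cross σ e) (p e)) (edges G))
      where below : ∀ a b → (a ∧ b) B.≤ b
            below true b = b≤b
            below false b = Bₚ.≤-minimum b

theorem4p1 : Σ ℕ λ k → ∀ (n : ℕ) (G : Graph n) → EdgeConnected k G → 5 ∣ length (edges G) → P5Decomposition G
-- 69 and 16 are the predecessors of the branching 70, needed in `carve`, and of the 17 rays per
-- vertex.
theorem4p1 = Numbers.k 69 16 , decompose
  where
    decompose : ∀ n (G : Graph n) → EdgeConnected (Numbers.k 69 16) G → 5 ∣ length (edges G) → P5Decomposition G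
    -- With at most one vertex there are no edges. The main argument assumes two vertices, so that
    -- each vertex is separated from another by a cut.
    decompose zero G conn div = [] , λ { (() , _) }
    decompose (suc zero) G conn div = [] , λ { (zero , zero) m → case proj₁ (∈-edges⁻ G {zero} {zero} m) of λ () }
    decompose (suc (suc n″)) G conn div = large G conn div
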